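{- There is a polynomial-time algorithm that, given a formula of existential Presburger arithmetic ($\exists\mathrm{PA}$), constructs an equivalent formula of bounded existential Presburger arithmetic ($\exists^{\le}\mathrm{PA}$) with the same free variables.
   Context: Presburger arithmetic (PA) is the first-order theory of $\langle \mathbb{Z};+,<,(\equiv_m)_{m\in\mathbb{Z}},0,1\rangle$. Atomic formulas are linear inequalities $a_1x_1+\cdots+a_nx_n\le b$ and modulo constraints $a_1x_1+\cdots+a_nx_n\equiv b \pmod{m}$, with integer constants $a_i,b,m$ written in binary. A formula is quantifier-free if it is a Boolean combination of atoms. An $\exists\mathrm{PA}$ formula has the form $\exists x_1\cdots\exists x_k\colon \varphi$ with $\varphi$ quantifier-free. The size $|\varphi|$ of a formula is the number of symbols used to write it, constants in binary. An $\exists^{\le}\mathrm{PA}$ formula over free variables $y_1,\dots,y_m$ has the form $\exists^{\le k_1}x_1\cdots\exists^{\le k_n}x_n\colon\varphi$, where each $k_i\in\mathbb{N}$ is given in binary, $\exists^{\le k_i}x_i$ means "there exists $x_i\in\mathbb{Z}$ with $|x_i|\le k_i$", and $\varphi$ is a Boolean combination of atoms of the forms $\sum_{i=1}^m p_iy_i\le q$ or $\sum_{i=1}^m p_iy_i\equiv r\pmod{q}$ with $p_1,\dots,p_m,q,r\in\mathbb{Z}[x_1,\dots,x_n]$ polynomials (written explicitly, coefficients in binary). Two formulas are equivalent if they define the same set of assignments to the free variables over $\mathbb{Z}$. -}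

module Defs where

open import Algebra.Properties.CommutativeMonoid.Sum using (sum)
open import Data.Fin.Base using (Fin; toℕ)
open import Data.Integer.Base as ℤ using (ℤ; +_; -[1+_]; ∣_∣)
open import Data.Integer.Divisibility as ℤ using ()
open import Data.Integer.Properties using (+-0-commutativeMonoid)
open import Data.List.Base as List using (List; []; _∷_)
open import Data.Nat.Base using (ℕ; suc; _+_; _≤_; s≤s)
open import Data.Nat.Binary.Base as ℕᵇ using (ℕᵇ; 2[1+_]; 1+[2_])
open import Data.Nat.Properties
  using (≤-refl; ≤-trans; m≤m+n; m≤n+m; n≤1+n; +-mono-≤)
open import Data.Product.Base using (_×_; _,_; ∃-syntax)
open import Data.Sum.Base using (_⊎_)
open import Data.Vec.Base as Vec using (Vec; lookup; toList)
open import Data.Vec.Functional using (Vector; _++_)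
open import Function.Base using (id)
open import Relation.Nullary.Negation.Core using (¬_)

------------------------------------------------------------------------
-- Quantifier-free formulas

-- An atom is linear in m variables.  Its coefficients, right-hand side
-- and modulus are drawn from C, which is ℤ for ordinary Presburger
-- formulas and a set of polynomials for bounded ones.

data Atom (C : Set) (m : ℕ) : Set where
  _⊴_     : (a : Vec C m) (b : C) → Atom C m
  _≋_mod_ : (a : Vec C m) (b q : C) → Atom C m

data QF (C : Set) (m : ℕ) : Set where
  atom    : Atom C m → QF C m
  _∧_ _∨_ : QF C m → QF C m → QF C m
  ~_      : QF C m → QF C m

-- Congruence modulo 0 is equality, and the sign of the modulus is
-- irrelevant.

_≡_[mod_] : ℤ → ℤ → ℤ → Set
a ≡ b [mod q ] = q ℤ.∣ (a ℤ.- b)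

-- ⟦ φ ⟧ val y: the formula φ holds at y when each constant c : C is read
-- as the integer val c.

module _ {C : Set} {m : ℕ} where

  linear : Vec C m → (C → ℤ) → Vector ℤ m → ℤ
  linear a val y =
    sum +-0-commutativeMonoid (λ i → val (lookup a i) ℤ.* y i)

  ⟦_⟧ᵃ : Atom C m → (C → ℤ) → Vector ℤ m → Set
  ⟦ a ⊴ b ⟧ᵃ       val y = linear a val y ℤ.≤ val b
  ⟦ a ≋ b mod q ⟧ᵃ val y = linear a val y ≡ val b [mod val q ]

  ⟦_⟧ : QF C m → (C → ℤ) → Vector ℤ m → Set
  ⟦ atom α ⟧ val y = ⟦ α ⟧ᵃ val y
  ⟦ φ ∧ ψ ⟧  val y = ⟦ φ ⟧ val y × ⟦ ψ ⟧ val y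
  ⟦ φ ∨ ψ ⟧  val y = ⟦ φ ⟧ val y ⊎ ⟦ ψ ⟧ val y
  ⟦ ~ φ ⟧    val y = ¬ ⟦ φ ⟧ val y

------------------------------------------------------------------------
-- Existential Presburger arithmetic

-- Variables 0 … k-1 of the matrix are quantified, the last m are free.

record ∃PA (m : ℕ) : Set where
  constructor ∃^_∶_
  field
    k      : ℕ
    matrix : QF ℤ (k + m)

_⊨∃_ : ∀ {m} → Vector ℤ m → ∃PA m → Set
y ⊨∃ (∃^ k ∶ φ) = ∃[ x ] ⟦ φ ⟧ id (_++_ {m = k} x y)

------------------------------------------------------------------------
-- Bounded existential Presburger arithmetic

-- Explicitly written polynomials in ℤ[x₀,…,xₙ₋₁]: sums of monomials
-- c·xᵢ·xⱼ⋯, in which a power of a variable is spelled out as a repeated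
-- product.

Monomial : ℕ → Set
Monomial n = ℤ × List (Fin n)

Poly : ℕ → Set
Poly n = List (Monomial n)

evalMonomial : ∀ {n} → Vector ℤ n → Monomial n → ℤ
evalMonomial x (c , is) = List.foldr (λ i r → x i ℤ.* r) c is

evalPoly : ∀ {n} → Vector ℤ n → Poly n → ℤ
evalPoly x = List.foldr (λ t r → evalMonomial x t ℤ.+ r) (+ 0)

record ∃≤PA (m : ℕ) : Set where
  constructor ∃≤^_∶_
  field
    {n}    : ℕ
    bounds : Vec ℕ n
    matrix : QF (Poly n) m

_⊨∃≤_ : ∀ {m} → Vector ℤ m → ∃≤PA m → Set
y ⊨∃≤ (∃≤^ bounds ∶ φ) =
  ∃[ x ] (∀ i → ∣ x i ∣ ≤ lookup bounds i) × ⟦ φ ⟧ (evalPoly x) y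

------------------------------------------------------------------------
-- Model of computation: while programs on binary trees

data Tree : Set where
  nil : Tree
  _∙_ : Tree → Tree → Tree

infixr 5 _∙_

size : Tree → ℕ
size nil     = 1
size (s ∙ t) = suc (size s + size t)

-- A program transforms a single tree; in "cons P Q" both P and Q start
-- from the current tree.  In tests, nil is false and all else is true.

data Program : Set where
  skip mknil hd tl : Program
  cons             : Program → Program → Program
  _⨾_              : Program → Program → Program
  if               : Program → Program → Program → Program
  while            : Program → Program → Program

infixr 4 _⨾_

-- P ⊢ s ⇓ t ⟨ c ⟩: started on s, the program P halts with t at cost c.
-- Every executed instruction is charged the size of the whole tree it is
-- applied to.  With unit costs, sharing would allow outputs of size
-- exponential in the cost; here output≤cost excludes this, and costs
-- agree with Turing machine running times up to a polynomial.

infix 3 _⊢_⇓_⟨_⟩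

data _⊢_⇓_⟨_⟩ : Program → Tree → Tree → ℕ → Set where

  skip   : ∀ {s} → skip ⊢ s ⇓ s ⟨ size s ⟩

  mknil  : ∀ {s} → mknil ⊢ s ⇓ nil ⟨ size s ⟩

  hd-nil : hd ⊢ nil ⇓ nil ⟨ size nil ⟩
  hd-∙   : ∀ {s t} → hd ⊢ s ∙ t ⇓ s ⟨ size (s ∙ t) ⟩

  tl-nil : tl ⊢ nil ⇓ nil ⟨ size nil ⟩
  tl-∙   : ∀ {s t} → tl ⊢ s ∙ t ⇓ t ⟨ size (s ∙ t) ⟩

  cons   : ∀ {P Q s t u c d} →
           P ⊢ s ⇓ t ⟨ c ⟩ → Q ⊢ s ⇓ u ⟨ d ⟩ →
           cons P Q ⊢ s ⇓ t ∙ u ⟨ size s + (c + d) ⟩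

  seq    : ∀ {P Q s t u c d} →
           P ⊢ s ⇓ t ⟨ c ⟩ → Q ⊢ t ⇓ u ⟨ d ⟩ →
           P ⨾ Q ⊢ s ⇓ u ⟨ size s + (c + d) ⟩

  if-true     : ∀ {B P Q s t b b′ c d} →
                B ⊢ s ⇓ b ∙ b′ ⟨ c ⟩ → P ⊢ s ⇓ t ⟨ d ⟩ →
                if B P Q ⊢ s ⇓ t ⟨ size s + (c + d) ⟩

  if-false    : ∀ {B P Q s t c d} →
                B ⊢ s ⇓ nil ⟨ c ⟩ → Q ⊢ s ⇓ t ⟨ d ⟩ →
                if B P Q ⊢ s ⇓ t ⟨ size s + (c + d) ⟩

  while-true  : ∀ {B P s t u b b′ c d e} →
                B ⊢ s ⇓ b ∙ b′ ⟨ c ⟩ → P ⊢ s ⇓ t ⟨ d ⟩ →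
                while B P ⊢ t ⇓ u ⟨ e ⟩ →
                while B P ⊢ s ⇓ u ⟨ size s + (c + (d + e)) ⟩

  while-false : ∀ {B P s c} →
                B ⊢ s ⇓ nil ⟨ c ⟩ →
                while B P ⊢ s ⇓ s ⟨ size s + c ⟩

1≤size : ∀ s → 1 ≤ size s
1≤size nil     = ≤-refl
1≤size (s ∙ t) = s≤s (m≤m+n 0 _)

output≤cost : ∀ {P s t c} → P ⊢ s ⇓ t ⟨ c ⟩ → size t ≤ c
output≤cost skip           = ≤-refl
output≤cost (mknil {s})    = 1≤size s
output≤cost hd-nil         = ≤-refl
output≤cost (hd-∙ {s} {t}) = ≤-trans (m≤m+n (size s) (size t)) (n≤1+n _)
output≤cost tl-nil         = ≤-refl
output≤cost (tl-∙ {s} {t}) = ≤-trans (m≤n+m (size t) (size s)) (n≤1+n _)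
output≤cost (cons {s = s} p q) =
  +-mono-≤ (1≤size s) (+-mono-≤ (output≤cost p) (output≤cost q))
output≤cost (seq {s = s} {c = c} p q) =
  ≤-trans (output≤cost q) (≤-trans (m≤n+m _ c) (m≤n+m _ (size s)))
output≤cost (if-true {s = s} {c = c} b p) =
  ≤-trans (output≤cost p) (≤-trans (m≤n+m _ c) (m≤n+m _ (size s)))
output≤cost (if-false {s = s} {c = c} b p) =
  ≤-trans (output≤cost p) (≤-trans (m≤n+m _ c) (m≤n+m _ (size s)))
output≤cost (while-true {s = s} {c = c} {d = d} b p w) =
  ≤-trans (output≤cost w)
    (≤-trans (m≤n+m _ d) (≤-trans (m≤n+m _ c) (m≤n+m _ (size s))))
output≤cost (while-false b) = m≤m+n _ _

------------------------------------------------------------------------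
-- Formulas as trees

-- Numeric constants are written in binary (ℕᵇ is bijective base 2, so the
-- number n takes ⌊log₂(n+1)⌋ digits).  Indices of variables and the
-- length of the quantifier prefix are written in unary.

encodeList : {A : Set} → (A → Tree) → List A → Tree
encodeList enc = List.foldr (λ a t → enc a ∙ t) nil

encodeUnary : ℕ → Tree
encodeUnary n = encodeList id (List.replicate n nil)

encodeℕᵇ : ℕᵇ → Tree
encodeℕᵇ ℕᵇ.zero  = nil
encodeℕᵇ 2[1+ b ] = nil ∙ encodeℕᵇ b
encodeℕᵇ 1+[2 b ] = (nil ∙ nil) ∙ encodeℕᵇ b

encodeℕ : ℕ → Tree
encodeℕ n = encodeℕᵇ (ℕᵇ.fromℕ n)

encodeℤ : ℤ → Tree
encodeℤ (+ n)    = nil ∙ encodeℕ n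
encodeℤ -[1+ n ] = (nil ∙ nil) ∙ encodeℕ (suc n)

encodePoly : ∀ {n} → Poly n → Tree
encodePoly = encodeList λ where
  (c , is) → encodeℤ c ∙ encodeList (λ i → encodeUnary (toℕ i)) is

module _ {C : Set} {m : ℕ} (enc : C → Tree) where

  encodeAtom : Atom C m → Tree
  encodeAtom (a ⊴ b)       = encodeUnary 0 ∙ encodeList enc (toList a) ∙ enc b
  encodeAtom (a ≋ b mod q) =
    encodeUnary 1 ∙ encodeList enc (toList a) ∙ enc b ∙ enc q

  encodeQF : QF C m → Tree
  encodeQF (atom α) = encodeUnary 0 ∙ encodeAtom α
  encodeQF (φ ∧ ψ)  = encodeUnary 1 ∙ encodeQF φ ∙ encodeQF ψ
  encodeQF (φ ∨ ψ)  = encodeUnary 2 ∙ encodeQF φ ∙ encodeQF ψ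
  encodeQF (~ φ)    = encodeUnary 3 ∙ encodeQF φ

encode∃PA : ∀ {m} → ∃PA m → Tree
encode∃PA (∃^ k ∶ φ) = encodeUnary k ∙ encodeQF encodeℤ φ

encode∃≤PA : ∀ {m} → ∃≤PA m → Tree
encode∃≤PA (∃≤^ bounds ∶ φ) =
  encodeList encodeℕ (toList bounds) ∙ encodeQF encodePoly φ

{-# OPTIONS --safe #-}
module Submission where

open import Defs
open import Data.Fin.Base as Fin
  using (Fin; zero; suc; toℕ; fromℕ<; _↑ˡ_; _↑ʳ_; splitAt; combine; remQuot; finToFun; funToFin)
import Data.Fin.Properties as Fin
open import Data.Integer.Base as ℤ using (ℤ; +_; -[1+_]; ∣_∣)
import Data.Integer.Divisibility as ℤ
import Data.Integer.Divisibility.Signed as Signed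
import Data.Integer.Properties as ℤ
import Data.Integer.Tactic.RingSolver as ℤ using (solve-∀)
open import Data.List.Base as List using (List; []; _∷_)
open import Data.List.Membership.Propositional.Properties using (∈-lookup)
open import Data.List.Relation.Unary.All as All using (All; []; _∷_)
import Data.List.Relation.Unary.All.Properties as All
open import Data.List.Relation.Unary.Any using (index)
open import Data.List.Relation.Unary.Any.Properties using (lookup-index)
open import Data.Nat.Base as ℕ using (ℕ; zero; suc; _+_; _*_; _^_; _∸_; _⊔_; _≤_; _<_; z≤n; s≤s; NonZero)
open import Data.Nat.Binary.Base as ℕᵇ using (ℕᵇ; 2[1+_]; 1+[2_])
import Data.Nat.Binary.Properties as ℕᵇ
import Data.Nat.Divisibility as ℕ
import Data.Nat.Properties as ℕ
open import Data.Nat.Tactic.RingSolver using (solve-∀)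
open import Data.Product.Base using (_×_; _,_; ∃₂; ∃-syntax; Σ-syntax; proj₁; proj₂; uncurry)
open import Data.Sum.Base as Sum using (_⊎_; inj₁; inj₂; [_,_]′)
open import Data.Vec.Base as Vec using (Vec; []; _∷_; lookup; toList)
open import Data.Vec.Functional as Vector using (Vector; _++_)
open import Data.Vec.Functional.Properties using (lookup-++ˡ; lookup-++ʳ)
open import Data.Vec.Properties using (lookup∘tabulate; lookup-replicate)
open import Function.Base using (id; _∘_; const)
open import Function.Bundles using (_⇔_; mk⇔)
open import Relation.Binary.PropositionalEquality
open import Relation.Nullary.Decidable.Core using (yes; no)
open import Relation.Nullary.Negation.Core using (¬_; contradiction)

open import Algebra.Properties.Semiring.Sum ℤ.+-*-semiring

-- The formula ∃x φ(x, y) is translated by substituting x = (X y - X₀)/Q for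
-- bounded variables Q, X₀, X: clearing denominators turns every atom into one
-- that is linear in y with coefficients polynomial in Q, X₀ and X, and it
-- remains to require Q > 0 and the integrality of x.
--
-- If φ(x, y) holds for some x, then also for one that is given in this way by
-- numbers of polynomially many bits.  Let M be the product of the nonzero
-- moduli.  As long as the hyperplanes (of the atoms and of the coordinates)
-- found to be near x do not have full rank, Siegel's lemma gives a small integer
-- vector v parallel to all of them; moving x along ±M v preserves the truth of φ
-- until the next step would touch, leave or cross a hyperplane, which is then
-- near x and raises the rank.  Once the rank is full, x is determined by its
-- bounded distances from these hyperplanes, and Siegel's lemma also provides the
-- small coefficients that express each xᵢ in terms of them.

-- Polynomial-time functions on trees

-- The obstacle is that `y` is unbounded, so solutions `x` cannot be bounded in terms of `φ` alone;
-- only the coefficients of an affine dependence of `x` on `y` can. Hyperplanes are therefore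
-- treated through their normals, which are small, and through distances to them; their offsets,
-- which absorb `y`, enter no estimate. The coordinate hyperplanes join the family because the
-- normals occurring in `φ` need not span the space, and then there would be no vertex to move to. A
-- congruence modulo 0 is an equation: residues modulo `M` do not control it, but the position
-- relative to its hyperplane does. Siegel's lemma stands in for determinants throughout; its
-- pigeonhole bound is crude, yet still 2 to a polynomial. None of this is computed. The algorithm
-- only writes down the symbolic substitution and a bound with `s⁴` binary digits, `s` being the
-- size of the input. The exponent 4 leaves room for the cubic number of bits that the estimates
-- yield.

data Bound : Set where
  κ       : ℕ → Bound
  ι       : Bound
  _⊕_ _⊗_ : Bound → Bound → Bound

infixl 6 _⊕_
infixl 7 _⊗_

⟪_⟫ : Bound → ℕ → ℕ
⟪ κ c ⟫   n = c
⟪ ι ⟫     n = n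
⟪ p ⊕ q ⟫ n = ⟪ p ⟫ n + ⟪ q ⟫ n
⟪ p ⊗ q ⟫ n = ⟪ p ⟫ n * ⟪ q ⟫ n

mono : ∀ p {a b} → a ≤ b → ⟪ p ⟫ a ≤ ⟪ p ⟫ b
mono (κ c)   a≤b = ℕ.≤-refl
mono ι       a≤b = a≤b
mono (p ⊕ q) a≤b = ℕ.+-mono-≤ (mono p a≤b) (mono q a≤b)
mono (p ⊗ q) a≤b = ℕ.*-mono-≤ (mono p a≤b) (mono q a≤b)

infixr 8 _⟨_⟩ᵇ

_⟨_⟩ᵇ : Bound → Bound → Bound
κ c     ⟨ r ⟩ᵇ = κ c
ι       ⟨ r ⟩ᵇ = r
(p ⊕ q) ⟨ r ⟩ᵇ = p ⟨ r ⟩ᵇ ⊕ q ⟨ r ⟩ᵇ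
(p ⊗ q) ⟨ r ⟩ᵇ = p ⟨ r ⟩ᵇ ⊗ q ⟨ r ⟩ᵇ

⟪⟫-∘ : ∀ p r n → ⟪ p ⟨ r ⟩ᵇ ⟫ n ≡ ⟪ p ⟫ (⟪ r ⟫ n)
⟪⟫-∘ (κ c)   r n = refl
⟪⟫-∘ ι       r n = refl
⟪⟫-∘ (p ⊕ q) r n = cong₂ _+_ (⟪⟫-∘ p r n) (⟪⟫-∘ q r n)
⟪⟫-∘ (p ⊗ q) r n = cong₂ _*_ (⟪⟫-∘ p r n) (⟪⟫-∘ q r n)

-- Syntactic polynomials with natural coefficients are monotone and closed under sums, products and
-- composition by plain induction, so running times are kept in that form and brought to `c * n ^ d`
-- only at the very end. Positivity of `n` permits raising both exponents of a sum to `d + d′`.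
monomial-bound : ∀ p → ∃₂ λ c d → ∀ n → 1 ≤ n → ⟪ p ⟫ n ≤ c * n ^ d
monomial-bound (κ c) = c , 0 , λ n _ → ℕ.≤-reflexive (sym (ℕ.*-identityʳ c))
monomial-bound ι     = 1 , 1 , λ n _ → ℕ.≤-reflexive (lemma n)
  where
  lemma : ∀ n → n ≡ 1 * n ^ 1
  lemma n = sym (trans (ℕ.*-identityˡ _) (ℕ.*-identityʳ n))
monomial-bound (p ⊕ q) with monomial-bound p | monomial-bound q
... | c , d , f | c′ , d′ , g = c + c′ , d + d′ , λ { n@(suc _) 1≤n → begin
  ⟪ p ⟫ n + ⟪ q ⟫ n                     ≤⟨ ℕ.+-mono-≤ (f n 1≤n) (g n 1≤n) ⟩
  c * n ^ d + c′ * n ^ d′               ≤⟨ ℕ.+-mono-≤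
    (ℕ.*-monoʳ-≤ c (ℕ.^-monoʳ-≤ n (ℕ.m≤m+n d d′)))
    (ℕ.*-monoʳ-≤ c′ (ℕ.^-monoʳ-≤ n (ℕ.m≤n+m d′ d))) ⟩
  c * n ^ (d + d′) + c′ * n ^ (d + d′)  ≡⟨ ℕ.*-distribʳ-+ (n ^ (d + d′)) c c′ ⟨
  (c + c′) * n ^ (d + d′)               ∎ }
  where open ℕ.≤-Reasoning
monomial-bound (p ⊗ q) with monomial-bound p | monomial-bound q
... | c , d , f | c′ , d′ , g = c * c′ , d + d′ , λ n 1≤n → begin
  ⟪ p ⟫ n * ⟪ q ⟫ n              ≤⟨ ℕ.*-mono-≤ (f n 1≤n) (g n 1≤n) ⟩
  (c * n ^ d) * (c′ * n ^ d′)    ≡⟨ interchange c (n ^ d) c′ (n ^ d′) ⟩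
  (c * c′) * (n ^ d * n ^ d′)    ≡⟨ cong (c * c′ *_) (ℕ.^-distribˡ-+-* n d d′) ⟨
  (c * c′) * n ^ (d + d′)        ∎
  where
  open ℕ.≤-Reasoning
  interchange : ∀ a b c d → (a * b) * (c * d) ≡ (a * c) * (b * d)
  interchange = solve-∀

-- The bound covers every tree, not only codes of formulas. Hence each function also needs a
-- controlled result on malformed input.
record PolyTime (f : Tree → Tree) : Set where
  constructor polyTime
  field
    program : Program
    bound   : Bound
    run     : ∀ s → ∃[ t ] (program ⊢ s ⇓ f s ⟨ t ⟩) × t ≤ ⟪ bound ⟫ (size s)

open PolyTime

size-bound : ∀ {f} (p : PolyTime f) s → size (f s) ≤ ⟪ bound p ⟫ (size s)
size-bound p s = let t , r , t≤ = run p s in ℕ.≤-trans (output≤cost r) t≤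

first second : Tree → Tree
first nil     = nil
first (s ∙ t) = s
second nil     = nil
second (s ∙ t) = t

choose : Tree → Tree → Tree → Tree
choose nil     s t = t
choose (_ ∙ _) s t = s

infixr 9 _∘ᵖ_
infixr 5 _∙ᵖ_

idᵖ : PolyTime id
idᵖ = polyTime skip ι λ s → _ , skip , ℕ.≤-refl

_∘ᵖ_ : ∀ {f g} → PolyTime g → PolyTime f → PolyTime (g ∘ f)
_∘ᵖ_ {f} {g} q p = polyTime (program p ⨾ program q)
  (ι ⊕ (bound p ⊕ bound q ⟨ bound p ⟩ᵇ)) λ s →
    let c , r , c≤ = run p s
        d , r′ , d≤ = run q (f s)
        open ℕ.≤-Reasoning
    in _ , seq r r′ , ℕ.+-monoʳ-≤ (size s) (ℕ.+-mono-≤ c≤ (begin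
      d                                          ≤⟨ d≤ ⟩
      ⟪ bound q ⟫ (size (f s))                   ≤⟨ mono (bound q) (size-bound p s) ⟩
      ⟪ bound q ⟫ (⟪ bound p ⟫ (size s))         ≡⟨ ⟪⟫-∘ (bound q) (bound p) (size s) ⟨
      ⟪ bound q ⟨ bound p ⟩ᵇ ⟫ (size s)          ∎))

nilᵖ : PolyTime (const nil)
nilᵖ = polyTime mknil ι λ s → _ , mknil , ℕ.≤-refl

_∙ᵖ_ : ∀ {f g} → PolyTime f → PolyTime g → PolyTime (λ s → f s ∙ g s)
p ∙ᵖ q = polyTime (cons (program p) (program q)) (ι ⊕ (bound p ⊕ bound q)) λ s →
  let c , r , c≤ = run p s
      d , r′ , d≤ = run q s
  in _ , cons r r′ , ℕ.+-monoʳ-≤ (size s) (ℕ.+-mono-≤ c≤ d≤)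

constᵖ : ∀ t → PolyTime (const t)
constᵖ nil     = nilᵖ
constᵖ (s ∙ t) = constᵖ s ∙ᵖ constᵖ t

hdᵖ : ∀ {f} → PolyTime f → PolyTime (first ∘ f)
hdᵖ p = _∘ᵖ_ {g = first} (polyTime hd ι (λ where
  nil     → _ , hd-nil , ℕ.≤-refl
  (s ∙ t) → _ , hd-∙ , ℕ.≤-refl)) p

tlᵖ : ∀ {f} → PolyTime f → PolyTime (second ∘ f)
tlᵖ p = _∘ᵖ_ {g = second} (polyTime tl ι (λ where
  nil     → _ , tl-nil , ℕ.≤-refl
  (s ∙ t) → _ , tl-∙ , ℕ.≤-refl)) p

chooseᵖ : ∀ {b f g} → PolyTime b → PolyTime f → PolyTime g →
          PolyTime (λ s → choose (b s) (f s) (g s))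
chooseᵖ {b} {f} {g} p q r = polyTime (if (program p) (program q) (program r))
  (ι ⊕ (bound p ⊕ (bound q ⊕ bound r))) λ s → go s (run p s)
  where
  go : ∀ s → (∃[ t ] (program p ⊢ s ⇓ b s ⟨ t ⟩) × t ≤ ⟪ bound p ⟫ (size s)) →
       ∃[ t ] (if (program p) (program q) (program r) ⊢ s ⇓ choose (b s) (f s) (g s) ⟨ t ⟩)
         × t ≤ size s + (⟪ bound p ⟫ (size s) + (⟪ bound q ⟫ (size s) + ⟪ bound r ⟫ (size s)))
  go s (c , x , c≤) with b s
  ... | nil   = let d , y , d≤ = run r s in _ , if-false x y ,
    ℕ.+-monoʳ-≤ (size s) (ℕ.+-mono-≤ c≤ (ℕ.≤-trans d≤ (ℕ.m≤n+m _ _)))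
  ... | _ ∙ _ = let d , y , d≤ = run q s in _ , if-true x y ,
    ℕ.+-monoʳ-≤ (size s) (ℕ.+-mono-≤ c≤ (ℕ.≤-trans d≤ (ℕ.m≤m+n _ _)))

-- Φ bounds both the size of a state and the number of remaining
-- iterations.
loopᵖ : ∀ {test step out result} →
        PolyTime test → PolyTime step → PolyTime out →
        (Φ : Tree → ℕ) (β : Bound) →
        (∀ s → size s ≤ Φ s) →
        (∀ s → Φ s ≤ ⟪ β ⟫ (size s)) →
        (∀ s → (test s ≡ nil × result s ≡ out s) ⊎
               (∃₂ λ b b′ → test s ≡ b ∙ b′ × Φ (step s) < Φ s × result s ≡ result (step s))) →
        PolyTime result
loopᵖ {test} {step} {out} {result} p q r Φ β size≤Φ Φ≤β progress =
  polyTime (while (program p) (program q) ⨾ program r)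
           (ι ⊕ ((κ 1 ⊕ β) ⊗ unit ⟨ β ⟩ᵇ ⊕ bound r ⟨ β ⟩ᵇ)) run′
  where
  open ℕ.≤-Reasoning

  unit : Bound
  unit = ι ⊕ (bound p ⊕ bound q)

  -- `S` is the initial potential: as `Φ` only falls, it caps the size of every later state. `n` is
  -- fuel for the iterations. Each round then costs at most `unit` evaluated at `S`, and the final
  -- failing test accounts for the `suc`.
  iterate : ∀ S n s → Φ s ≤ n → Φ s ≤ S →
            ∃₂ λ u t → (while (program p) (program q) ⊢ s ⇓ u ⟨ t ⟩)
              × t ≤ suc n * ⟪ unit ⟫ S × size u ≤ S × result s ≡ out u
  iterate S n s Φ≤n Φ≤S with run p s | progress s
  ... | c , x , c≤ | inj₁ (s≡ , eq) = s , _ ,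
    while-false (subst (λ b → program p ⊢ s ⇓ b ⟨ c ⟩) s≡ x) , (begin
      size s + c                   ≤⟨ ℕ.+-mono-≤ s≤S (ℕ.≤-trans (ℕ.≤-trans c≤ (mono (bound p) s≤S)) (ℕ.m≤m+n _ _)) ⟩
      ⟪ unit ⟫ S                   ≤⟨ ℕ.m≤m+n _ _ ⟩
      suc n * ⟪ unit ⟫ S           ∎) , s≤S , eq
    where
    s≤S : size s ≤ S
    s≤S = ℕ.≤-trans (size≤Φ s) Φ≤S
  iterate S zero s Φ≤n Φ≤S | c , x , c≤ | inj₂ (b , b′ , s≡ , dec , eq)
    with () ← ℕ.<-≤-trans dec Φ≤n
  iterate S (suc n) s Φ≤n Φ≤S | c , x , c≤ | inj₂ (b , b′ , s≡ , dec , eq)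
    with run q s | iterate S n (step s) (ℕ.≤-pred (ℕ.≤-trans dec Φ≤n)) (ℕ.≤-trans (ℕ.<⇒≤ dec) Φ≤S)
  ... | d , y , d≤ | u , e , z , e≤ , u≤ , eq′ = u , _ ,
    while-true (subst (λ b → program p ⊢ s ⇓ b ⟨ c ⟩) s≡ x) y z , (begin
      size s + (c + (d + e))                                  ≡⟨ reassoc (size s) c d e ⟩
      (size s + (c + d)) + e                                  ≤⟨ ℕ.+-mono-≤ (ℕ.+-mono-≤ s≤S (ℕ.+-mono-≤
                                                                   (ℕ.≤-trans c≤ (mono (bound p) s≤S))
                                                                   (ℕ.≤-trans d≤ (mono (bound q) s≤S)))) e≤ ⟩
      ⟪ unit ⟫ S + suc n * ⟪ unit ⟫ S                         ∎) , u≤ , trans eq eq′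
    where
    s≤S : size s ≤ S
    s≤S = ℕ.≤-trans (size≤Φ s) Φ≤S
    reassoc : ∀ a b c d → a + (b + (c + d)) ≡ (a + (b + c)) + d
    reassoc = solve-∀

  run′ : ∀ s → ∃[ t ] (while (program p) (program q) ⨾ program r ⊢ s ⇓ result s ⟨ t ⟩) × _
  run′ s with iterate (⟪ β ⟫ (size s)) (⟪ β ⟫ (size s)) s (Φ≤β s) (Φ≤β s)
  ... | u , t , x , t≤ , u≤ , eq with run r u
  ... | d , y , d≤ = _ , seq x (subst (λ v → program r ⊢ u ⇓ v ⟨ d ⟩) (sym eq) y) ,
    ℕ.+-monoʳ-≤ (size s) (ℕ.+-mono-≤
      (ℕ.≤-trans t≤ (ℕ.≤-reflexive (cong (suc (⟪ β ⟫ (size s)) *_) (sym (⟪⟫-∘ unit β (size s))))))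
      (ℕ.≤-trans (ℕ.≤-trans d≤ (mono (bound r) u≤)) (ℕ.≤-reflexive (sym (⟪⟫-∘ (bound r) β (size s))))))

-- Sizes of components and folds over lists

size-first : ∀ s → size (first s) ≤ size s
size-first nil     = ℕ.≤-refl
size-first (s ∙ t) = ℕ.m≤n⇒m≤1+n (ℕ.m≤m+n _ _)

size-second : ∀ s → size (second s) ≤ size s
size-second nil     = ℕ.≤-refl
size-second (s ∙ t) = ℕ.m≤n⇒m≤1+n (ℕ.m≤n+m _ _)

size-split : ∀ s → size s ≤ suc (size (first s) + size (second s))
size-split nil     = s≤s z≤n
size-split (s ∙ t) = ℕ.≤-refl

-- The slack of one is for `nil`, both of whose components are `nil` again.
size-parts : ∀ s → size (first s) + size (second s) ≤ suc (size s)
size-parts nil     = ℕ.≤-refl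
size-parts (s ∙ t) = ℕ.m≤n⇒m≤1+n (ℕ.n≤1+n _)

-- A tree is read as the list of the left subtrees along its right spine.
-- The folded function sees the whole remaining list, not just its head.
fold : (Tree → Tree → Tree → Tree) → Tree → Tree → Tree → Tree
fold f c a nil             = a
fold f c a l@(_ ∙ l′) = fold f c (f c a l) l′

-- The growth may depend on the constant and on the remaining list, but not on the accumulator. A
-- step allowed to double its accumulator could produce trees of exponential size.
Additive : Bound → (Tree → Tree → Tree → Tree) → Set
Additive G f = ∀ c a l → size (f c a l) ≤ size a + ⟪ G ⟫ (size c + size l)

fold-size : ∀ {f} G → Additive G f → ∀ c a l →
            size (fold f c a l) ≤ size a + size l * ⟪ G ⟫ (size c + size l)
fold-size G growth c a nil = ℕ.m≤m+n _ _
fold-size {f} G growth c a l@(x ∙ l′) = begin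
  size (fold f c (f c a l) l′)                          ≤⟨ fold-size G growth c (f c a l) l′ ⟩
  size (f c a l) + size l′ * ⟪ G ⟫ (size c + size l′)   ≤⟨ ℕ.+-mono-≤ (growth c a l)
    (ℕ.*-mono-≤ (ℕ.m≤n+m (size l′) (size x)) (mono G (ℕ.+-monoʳ-≤ (size c) (size-second l)))) ⟩
  (size a + g) + (size x + size l′) * g                 ≡⟨ ℕ.+-assoc (size a) g _ ⟩
  size a + size l * g                                   ∎
  where
  open ℕ.≤-Reasoning
  g = ⟪ G ⟫ (size c + size l)

foldᵖ : ∀ {f c a l} G → Additive G f →
        PolyTime (λ s → f (first s) (first (second s)) (second (second s))) →
        PolyTime c → PolyTime a → PolyTime l →
        PolyTime (λ s → fold f (c s) (a s) (l s))
foldᵖ {f} G growth p pc pa pl =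
  _∘ᵖ_ {g = λ s → fold f (first s) (first (second s)) (second (second s))}
    (loopᵖ (tlᵖ (tlᵖ idᵖ)) (hdᵖ idᵖ ∙ᵖ p ∙ᵖ tlᵖ (tlᵖ (tlᵖ idᵖ))) (hdᵖ (tlᵖ idᵖ))
      Φ β size≤Φ Φ≤β progress)
    (pc ∙ᵖ pa ∙ᵖ pl)
  where
  open ℕ.≤-Reasoning

  Φ₃ : Tree → Tree → Tree → ℕ
  -- Every unit of size left in `l` prepays one growth of the accumulator; the extra one per unit
  -- makes the potential fall strictly.
  Φ₃ c a l = 2 + size c + size a + size l * suc (⟪ G ⟫ (size c + size l))

  Φ : Tree → ℕ
  Φ s = Φ₃ (first s) (first (second s)) (second (second s))

  β : Bound
  β = κ 2 ⊕ ι ⊕ ι ⊕ ι ⊗ (κ 1 ⊕ G ⟨ ι ⊕ ι ⟩ᵇ)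

  size≤Φ : ∀ s → size s ≤ Φ s
  size≤Φ s = let x = size (first s); y = size (first (second s)); z = size (second (second s)) in begin
    size s                                  ≤⟨ size-split s ⟩
    suc (x + size (second s))               ≤⟨ s≤s (ℕ.+-monoʳ-≤ x (size-split (second s))) ⟩
    suc (x + suc (y + z))                   ≡⟨ shift x y z ⟩
    2 + x + y + z * 1                       ≤⟨ ℕ.+-monoʳ-≤ (2 + x + y) (ℕ.*-monoʳ-≤ z (s≤s z≤n)) ⟩
    Φ s                                     ∎
    where
    shift : ∀ x y z → suc (x + suc (y + z)) ≡ 2 + x + y + z * 1
    shift = solve-∀

  Φ≤β : ∀ s → Φ s ≤ ⟪ β ⟫ (size s)
  Φ≤β s = ℕ.+-mono-≤ (ℕ.+-mono-≤ (ℕ.+-monoʳ-≤ 2 (size-first s)) y≤)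
    (ℕ.*-mono-≤ z≤ (s≤s (ℕ.≤-trans (mono G (ℕ.+-mono-≤ (size-first s) z≤))
      (ℕ.≤-reflexive (sym (⟪⟫-∘ G (ι ⊕ ι) (size s)))))))
    where
    y≤ = ℕ.≤-trans (size-first (second s)) (size-second s)
    z≤ = ℕ.≤-trans (size-second (second s)) (size-second s)

  decrease : ∀ c a x l′ → Φ₃ c (f c a (x ∙ l′)) l′ < Φ₃ c a (x ∙ l′)
  decrease c a x l′ = let l = x ∙ l′; g = ⟪ G ⟫ (size c + size l) in begin-strict
    2 + size c + size (f c a l) + size l′ * suc (⟪ G ⟫ (size c + size l′))
      ≤⟨ ℕ.+-mono-≤ (ℕ.+-monoʳ-≤ (2 + size c) (growth c a l))
           (ℕ.*-mono-≤ (ℕ.m≤n+m (size l′) (size x)) (s≤s (mono G (ℕ.+-monoʳ-≤ (size c) (size-second l))))) ⟩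
    2 + size c + (size a + g) + (size x + size l′) * suc g
      <⟨ ℕ.n<1+n _ ⟩
    suc (2 + size c + (size a + g) + (size x + size l′) * suc g)
      ≡⟨ regroup (size c) (size a) g _ ⟩
    2 + size c + size a + size l * suc g ∎
    where
    regroup : ∀ c a g y → suc (2 + c + (a + g) + y) ≡ 2 + c + a + (suc g + y)
    regroup = solve-∀

  progress : ∀ s → _
  progress s = by-list (first s) (first (second s)) (second (second s))
    where
    by-list : ∀ c a l → (l ≡ nil × fold f c a l ≡ a) ⊎
              ∃₂ λ b b′ → l ≡ b ∙ b′ × Φ₃ c (f c a l) (second l) < Φ₃ c a l
                        × fold f c a l ≡ fold f c (f c a l) (second l)
    by-list c a nil      = inj₁ (refl , refl)
    by-list c a (x ∙ l′) = inj₂ (x , l′ , refl , decrease c a x l′ , refl)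

-- Tree recursion with an explicit stack

weight : Tree → ℕ
weight nil     = 0
weight (s ∙ t) = size s + weight t

weight≤size : ∀ t → weight t ≤ size t
weight≤size nil     = z≤n
weight≤size (s ∙ t) = ℕ.m≤n⇒m≤1+n (ℕ.+-monoʳ-≤ (size s) (weight≤size t))

size≤weight : ∀ t → size t ≤ suc (2 * weight t)
size≤weight nil     = s≤s z≤n
size≤weight (s ∙ t) = begin
  suc (size s + size t)                            ≤⟨ s≤s (ℕ.+-monoʳ-≤ (size s) (size≤weight t)) ⟩
  suc (size s + suc (2 * weight t))                ≤⟨ s≤s (ℕ.+-monoʳ-≤ (size s) (ℕ.+-monoˡ-≤ (2 * weight t) (1≤size s))) ⟩
  suc (size s + (size s + 2 * weight t))           ≡⟨ regroup (size s) (weight t) ⟩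
  suc (2 * (size s + weight t))                    ∎
  where
  open ℕ.≤-Reasoning
  regroup : ∀ a b → suc (a + (a + 2 * b)) ≡ 1 + 2 * (a + b)
  regroup = solve-∀

-- While programs have no recursion; it is simulated by a stack of pending subtrees and an output
-- list. The measure `weight` ignores the cells that form the stack: replacing an entry `s ∙ t` by
-- the two entries `s` and `t` leaves the size of the stack unchanged but lowers its weight by one.
-- Four times the loss of weight has to pay for the emitted tree and its cell.
worklistᵖ : ∀ {push : Tree → Tree → Tree} {emit : Tree → Tree} {result : Tree → Tree → Tree} →
            PolyTime (λ s → push (first s) (second s)) → PolyTime emit →
            (∀ x r → size (emit x) + 2 + 4 * weight (push x r) ≤ 4 * (size x + weight r)) →
            (∀ a → result nil a ≡ a) →
            (∀ x r a → result (x ∙ r) a ≡ result (push x r) (emit x ∙ a)) →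
            PolyTime (λ s → result (first s) (second s))
worklistᵖ {push} {emit} {result} pushᵖ emitᵖ decrease done continue =
  loopᵖ (hdᵖ idᵖ)
        (_∘ᵖ_ {g = λ s → push (first s) (second s)} pushᵖ (hdᵖ (hdᵖ idᵖ) ∙ᵖ tlᵖ (hdᵖ idᵖ))
          ∙ᵖ (emitᵖ ∘ᵖ hdᵖ (hdᵖ idᵖ)) ∙ᵖ tlᵖ idᵖ)
        (tlᵖ idᵖ) Φ (κ 4 ⊗ ι ⊕ ι ⊕ κ 2) size≤Φ Φ≤ progress
  where
  open ℕ.≤-Reasoning

  Φ₂ : Tree → Tree → ℕ
  Φ₂ l a = 4 * weight l + size a + 2

  Φ : Tree → ℕ
  Φ s = Φ₂ (first s) (second s)

  size≤Φ : ∀ s → size s ≤ Φ s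
  size≤Φ s = let w = weight (first s); y = size (second s) in begin
    size s                                  ≤⟨ size-split s ⟩
    suc (size (first s) + y)                ≤⟨ s≤s (ℕ.+-monoˡ-≤ y (size≤weight (first s))) ⟩
    suc (suc (2 * w) + y)                   ≡⟨ shift w y ⟩
    2 * w + y + 2                           ≤⟨ ℕ.+-monoˡ-≤ 2 (ℕ.+-monoˡ-≤ y (ℕ.*-monoˡ-≤ w {2} {4} (s≤s (s≤s z≤n)))) ⟩
    Φ s                                     ∎
    where
    shift : ∀ w y → suc (suc (2 * w) + y) ≡ 2 * w + y + 2
    shift = solve-∀

  Φ≤ : ∀ s → Φ s ≤ 4 * size s + size s + 2
  Φ≤ s = ℕ.+-monoˡ-≤ 2 (ℕ.+-mono-≤
    (ℕ.*-monoʳ-≤ 4 (ℕ.≤-trans (weight≤size (first s)) (size-first s))) (size-second s))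

  smaller : ∀ x r a → Φ₂ (push x r) (emit x ∙ a) < Φ₂ (x ∙ r) a
  smaller x r a = begin
    suc (4 * weight (push x r) + suc (size (emit x) + size a) + 2)      ≡⟨ regroup (weight (push x r)) (size (emit x)) (size a) ⟩
    (size (emit x) + 2 + 4 * weight (push x r)) + size a + 2            ≤⟨ ℕ.+-monoˡ-≤ 2 (ℕ.+-monoˡ-≤ (size a) (decrease x r)) ⟩
    4 * (size x + weight r) + size a + 2                                ∎
    where
    regroup : ∀ w e a → suc (4 * w + suc (e + a) + 2) ≡ (e + 2 + 4 * w) + a + 2
    regroup = solve-∀

  progress : ∀ s → _
  progress s = by-list (first s) (second s)
    where
    by-list : ∀ l a → (l ≡ nil × result l a ≡ a) ⊎
              ∃₂ λ b b′ → l ≡ b ∙ b′ × Φ₂ (push (first l) (second l)) (emit (first l) ∙ a) < Φ₂ l a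
                        × result l a ≡ result (push (first l) (second l)) (emit (first l) ∙ a)
    by-list nil     a = inj₁ (refl , done a)
    by-list (x ∙ r) a = inj₂ (x , r , refl , smaller x r a , continue x r a)

visit : (Tree → Tree → Tree) → Tree → Tree → Tree
visit f nil     a = a
visit f (x ∙ r) a = visit f r (f x a)

countNodes : Tree → Tree → Tree
countNodes nil     a = nil ∙ a
countNodes (s ∙ t) a = countNodes t (countNodes s (nil ∙ a))

countNodesᵖ : ∀ {t} → PolyTime t → PolyTime (λ s → countNodes (t s) nil)
countNodesᵖ p = _∘ᵖ_ {g = λ s → visit countNodes (first s) (second s)}
  (worklistᵖ {push} {const nil} {visit countNodes}
    (chooseᵖ (hdᵖ idᵖ) (hdᵖ (hdᵖ idᵖ) ∙ᵖ tlᵖ (hdᵖ idᵖ) ∙ᵖ tlᵖ idᵖ) (tlᵖ idᵖ)) nilᵖ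
    decrease (λ _ → refl) continue)
  ((p ∙ᵖ nilᵖ) ∙ᵖ nilᵖ)
  where
  push : Tree → Tree → Tree
  push x r = choose x (first x ∙ second x ∙ r) r

  decrease : ∀ x r → 3 + 4 * weight (push x r) ≤ 4 * (size x + weight r)
  decrease nil     r = ℕ.≤-trans (ℕ.n≤1+n _) (ℕ.≤-reflexive (regroup (weight r)))
    where
    regroup : ∀ w → 4 + 4 * w ≡ 4 * (1 + w)
    regroup = solve-∀
  decrease (s ∙ t) r = ℕ.≤-trans (ℕ.n≤1+n _) (ℕ.≤-reflexive (regroup (size s) (size t) (weight r)))
    where
    regroup : ∀ s t w → 4 + 4 * (s + (t + w)) ≡ 4 * (suc (s + t) + w)
    regroup = solve-∀

  continue : ∀ x r a → visit countNodes (x ∙ r) a ≡ visit countNodes (push x r) (nil ∙ a)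
  continue nil     r a = refl
  continue (s ∙ t) r a = refl

-- Lists the connectives and atoms of a formula in reversed prefix order.
-- The tags of ∧, ∨ and ~ are the unary numbers 1, 2 and 3.
tokens : Tree → Tree → Tree
tokens nil          a = nil ∙ a
tokens x@(nil ∙ _)  a = x ∙ a
tokens (tag@(_ ∙ t) ∙ body) a with second t
... | _ ∙ _ = tokens body ((tag ∙ nil) ∙ a)
... | nil   = both body
  where
  both : Tree → Tree
  both nil     = nil ∙ nil ∙ (tag ∙ nil) ∙ a
  both (l ∙ r) = tokens r (tokens l ((tag ∙ nil) ∙ a))

-- A binary connective with body `nil` counts as having two operands `nil`, which is what `first`
-- and `second` return there. So the stack machine agrees with `tokens` on malformed trees too.
-- Among the three tags, only that of negation is long enough for its second tail to be nonempty.
tokensᵖ : ∀ {t} → PolyTime t → PolyTime (λ s → tokens (t s) nil)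
tokensᵖ p = _∘ᵖ_ {g = λ s → visit tokens (first s) (second s)}
  (worklistᵖ {push} {emit} {visit tokens}
    (chooseᵖ (hdᵖ (hdᵖ idᵖ))
      (chooseᵖ (tlᵖ (tlᵖ (hdᵖ (hdᵖ idᵖ)))) (tlᵖ (hdᵖ idᵖ) ∙ᵖ tlᵖ idᵖ)
        (hdᵖ (tlᵖ (hdᵖ idᵖ)) ∙ᵖ tlᵖ (tlᵖ (hdᵖ idᵖ)) ∙ᵖ tlᵖ idᵖ))
      (tlᵖ idᵖ))
    (chooseᵖ (hdᵖ idᵖ) (hdᵖ idᵖ ∙ᵖ nilᵖ) idᵖ)
    decrease (λ _ → refl) continue)
  ((p ∙ᵖ nilᵖ) ∙ᵖ nilᵖ)
  where
  open ℕ.≤-Reasoning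

  push : Tree → Tree → Tree
  push x r = choose (first x)
    (choose (second (second (first x))) (second x ∙ r) (first (second x) ∙ second (second x) ∙ r))
    r

  emit : Tree → Tree
  emit x = choose (first x) (first x ∙ nil) x

  leaf : ∀ x w → size x + 2 + 4 * w ≤ 4 * (size x + w)
  leaf x w = begin
    size x + 2 + 4 * w           ≤⟨ ℕ.+-monoˡ-≤ (4 * w) (ℕ.+-monoʳ-≤ (size x) (ℕ.≤-trans (ℕ.n≤1+n 2) (ℕ.*-monoʳ-≤ 3 (1≤size x)))) ⟩
    size x + 3 * size x + 4 * w  ≡⟨ regroup (size x) w ⟩
    4 * (size x + w)             ∎
    where
    regroup : ∀ s w → s + 3 * s + 4 * w ≡ 4 * (s + w)
    regroup = solve-∀

  decrease : ∀ x r → size (emit x) + 2 + 4 * weight (push x r) ≤ 4 * (size x + weight r)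
  decrease nil         r = leaf nil (weight r)
  decrease x@(nil ∙ _) r = leaf x (weight r)
  decrease ((h ∙ t) ∙ body) r with second t
  ... | _ ∙ _ = begin
    suc (suc (size h + size t) + 1) + 2 + 4 * (size body + weight r)
      ≤⟨ ℕ.m≤m+n _ (3 * suc (size h + size t)) ⟩
    suc (suc (size h + size t) + 1) + 2 + 4 * (size body + weight r) + 3 * suc (size h + size t)
      ≡⟨ regroup (suc (size h + size t)) (size body) (weight r) ⟩
    4 * (suc (suc (size h + size t) + size body) + weight r) ∎
    where
    regroup : ∀ t b w → suc (t + 1) + 2 + 4 * (b + w) + 3 * t ≡ 4 * (suc (t + b) + w)
    regroup = solve-∀
  ... | nil = begin
    suc (suc (size h + size t) + 1) + 2 + 4 * (size (first body) + (size (second body) + weight r))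
      ≡⟨ cong (λ n → suc (suc (size h + size t) + 1) + 2 + 4 * n) (ℕ.+-assoc (size (first body)) _ _) ⟨
    suc (suc (size h + size t) + 1) + 2 + 4 * (size (first body) + size (second body) + weight r)
      ≤⟨ ℕ.+-monoʳ-≤ (suc (suc (size h + size t) + 1) + 2) (ℕ.*-monoʳ-≤ 4 (ℕ.+-monoˡ-≤ (weight r) (size-parts body))) ⟩
    suc (suc (size h + size t) + 1) + 2 + 4 * (suc (size body) + weight r)
      ≤⟨ ℕ.+-monoˡ-≤ (4 * (suc (size body) + weight r))
           (ℕ.+-monoʳ-≤ (suc (suc (size h + size t) + 1)) (ℕ.≤-trans (s≤s (s≤s z≤n)) (ℕ.*-monoʳ-≤ 2 (1≤size h)))) ⟩
    suc (suc (size h + size t) + 1) + 2 * size h + 4 * (suc (size body) + weight r)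
      ≤⟨ ℕ.m≤m+n _ (size h + 3 * size t) ⟩
    suc (suc (size h + size t) + 1) + 2 * size h + 4 * (suc (size body) + weight r) + (size h + 3 * size t)
      ≤⟨ ℕ.n≤1+n _ ⟩
    suc (suc (suc (size h + size t) + 1) + 2 * size h + 4 * (suc (size body) + weight r) + (size h + 3 * size t))
      ≡⟨ regroup (size h) (size t) (size body) (weight r) ⟩
    4 * (suc (suc (size h + size t) + size body) + weight r) ∎
    where
    regroup : ∀ h t b w → suc (suc (suc (h + t) + 1) + 2 * h + 4 * (suc b + w) + (h + 3 * t))
                        ≡ 4 * (suc (suc (h + t) + b) + w)
    regroup = solve-∀

  continue : ∀ x r a → visit tokens (x ∙ r) a ≡ visit tokens (push x r) (emit x ∙ a)
  continue nil         r a = refl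
  continue (nil ∙ _)   r a = refl
  continue ((h ∙ t) ∙ body) r a with second t
  ... | _ ∙ _ = refl
  continue ((h ∙ t) ∙ nil)     r a | nil = refl
  continue ((h ∙ t) ∙ (_ ∙ _)) r a | nil = refl

-- The translation as a program

reverseOnto : Tree → Tree → Tree
reverseOnto a l = fold (λ _ a l → first l ∙ a) nil a l

reverseOnto-size : ∀ a l → size (reverseOnto a l) ≤ size a + size l
reverseOnto-size a nil     = ℕ.m≤m+n _ _
reverseOnto-size a (x ∙ l) = begin
  size (reverseOnto (x ∙ a) l)        ≤⟨ reverseOnto-size (x ∙ a) l ⟩
  suc (size x + size a) + size l      ≡⟨ regroup (size x) (size a) (size l) ⟩
  size a + suc (size x + size l)      ∎
  where
  open ℕ.≤-Reasoning
  regroup : ∀ x a l → suc (x + a) + l ≡ a + suc (x + l)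
  regroup = solve-∀

reverseOntoᵖ : ∀ {f g} → PolyTime f → PolyTime g → PolyTime (λ s → reverseOnto (f s) (g s))
reverseOntoᵖ p q = foldᵖ (κ 1 ⊕ ι) additive (hdᵖ (tlᵖ (tlᵖ idᵖ)) ∙ᵖ hdᵖ (tlᵖ idᵖ)) nilᵖ p q
  where
  additive : Additive (κ 1 ⊕ ι) (λ _ a l → first l ∙ a)
  additive c a l = begin
    suc (size (first l) + size a)          ≤⟨ s≤s (ℕ.+-monoˡ-≤ (size a) (ℕ.≤-trans (size-first l) (ℕ.m≤n+m _ (size c)))) ⟩
    suc (size c + size l + size a)         ≡⟨ ℕ.+-comm (suc (size c + size l)) (size a) ⟩
    size a + suc (size c + size l)         ∎
    where open ℕ.≤-Reasoning

timesTree : Tree → Tree → Tree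
timesTree u v = fold (λ c a _ → reverseOnto a c) u nil v

timesTreeᵖ : ∀ {f g} → PolyTime f → PolyTime g → PolyTime (λ s → timesTree (f s) (g s))
timesTreeᵖ p q = foldᵖ ι
  (λ c a l → ℕ.≤-trans (reverseOnto-size a c) (ℕ.+-monoʳ-≤ (size a) (ℕ.m≤m+n (size c) (size l))))
  (reverseOntoᵖ (hdᵖ (tlᵖ idᵖ)) (hdᵖ idᵖ)) p nilᵖ q

-- On a unary number n, the list of the unary numbers 1, …, n.
indices : Tree → Tree
indices u = fold (λ _ a l → l ∙ a) nil nil u

indicesᵖ : ∀ {f} → PolyTime f → PolyTime (λ s → indices (f s))
indicesᵖ p = foldᵖ (κ 1 ⊕ ι) additive (tlᵖ (tlᵖ idᵖ) ∙ᵖ hdᵖ (tlᵖ idᵖ)) nilᵖ nilᵖ p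
  where
  additive : Additive (κ 1 ⊕ ι) (λ _ a l → l ∙ a)
  additive c a l = begin
    suc (size l + size a)                  ≤⟨ s≤s (ℕ.+-monoˡ-≤ (size a) (ℕ.m≤n+m _ (size c))) ⟩
    suc (size c + size l + size a)         ≡⟨ ℕ.+-comm (suc (size c + size l)) (size a) ⟩
    size a + suc (size c + size l)         ∎
    where open ℕ.≤-Reasoning

replicateTree : Tree → Tree → Tree
replicateTree x l = fold (λ c a _ → c ∙ a) x nil l

replicateTreeᵖ : ∀ {f g} → PolyTime f → PolyTime g → PolyTime (λ s → replicateTree (f s) (g s))
replicateTreeᵖ p q = foldᵖ (κ 1 ⊕ ι) additive (hdᵖ idᵖ ∙ᵖ hdᵖ (tlᵖ idᵖ)) p nilᵖ q
  where
  additive : Additive (κ 1 ⊕ ι) (λ c a _ → c ∙ a)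
  additive c a l = begin
    suc (size c + size a)                  ≤⟨ s≤s (ℕ.+-monoˡ-≤ (size a) (ℕ.m≤m+n (size c) (size l))) ⟩
    suc (size c + size l + size a)         ≡⟨ ℕ.+-comm (suc (size c + size l)) (size a) ⟩
    size a + suc (size c + size l)         ∎
    where open ℕ.≤-Reasoning

-- Splits off as many elements of l as u has: the reversed prefix and the
-- remaining suffix.
splitTree : Tree → Tree → Tree
splitTree u l = fold (λ _ a _ → (first (second a) ∙ first a) ∙ second (second a)) nil (nil ∙ l) u

splitTreeᵖ : ∀ {f g} → PolyTime f → PolyTime g → PolyTime (λ s → splitTree (f s) (g s))
splitTreeᵖ p q = foldᵖ (κ 4) additive
  ((hdᵖ (tlᵖ (hdᵖ (tlᵖ idᵖ))) ∙ᵖ hdᵖ (hdᵖ (tlᵖ idᵖ))) ∙ᵖ tlᵖ (tlᵖ (hdᵖ (tlᵖ idᵖ))))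
  nilᵖ (nilᵖ ∙ᵖ q) p
  where
  additive : Additive (κ 4) (λ _ a _ → (first (second a) ∙ first a) ∙ second (second a))
  additive c a l = begin
    suc (suc (size (first (second a)) + size (first a)) + size (second (second a)))
      ≡⟨ regroup (size (first (second a))) (size (first a)) (size (second (second a))) ⟩
    2 + (size (first (second a)) + size (second (second a))) + size (first a)
      ≤⟨ ℕ.+-monoˡ-≤ (size (first a)) (ℕ.+-monoʳ-≤ 2 (size-parts (second a))) ⟩
    2 + suc (size (second a)) + size (first a)
      ≡⟨ regroup′ (size (first a)) (size (second a)) ⟩
    3 + (size (first a) + size (second a))
      ≤⟨ ℕ.+-monoʳ-≤ 3 (size-parts a) ⟩
    4 + size a
      ≡⟨ ℕ.+-comm 4 (size a) ⟩
    size a + 4 ∎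
    where
    open ℕ.≤-Reasoning
    regroup : ∀ x y z → suc (suc (x + y) + z) ≡ 2 + (x + z) + y
    regroup = solve-∀
    regroup′ : ∀ x y → 2 + suc y + x ≡ 3 + (x + y)
    regroup′ = solve-∀

-- The polynomial consisting of c times the variable of index 0.
scalarTree : Tree → Tree
scalarTree c = (c ∙ nil ∙ nil) ∙ nil

scalarTreeᵖ : ∀ {f} → PolyTime f → PolyTime (λ s → scalarTree (f s))
scalarTreeᵖ p = (p ∙ᵖ nilᵖ ∙ᵖ nilᵖ) ∙ᵖ nilᵖ

scalarsTree : Tree → Tree
scalarsTree l = reverseOnto nil (fold (λ _ a l → scalarTree (first l) ∙ a) nil nil l)

scalarsTreeᵖ : ∀ {f} → PolyTime f → PolyTime (λ s → scalarsTree (f s))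
scalarsTreeᵖ p = reverseOntoᵖ nilᵖ
  (foldᵖ (κ 7 ⊕ ι) additive (scalarTreeᵖ (hdᵖ (tlᵖ (tlᵖ idᵖ))) ∙ᵖ hdᵖ (tlᵖ idᵖ)) nilᵖ nilᵖ p)
  where
  additive : Additive (κ 7 ⊕ ι) (λ _ a l → scalarTree (first l) ∙ a)
  additive c a l = begin
    suc (suc (suc (size (first l) + 3) + 1) + size a)
      ≡⟨ regroup (size (first l)) (size a) ⟩
    size a + (7 + size (first l))
      ≤⟨ ℕ.+-monoʳ-≤ (size a) (ℕ.+-monoʳ-≤ 7 (ℕ.≤-trans (size-first l) (ℕ.m≤n+m _ (size c)))) ⟩
    size a + (7 + (size c + size l)) ∎
    where
    open ℕ.≤-Reasoning
    regroup : ∀ x a → suc (suc (suc (x + 3) + 1) + a) ≡ a + (7 + x)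
    regroup = solve-∀

-- One row of the coefficient table: the remaining indices, the remaining
-- polynomials, and (reversed) the polynomials to which a monomial with
-- coefficient c has been added.
rowStep : Tree → Tree → Tree → Tree
rowStep c a _ = second (first a) ∙ second (first (second a)) ∙
  ((c ∙ first (first a) ∙ nil) ∙ first (first (second a))) ∙ second (second a)

rowTree : Tree → Tree → Tree → Tree → Tree
rowTree c is ps w = fold rowStep c (is ∙ ps ∙ nil) w

rowStep-additive : Additive (κ 10 ⊕ ι) rowStep
rowStep-additive c a l = begin
  suc (size (second (first a)) + suc (size (second (first (second a))) +
    suc (suc (suc (size c + suc (size (first (first a)) + 1)) + size (first (first (second a)))) +
      size (second (second a)))))
    ≡⟨ regroup (size (second (first a))) (size (second (first (second a)))) (size c)
         (size (first (first a))) (size (first (first (second a)))) (size (second (second a))) ⟩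
  7 + size c + (size (first (first a)) + size (second (first a)))
    + (size (first (first (second a))) + size (second (first (second a)))) + size (second (second a))
    ≤⟨ ℕ.+-monoˡ-≤ _ (ℕ.+-mono-≤ (ℕ.+-monoʳ-≤ (7 + size c) (size-parts (first a))) (size-parts (first (second a)))) ⟩
  7 + size c + suc (size (first a)) + suc (size (first (second a))) + size (second (second a))
    ≡⟨ regroup₂ (size c) (size (first a)) (size (first (second a))) (size (second (second a))) ⟩
  9 + size c + size (first a) + (size (first (second a)) + size (second (second a)))
    ≤⟨ ℕ.+-monoʳ-≤ (9 + size c + size (first a)) (size-parts (second a)) ⟩
  9 + size c + size (first a) + suc (size (second a))
    ≡⟨ regroup₃ (size c) (size (first a)) (size (second a)) ⟩
  10 + size c + (size (first a) + size (second a))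
    ≤⟨ ℕ.+-monoʳ-≤ (10 + size c) (size-parts a) ⟩
  10 + size c + suc (size a)
    ≤⟨ ℕ.+-monoʳ-≤ (10 + size c) (ℕ.+-monoˡ-≤ (size a) (1≤size l)) ⟩
  10 + size c + (size l + size a)
    ≡⟨ regroup₄ (size c) (size l) (size a) ⟩
  size a + (10 + (size c + size l)) ∎
  where
  open ℕ.≤-Reasoning
  regroup : ∀ x y c z w v → suc (x + suc (y + suc (suc (suc (c + suc (z + 1)) + w) + v)))
          ≡ 7 + c + (z + x) + (w + y) + v
  regroup = solve-∀
  regroup₂ : ∀ c x y z → 7 + c + suc x + suc y + z ≡ 9 + c + x + (y + z)
  regroup₂ = solve-∀
  regroup₃ : ∀ c x y → 9 + c + x + suc y ≡ 10 + c + (x + y)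
  regroup₃ = solve-∀
  regroup₄ : ∀ c l a → 10 + c + (l + a) ≡ a + (10 + (c + l))
  regroup₄ = solve-∀

rowTreeᵖ : ∀ {f g h k} → PolyTime f → PolyTime g → PolyTime h → PolyTime k →
           PolyTime (λ s → rowTree (f s) (g s) (h s) (k s))
rowTreeᵖ p q r t = foldᵖ (κ 10 ⊕ ι) rowStep-additive
  (tlᵖ (hdᵖ a) ∙ᵖ tlᵖ (hdᵖ (tlᵖ a)) ∙ᵖ
    ((hdᵖ idᵖ ∙ᵖ hdᵖ (hdᵖ a) ∙ᵖ nilᵖ) ∙ᵖ hdᵖ (hdᵖ (tlᵖ a))) ∙ᵖ tlᵖ (tlᵖ a))
  p (q ∙ᵖ r ∙ᵖ nilᵖ) t
  where
  a = hdᵖ (tlᵖ idᵖ)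

rowBound : Bound
rowBound = ι ⊗ (κ 10 ⊕ (ι ⊕ ι))

rowTree-size : ∀ c is ps w n → size c ≤ n → size w ≤ n →
               size (rowTree c is ps w) ≤ suc (size is + suc (size ps + 1)) + ⟪ rowBound ⟫ n
rowTree-size c is ps w n c≤ w≤ = ℕ.≤-trans
  (fold-size (κ 10 ⊕ ι) rowStep-additive c (is ∙ ps ∙ nil) w)
  (ℕ.+-monoʳ-≤ (size (is ∙ ps ∙ nil)) (ℕ.*-mono-≤ w≤ (ℕ.+-monoʳ-≤ 10 (ℕ.+-mono-≤ c≤ w≤))))

rowRest rowResult : Tree → Tree
rowRest r   = first r
rowResult r = reverseOnto nil (second (second r))

-- `is` and `ps` form the accumulator of the enclosing fold over the rows, so they must enter with
-- coefficient one. The remaining growth depends only on `c` and `w`, which makes the nested fold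
-- additive.
row-size : ∀ c is ps w n → size c ≤ n → size w ≤ n →
           size (rowRest (rowTree c is ps w)) + size (rowResult (rowTree c is ps w))
             ≤ 6 + size is + size ps + ⟪ rowBound ⟫ n
row-size c is ps w n c≤ w≤ = begin
  size (first r) + size (rowResult r)               ≤⟨ ℕ.+-monoʳ-≤ (size (first r)) (reverseOnto-size nil (second (second r))) ⟩
  size (first r) + suc (size (second (second r)))   ≤⟨ ℕ.+-monoʳ-≤ (size (first r)) (s≤s (size-second (second r))) ⟩
  size (first r) + suc (size (second r))            ≡⟨ ℕ.+-suc _ _ ⟩
  suc (size (first r) + size (second r))            ≤⟨ s≤s (size-parts r) ⟩
  2 + size r                                        ≤⟨ ℕ.+-monoʳ-≤ 2 (rowTree-size c is ps w n c≤ w≤) ⟩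
  2 + (suc (size is + suc (size ps + 1)) + ⟪ rowBound ⟫ n)     ≤⟨ ℕ.n≤1+n _ ⟩
  3 + (suc (size is + suc (size ps + 1)) + ⟪ rowBound ⟫ n)   ≡⟨ regroup (size is) (size ps) (⟪ rowBound ⟫ n) ⟩
  6 + size is + size ps + ⟪ rowBound ⟫ n            ∎
  where
  open ℕ.≤-Reasoning
  r = rowTree c is ps w
  regroup : ∀ x y z → 3 + (suc (x + suc (y + 1)) + z) ≡ 6 + x + y + z
  regroup = solve-∀

rowsStep : Tree → Tree → Tree → Tree
rowsStep w a l = let r = rowTree (first l) (first a) (second a) w in rowRest r ∙ rowResult r

rowsTree : Tree → Tree → Tree → Tree → Tree
rowsTree w is ps l = second (fold rowsStep w (is ∙ ps) l)

rowsTreeᵖ : ∀ {f g h k} → PolyTime f → PolyTime g → PolyTime h → PolyTime k →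
            PolyTime (λ s → rowsTree (f s) (g s) (h s) (k s))
rowsTreeᵖ p₁ p₂ p₃ p₄ = tlᵖ (foldᵖ (κ 8 ⊕ rowBound) additive
  (hdᵖ row ∙ᵖ reverseOntoᵖ nilᵖ (tlᵖ (tlᵖ row))) p₁ (p₂ ∙ᵖ p₃) p₄)
  where
  row = rowTreeᵖ (hdᵖ (tlᵖ (tlᵖ idᵖ))) (hdᵖ (hdᵖ (tlᵖ idᵖ))) (tlᵖ (hdᵖ (tlᵖ idᵖ))) (hdᵖ idᵖ)

  additive : Additive (κ 8 ⊕ rowBound) rowsStep
  additive c a l = begin
    suc (size (rowRest r) + size (rowResult r))
      ≤⟨ s≤s (row-size (first l) (first a) (second a) c _
           (ℕ.≤-trans (size-first l) (ℕ.m≤n+m _ (size c))) (ℕ.m≤m+n _ (size l))) ⟩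
    suc (6 + size (first a) + size (second a) + b)
      ≡⟨ regroup (size (first a)) (size (second a)) b ⟩
    7 + (size (first a) + size (second a)) + b
      ≤⟨ ℕ.+-monoˡ-≤ b (ℕ.+-monoʳ-≤ 7 (size-parts a)) ⟩
    7 + suc (size a) + b
      ≡⟨ regroup₂ (size a) b ⟩
    size a + (8 + b) ∎
    where
    open ℕ.≤-Reasoning
    r = rowTree (first l) (first a) (second a) c
    b = ⟪ rowBound ⟫ (size c + size l)
    regroup : ∀ x y b → suc (6 + x + y + b) ≡ 7 + (x + y) + b
    regroup = solve-∀
    regroup₂ : ∀ x b → 7 + suc x + b ≡ x + (8 + b)
    regroup₂ = solve-∀

-- The context consists of the number of quantifiers in unary, of a list
-- as long as a row, and of the list of indices.
atomTree : Tree → Tree → Tree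
atomTree c x = nil ∙ tag ∙ second ps ∙ choose tag (first ps ∙ scalarTree (second rest)) (first ps)
  where
  tag rest splitted ps : Tree
  tag      = first x
  rest     = second (second x)
  splitted = splitTree (first c) (first (second x))
  ps       = rowsTree (first (second c)) (second (second c))
    (scalarsTree (choose tag (first rest) rest ∙ second splitted))
    (reverseOnto nil (first splitted))

abstract
  atomTreeᵖ : PolyTime (λ s → atomTree (first s) (second s))
  atomTreeᵖ =
    let c        = hdᵖ idᵖ
        x        = tlᵖ idᵖ
        tag      = hdᵖ x
        rest     = tlᵖ (tlᵖ x)
        splitted = splitTreeᵖ (hdᵖ c) (hdᵖ (tlᵖ x))
        ps       = rowsTreeᵖ (hdᵖ (tlᵖ c)) (tlᵖ (tlᵖ c))
          (scalarsTreeᵖ (chooseᵖ tag (hdᵖ rest) rest ∙ᵖ tlᵖ splitted))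
          (reverseOntoᵖ nilᵖ (hdᵖ splitted))
    in nilᵖ ∙ᵖ tag ∙ᵖ tlᵖ ps ∙ᵖ chooseᵖ tag (hdᵖ ps ∙ᵖ scalarTreeᵖ (tlᵖ rest)) (hdᵖ ps)

-- Evaluates reversed prefix notation with a stack of formulas.
buildStep : Tree → Tree → Tree → Tree
buildStep c a l = choose tag
  (choose (second (second tag)) ((tag ∙ first a) ∙ second a)
    ((tag ∙ first a ∙ first (second a)) ∙ second (second a)))
  (atomTree c (second (first l)) ∙ a)
  where
  tag : Tree
  tag = first (first l)

buildTree : Tree → Tree → Tree
buildTree c l = first (fold buildStep c nil l)

-- A connective merely rearranges the stack and adds its tag; an atom adds its translation, whose
-- size is bounded by the context and the token alone. Hence the stack grows additively.
buildTreeᵖ : ∀ {f g} → PolyTime f → PolyTime g → PolyTime (λ s → buildTree (f s) (g s))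
buildTreeᵖ p q = hdᵖ (foldᵖ (κ 5 ⊕ ι ⊕ atomBound ⟨ κ 1 ⊕ ι ⟩ᵇ) additive
  (chooseᵖ tag
    (chooseᵖ (tlᵖ (tlᵖ tag)) ((tag ∙ᵖ hdᵖ a) ∙ᵖ tlᵖ a)
      ((tag ∙ᵖ hdᵖ a ∙ᵖ hdᵖ (tlᵖ a)) ∙ᵖ tlᵖ (tlᵖ a)))
    (_∘ᵖ_ {g = λ s → atomTree (first s) (second s)} atomTreeᵖ (hdᵖ idᵖ ∙ᵖ tlᵖ (hdᵖ (tlᵖ (tlᵖ idᵖ)))) ∙ᵖ a))
  p nilᵖ q)
  where
  open ℕ.≤-Reasoning
  a = hdᵖ (tlᵖ idᵖ)
  tag = hdᵖ (hdᵖ (tlᵖ (tlᵖ idᵖ)))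
  atomBound = PolyTime.bound atomTreeᵖ

  additive : Additive (κ 5 ⊕ ι ⊕ atomBound ⟨ κ 1 ⊕ ι ⟩ᵇ) buildStep
  additive c a l with first (first l) in eq
  ... | nil = begin
    suc (size (atomTree c (second (first l))) + size a)
      ≤⟨ s≤s (ℕ.+-monoˡ-≤ (size a) (ℕ.≤-trans (size-bound atomTreeᵖ (c ∙ second (first l)))
           (ℕ.≤-trans (mono atomBound (s≤s (ℕ.+-monoʳ-≤ (size c) (ℕ.≤-trans (size-second (first l)) (size-first l)))))
             (ℕ.≤-reflexive (sym (⟪⟫-∘ atomBound (κ 1 ⊕ ι) (size c + size l))))))) ⟩
    suc (⟪ atomBound ⟨ κ 1 ⊕ ι ⟩ᵇ ⟫ (size c + size l) + size a)
      ≤⟨ ℕ.m≤m+n _ (4 + (size c + size l)) ⟩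
    suc (⟪ atomBound ⟨ κ 1 ⊕ ι ⟩ᵇ ⟫ (size c + size l) + size a) + (4 + (size c + size l))
      ≡⟨ regroup (⟪ atomBound ⟨ κ 1 ⊕ ι ⟩ᵇ ⟫ (size c + size l)) (size a) (size c + size l) ⟩
    size a + (5 + (size c + size l) + ⟪ atomBound ⟨ κ 1 ⊕ ι ⟩ᵇ ⟫ (size c + size l)) ∎
    where
    regroup : ∀ x y z → suc (x + y) + (4 + z) ≡ y + (5 + z + x)
    regroup = solve-∀
  ... | tag@(_ ∙ t) with second t
  ...   | _ ∙ _ = begin
    suc (suc (size tag + size (first a)) + size (second a))
      ≡⟨ cong (λ n → suc (suc n)) (ℕ.+-assoc (size tag) _ _) ⟩
    2 + (size tag + (size (first a) + size (second a)))
      ≤⟨ ℕ.+-monoʳ-≤ 2 (ℕ.+-mono-≤ tag≤ (size-parts a)) ⟩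
    2 + (size c + size l + suc (size a))
      ≤⟨ ℕ.m≤m+n _ (2 + ⟪ atomBound ⟨ κ 1 ⊕ ι ⟩ᵇ ⟫ (size c + size l)) ⟩
    2 + (size c + size l + suc (size a)) + (2 + ⟪ atomBound ⟨ κ 1 ⊕ ι ⟩ᵇ ⟫ (size c + size l))
      ≡⟨ regroup (size c + size l) (size a) (⟪ atomBound ⟨ κ 1 ⊕ ι ⟩ᵇ ⟫ (size c + size l)) ⟩
    size a + (5 + (size c + size l) + ⟪ atomBound ⟨ κ 1 ⊕ ι ⟩ᵇ ⟫ (size c + size l)) ∎
    where
    tag≤ : size tag ≤ size c + size l
    tag≤ = ℕ.≤-trans (ℕ.≤-trans (ℕ.≤-reflexive (cong size (sym eq)))
      (ℕ.≤-trans (size-first (first l)) (size-first l))) (ℕ.m≤n+m _ (size c))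
    regroup : ∀ x y z → 2 + (x + suc y) + (2 + z) ≡ y + (5 + x + z)
    regroup = solve-∀
  ...   | nil = begin
    suc (suc (size tag + suc (size (first a) + size (first (second a)))) + size (second (second a)))
      ≡⟨ regroup (size tag) (size (first a)) (size (first (second a))) (size (second (second a))) ⟩
    3 + size tag + size (first a) + (size (first (second a)) + size (second (second a)))
      ≤⟨ ℕ.+-mono-≤ (ℕ.+-monoˡ-≤ (size (first a)) (ℕ.+-monoʳ-≤ 3 tag≤)) (size-parts (second a)) ⟩
    3 + (size c + size l) + size (first a) + suc (size (second a))
      ≡⟨ regroup₂ (size c + size l) (size (first a)) (size (second a)) ⟩
    4 + (size c + size l) + (size (first a) + size (second a))
      ≤⟨ ℕ.+-monoʳ-≤ (4 + (size c + size l)) (size-parts a) ⟩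
    4 + (size c + size l) + suc (size a)
      ≤⟨ ℕ.m≤m+n _ (⟪ atomBound ⟨ κ 1 ⊕ ι ⟩ᵇ ⟫ (size c + size l)) ⟩
    4 + (size c + size l) + suc (size a) + ⟪ atomBound ⟨ κ 1 ⊕ ι ⟩ᵇ ⟫ (size c + size l)
      ≡⟨ regroup₃ (size c + size l) (size a) (⟪ atomBound ⟨ κ 1 ⊕ ι ⟩ᵇ ⟫ (size c + size l)) ⟩
    size a + (5 + (size c + size l) + ⟪ atomBound ⟨ κ 1 ⊕ ι ⟩ᵇ ⟫ (size c + size l)) ∎
    where
    tag≤ : size tag ≤ size c + size l
    tag≤ = ℕ.≤-trans (ℕ.≤-trans (ℕ.≤-reflexive (cong size (sym eq)))
      (ℕ.≤-trans (size-first (first l)) (size-first l))) (ℕ.m≤n+m _ (size c))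
    regroup : ∀ t x y z → suc (suc (t + suc (x + y)) + z) ≡ 3 + t + x + (y + z)
    regroup = solve-∀
    regroup₂ : ∀ t x y → 3 + t + x + suc y ≡ 4 + t + (x + y)
    regroup₂ = solve-∀
    regroup₃ : ∀ t x y → 4 + t + suc x + y ≡ x + (5 + t + y)
    regroup₃ = solve-∀

conjoinTree : Tree → Tree → Tree
conjoinTree s t = encodeUnary 1 ∙ s ∙ t

-- The accumulator pairs the indices not yet used with a formula.
integralStep : Tree → Tree → Tree → Tree
integralStep w a _ = rowRest r ∙
  conjoinTree (nil ∙ encodeUnary 1 ∙ second ps ∙ first ps ∙ scalarTree (encodeℤ (+ 1))) (second a)
  where
  r ps : Tree
  r  = rowTree (encodeℤ (+ 1)) (first a) nil w
  ps = rowResult r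

integralTree : Tree → Tree → Tree → Tree → Tree
integralTree w is t u = second (fold integralStep w (is ∙ t) u)

integralTreeᵖ : ∀ {f g h k} → PolyTime f → PolyTime g → PolyTime h → PolyTime k →
                PolyTime (λ s → integralTree (f s) (g s) (h s) (k s))
integralTreeᵖ p₁ p₂ p₃ p₄ = tlᵖ (foldᵖ (κ 36 ⊕ rowBound ⟨ κ 7 ⊕ ι ⟩ᵇ) additive
  (hdᵖ row ∙ᵖ constᵖ (encodeUnary 1) ∙ᵖ
    (nilᵖ ∙ᵖ constᵖ (encodeUnary 1) ∙ᵖ tlᵖ ps ∙ᵖ hdᵖ ps ∙ᵖ constᵖ (scalarTree (encodeℤ (+ 1)))) ∙ᵖ
    tlᵖ (hdᵖ (tlᵖ idᵖ)))
  p₁ (p₂ ∙ᵖ p₃) p₄)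
  where
  open ℕ.≤-Reasoning
  row = rowTreeᵖ (constᵖ (encodeℤ (+ 1))) (hdᵖ (hdᵖ (tlᵖ idᵖ))) nilᵖ (hdᵖ idᵖ)
  ps = reverseOntoᵖ nilᵖ (tlᵖ (tlᵖ row))

  additive : Additive (κ 36 ⊕ rowBound ⟨ κ 7 ⊕ ι ⟩ᵇ) integralStep
  additive w a l = begin
    suc (size (rowRest r) + suc (3 + suc (suc (1 + suc (3 + suc (size (second s) +
      suc (size (first s) + size (scalarTree (encodeℤ (+ 1)))))))
      + size (second a))))
      ≡⟨ regroup (size (rowRest r)) (size (first s)) (size (second s)) (size (second a)) ⟩
    27 + (size (rowRest r) + (size (first s) + size (second s))) + size (second a)
      ≤⟨ ℕ.+-monoˡ-≤ (size (second a)) (ℕ.+-monoʳ-≤ 27 (ℕ.+-monoʳ-≤ (size (rowRest r)) (size-parts s))) ⟩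
    27 + (size (rowRest r) + suc (size s)) + size (second a)
      ≡⟨ regroup₂ (size (rowRest r)) (size s) (size (second a)) ⟩
    28 + (size (rowRest r) + size s) + size (second a)
      ≤⟨ ℕ.+-monoˡ-≤ (size (second a)) (ℕ.+-monoʳ-≤ 28 (row-size (encodeℤ (+ 1)) (first a) nil w _
           (ℕ.m≤m+n 7 (size w + size l)) (ℕ.≤-trans (ℕ.m≤m+n _ (size l)) (ℕ.m≤n+m _ 7)))) ⟩
    28 + (6 + size (first a) + 1 + b) + size (second a)
      ≡⟨ regroup₃ (size (first a)) (size (second a)) b ⟩
    (size (first a) + size (second a)) + 35 + b
      ≤⟨ ℕ.+-monoˡ-≤ b (ℕ.+-monoˡ-≤ 35 (size-parts a)) ⟩
    suc (size a) + 35 + b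
      ≡⟨ regroup₄ (size a) b ⟩
    size a + (36 + b)
      ≡⟨ cong (λ b → size a + (36 + b)) (⟪⟫-∘ rowBound (κ 7 ⊕ ι) (size w + size l)) ⟨
    size a + (36 + ⟪ rowBound ⟨ κ 7 ⊕ ι ⟩ᵇ ⟫ (size w + size l)) ∎
    where
    r = rowTree (encodeℤ (+ 1)) (first a) nil w
    s = rowResult r
    b = ⟪ rowBound ⟫ (7 + (size w + size l))
    regroup : ∀ r x y z → suc (r + suc (3 + suc (suc (1 + suc (3 + suc (y + suc (x + 13)))) + z)))
            ≡ 27 + (r + (x + y)) + z
    regroup = solve-∀
    regroup₂ : ∀ r x z → 27 + (r + suc x) + z ≡ 28 + (r + x) + z
    regroup₂ = solve-∀
    regroup₃ : ∀ x z b → 28 + (6 + x + 1 + b) + z ≡ (x + z) + 35 + b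
    regroup₃ = solve-∀
    regroup₄ : ∀ x b → suc x + 35 + b ≡ x + (36 + b)
    regroup₄ = solve-∀

-- The list w has one more element than there are free variables.
positiveTree : Tree → Tree
positiveTree w = encodeUnary 3 ∙ encodeUnary 0 ∙ encodeUnary 0 ∙ second w ∙ scalarTree (encodeℤ -[1+ 0 ])

translateTree : Tree → Tree
translateTree s = replicateTree digits (nil ∙ entries) ∙
  integralTree row is (conjoinTree (positiveTree row) (buildTree (first s ∙ row ∙ is) ts)) (first s)
  where
  ts row entries is n n² digits : Tree
  ts      = tokens (second s) nil
  -- The number `m` of free variables is not part of the input code. It is read off an atom, by
  -- dropping the first `k` entries of its coefficient list; the additional `nil` stands for the
  -- constant column.
  row     = replicateTree nil (nil ∙ second (splitTree (first s) (first (second (second (first ts))))))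
  entries = timesTree row (first s)
  is      = indices entries
  n       = countNodes s nil
  n²      = timesTree n n
  -- As `nil` codes the digit 2 in bijective base 2, a unary number is itself the code of a numeral
  -- consisting of twos. The bound thus costs no arithmetic beyond a unary fourth power.
  digits  = timesTree n² n²

translateTreeᵖ : PolyTime translateTree
translateTreeᵖ = replicateTreeᵖ digits (nilᵖ ∙ᵖ entries) ∙ᵖ
  integralTreeᵖ row is
    (constᵖ (encodeUnary 1) ∙ᵖ
      (constᵖ (encodeUnary 3) ∙ᵖ nilᵖ ∙ᵖ nilᵖ ∙ᵖ tlᵖ row ∙ᵖ constᵖ (scalarTree (encodeℤ -[1+ 0 ]))) ∙ᵖ
      buildTreeᵖ (k ∙ᵖ row ∙ᵖ is) ts)
    k
  where
  k       = hdᵖ idᵖ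
  ts      = tokensᵖ (tlᵖ idᵖ)
  row     = replicateTreeᵖ nilᵖ (nilᵖ ∙ᵖ tlᵖ (splitTreeᵖ k (hdᵖ (tlᵖ (tlᵖ (hdᵖ ts))))))
  entries = timesTreeᵖ row k
  is      = indicesᵖ entries
  n       = countNodesᵖ idᵖ
  n²      = timesTreeᵖ n n
  digits  = timesTreeᵖ n² n²

-- The translation of formulas

-- The accumulating recursion prepends monomials in the same order as `rowsTree`: the two codes have
-- to agree literally, not just up to reordering a sum.
column : ∀ {k n} → (Fin k → ℤ) → (Fin k → Fin n) → Poly n → Poly n
column {zero}  a is p = p
column {suc k} a is p = column (a ∘ suc) (is ∘ suc) ((a zero , is zero ∷ []) ∷ p)

scalar : ∀ {n} → ℤ → Poly (suc n)
scalar c = (c , zero ∷ []) ∷ []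

monomial : ∀ {n} → Fin n → Poly n
monomial i = (+ 1 , i ∷ []) ∷ []

-- The number 2ⁿ⁺¹ - 2, whose code is the unary number n.
bigBinary : ℕ → ℕᵇ
bigBinary zero    = ℕᵇ.zero
bigBinary (suc n) = 2[1+ bigBinary n ]

-- Variable 0 is the common denominator Q.  The variables entry i j are the
-- numerators X i j in  Q xᵢ + X i 0 = Σⱼ X i (j+1) yⱼ.
module _ {k m : ℕ} where

  Coefficient : Set
  Coefficient = Poly (suc (k * suc m))

  entry : Fin k → Fin (suc m) → Fin (suc (k * suc m))
  entry i j = suc (combine i j)

  -- The right-hand side is treated as column 0. Because `X₀` is subtracted in the substitution, it
  -- reaches the right-hand side with a plus sign, so the constant column has the same shape as the
  -- coefficients of `y`.
  extended : Vec ℤ (k + m) → ℤ → Fin (suc m) → ℤ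
  extended a b zero    = b
  extended a b (suc j) = lookup a (k ↑ʳ j)

  coefficient : Vec ℤ (k + m) → ℤ → Fin (suc m) → Coefficient
  coefficient a b j = column (λ i → lookup a (i ↑ˡ m)) (λ i → entry i j) (scalar (extended a b j))

  translateAtom : Atom ℤ (k + m) → Atom Coefficient m
  translateAtom (a ⊴ b)       = Vec.tabulate (λ j → coefficient a b (suc j)) ⊴ coefficient a b zero
  translateAtom (a ≋ b mod q) =
    Vec.tabulate (λ j → coefficient a b (suc j)) ≋ coefficient a b zero mod scalar q

  translateQF : QF ℤ (k + m) → QF Coefficient m
  translateQF (atom α) = atom (translateAtom α)
  translateQF (φ ∧ ψ)  = translateQF φ ∧ translateQF ψ
  translateQF (φ ∨ ψ)  = translateQF φ ∨ translateQF ψ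
  translateQF (~ φ)    = ~ translateQF φ

-- Strict positivity of `Q` is written as the negation of `0 ≤ -Q`, with zero polynomials as the
-- coefficients of `y`.
positive : ∀ {m n} → QF (Poly (suc n)) m
positive {m} = ~ atom (Vec.replicate m [] ⊴ scalar -[1+ 0 ])

integral : ∀ {k m n} → (Fin k → Fin (suc m) → Fin (suc n)) → QF (Poly (suc n)) m → QF (Poly (suc n)) m
integral {zero}  is φ = φ
integral {suc k} is φ = integral (is ∘ suc)
  (atom (Vec.tabulate (λ j → monomial (is zero (suc j))) ≋ monomial (is zero zero) mod scalar (+ 1)) ∧ φ)

translate : ∀ {m} → ∃PA m → ∃≤PA m
translate {m} ψ@(∃^ k ∶ φ) = ∃≤^ Vec.replicate (suc (k * suc m)) (ℕᵇ.toℕ (bigBinary (s² * s²))) ∶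
  integral {k} {m} entry (positive ∧ translateQF φ)
  where
  s² : ℕ
  s² = size (encode∃PA ψ) * size (encode∃PA ψ)

-- The program computes the translation

table : ∀ {n} → (Fin n → Tree) → Tree → Tree
table {zero}  f t = t
table {suc n} f t = f zero ∙ table (f ∘ suc) t

reversed : ∀ {n} → (Fin n → Tree) → Tree → Tree
reversed {zero}  f t = t
reversed {suc n} f t = reversed (f ∘ suc) (f zero ∙ t)

tables : ∀ {k n} → (Fin k → Fin n → Tree) → Tree → Tree
tables {zero}  f t = t
tables {suc k} f t = table (f zero) (tables (f ∘ suc) t)

table-cong : ∀ {n} {f g : Fin n → Tree} {t} → f ≗ g → table f t ≡ table g t
table-cong {zero}  eq = refl
table-cong {suc n} eq = cong₂ _∙_ (eq zero) (table-cong (eq ∘ suc))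

table-lookup : ∀ {A : Set} {n} (enc : A → Tree) (v : Vec A n) →
               encodeList enc (toList v) ≡ table (enc ∘ lookup v) nil
table-lookup enc []      = refl
table-lookup enc (x ∷ v) = cong (enc x ∙_) (table-lookup enc v)

table-tabulate : ∀ {A : Set} {n} (enc : A → Tree) (f : Fin n → A) →
                 encodeList enc (toList (Vec.tabulate f)) ≡ table (enc ∘ f) nil
table-tabulate {n = zero}  enc f = refl
table-tabulate {n = suc n} enc f = cong (enc (f zero) ∙_) (table-tabulate enc (f ∘ suc))

table-replicate : ∀ {A : Set} n (enc : A → Tree) (x : A) →
                  encodeList enc (toList (Vec.replicate n x)) ≡ table {n} (const (enc x)) nil
table-replicate zero    enc x = refl
table-replicate (suc n) enc x = cong (enc x ∙_) (table-replicate n enc x)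

encodeUnary-table : ∀ n → encodeUnary n ≡ table {n} (const nil) nil
encodeUnary-table zero    = refl
encodeUnary-table (suc n) = cong (nil ∙_) (encodeUnary-table n)

table-++ : ∀ k {n} (f : Fin (k + n) → Tree) t →
           table f t ≡ table (f ∘ (_↑ˡ n)) (table (f ∘ (k ↑ʳ_)) t)
table-++ zero    f t = refl
table-++ (suc k) f t = cong (f zero ∙_) (table-++ k (f ∘ suc) t)

table-∷ʳ : ∀ n (f : ℕ → Tree) t → table {n} (f ∘ toℕ) (f n ∙ t) ≡ table {suc n} (f ∘ toℕ) t
table-∷ʳ zero    f t = refl
table-∷ʳ (suc n) f t = cong (f 0 ∙_) (table-∷ʳ n (f ∘ suc) t)

tables-combine : ∀ k {n} (f : Fin (k * n) → Tree) t → tables (λ i j → f (combine {k} {n} i j)) t ≡ table f t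
tables-combine zero    f t = refl
tables-combine (suc k) {n} f t = trans
  (cong (table (λ j → f (j ↑ˡ (k * n)))) (tables-combine k (f ∘ (n ↑ʳ_)) t))
  (sym (table-++ n f t))

reverseOnto-reversed : ∀ {n} (f : Fin n → Tree) a t →
                       reverseOnto t (reversed f a) ≡ reverseOnto (table f t) a
reverseOnto-reversed {zero}  f a t = refl
reverseOnto-reversed {suc n} f a t = reverseOnto-reversed (f ∘ suc) (f zero ∙ a) t

reverseOnto-unary : ∀ n x → reverseOnto (encodeUnary x) (encodeUnary n) ≡ encodeUnary (n + x)
reverseOnto-unary zero    x = refl
reverseOnto-unary (suc n) x = trans (reverseOnto-unary n (suc x)) (cong encodeUnary (ℕ.+-suc n x))

timesTree-unary : ∀ n k → timesTree (encodeUnary n) (encodeUnary k) ≡ encodeUnary (k * n)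
timesTree-unary n k = trans (accumulate k 0) (cong encodeUnary (ℕ.+-identityʳ (k * n)))
  where
  accumulate : ∀ k x → fold (λ c a _ → reverseOnto a c) (encodeUnary n) (encodeUnary x) (encodeUnary k)
                     ≡ encodeUnary (k * n + x)
  accumulate zero    x = refl
  accumulate (suc k) x = begin
    fold (λ c a _ → reverseOnto a c) (encodeUnary n) (reverseOnto (encodeUnary x) (encodeUnary n)) (encodeUnary k)
      ≡⟨ cong (λ a → fold (λ c a _ → reverseOnto a c) (encodeUnary n) a (encodeUnary k)) (reverseOnto-unary n x) ⟩
    fold (λ c a _ → reverseOnto a c) (encodeUnary n) (encodeUnary (n + x)) (encodeUnary k)
      ≡⟨ accumulate k (n + x) ⟩
    encodeUnary (k * n + (n + x))
      ≡⟨ cong encodeUnary (trans (sym (ℕ.+-assoc (k * n) n x)) (cong (_+ x) (ℕ.+-comm (k * n) n))) ⟩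
    encodeUnary (n + k * n + x) ∎
    where open ≡-Reasoning

countNodes-size : ∀ t n → countNodes t (encodeUnary n) ≡ encodeUnary (size t + n)
countNodes-size nil     n = refl
countNodes-size (s ∙ t) n = begin
  countNodes t (countNodes s (encodeUnary (suc n)))      ≡⟨ cong (countNodes t) (countNodes-size s (suc n)) ⟩
  countNodes t (encodeUnary (size s + suc n))            ≡⟨ countNodes-size t (size s + suc n) ⟩
  encodeUnary (size t + (size s + suc n))                ≡⟨ cong encodeUnary (regroup (size t) (size s) n) ⟩
  encodeUnary (suc (size s + size t) + n)                ∎
  where
  open ≡-Reasoning
  regroup : ∀ t s n → t + (s + suc n) ≡ suc (s + t) + n
  regroup = solve-∀

indices-unary : ∀ n a → fold (λ _ a l → l ∙ a) nil a (encodeUnary n) ≡ table {n} (encodeUnary ∘ suc ∘ toℕ) a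
indices-unary zero    a = refl
indices-unary (suc n) a = trans (indices-unary n (encodeUnary (suc n) ∙ a)) (table-∷ʳ n (encodeUnary ∘ suc) a)

replicateTree-table : ∀ {n} x (f : Fin n → Tree) → replicateTree x (table f nil) ≡ table {n} (const x) nil
replicateTree-table x f = accumulate f nil
  where
  accumulate : ∀ {n} (f : Fin n → Tree) a → fold (λ c a _ → c ∙ a) x a (table f nil) ≡ table {n} (const x) a
  accumulate {zero}  f a = refl
  accumulate {suc n} f a = trans (accumulate (f ∘ suc) (x ∙ a)) (table-∷ʳ n (const x) a)

splitTree-table : ∀ {k} (f : Fin k → Tree) t → splitTree (encodeUnary k) (table f t) ≡ reversed f nil ∙ t
splitTree-table f t = accumulate f nil
  where
  accumulate : ∀ {k} (f : Fin k → Tree) p →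
               fold (λ _ a _ → (first (second a) ∙ first a) ∙ second (second a)) nil (p ∙ table f t) (encodeUnary k)
             ≡ reversed f p ∙ t
  accumulate {zero}  f p = refl
  accumulate {suc k} f p = accumulate (f ∘ suc) (f zero ∙ p)

scalarsTree-table : ∀ {n} (f : Fin n → Tree) → scalarsTree (table f nil) ≡ table (scalarTree ∘ f) nil
scalarsTree-table f = trans (cong (reverseOnto nil) (accumulate f nil)) (reverseOnto-reversed (scalarTree ∘ f) nil nil)
  where
  accumulate : ∀ {n} (f : Fin n → Tree) a →
               fold (λ _ a l → scalarTree (first l) ∙ a) nil a (table f nil) ≡ reversed (scalarTree ∘ f) a
  accumulate {zero}  f a = refl
  accumulate {suc n} f a = accumulate (f ∘ suc) (scalarTree (f zero) ∙ a)

rowTree-table : ∀ {n} c (f g : Fin n → Tree) t →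
                rowTree c (table f t) (table g nil) (encodeUnary n)
              ≡ t ∙ nil ∙ reversed (λ j → (c ∙ f j ∙ nil) ∙ g j) nil
rowTree-table c f g t = accumulate f g nil
  where
  accumulate : ∀ {n} (f g : Fin n → Tree) a →
               fold rowStep c (table f t ∙ table g nil ∙ a) (encodeUnary n)
             ≡ t ∙ nil ∙ reversed (λ j → (c ∙ f j ∙ nil) ∙ g j) a
  accumulate {zero}  f g a = refl
  accumulate {suc n} f g a = accumulate (f ∘ suc) (g ∘ suc) (((c ∙ f zero ∙ nil) ∙ g zero) ∙ a)

-- Running out of polynomials is harmless, since `first nil` is `nil`, the code of the zero
-- polynomial. The routine that extends coefficients therefore also produces the bare monomials of
-- the integrality conditions.
rowTree-nil : ∀ {n} c (f : Fin n → Tree) t →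
              rowTree c (table f t) nil (encodeUnary n) ≡ t ∙ nil ∙ reversed (λ j → (c ∙ f j ∙ nil) ∙ nil) nil
rowTree-nil c f t = accumulate f nil
  where
  accumulate : ∀ {n} (f : Fin n → Tree) a →
               fold rowStep c (table f t ∙ nil ∙ a) (encodeUnary n)
             ≡ t ∙ nil ∙ reversed (λ j → (c ∙ f j ∙ nil) ∙ nil) a
  accumulate {zero}  f a = refl
  accumulate {suc n} f a = accumulate (f ∘ suc) (((c ∙ f zero ∙ nil) ∙ nil) ∙ a)

encodeIndex : ∀ {n} → Fin n → Tree
encodeIndex i = encodeUnary (toℕ i)

-- The starting polynomials `p` are arbitrary because each row extends what the earlier rows have
-- left.
rowsTree-table : ∀ {k q n} (is : Fin k → Fin q → Fin n) t (a : Fin k → ℤ) (p : Fin q → Poly n) →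
                 rowsTree (encodeUnary q) (tables (λ i j → encodeIndex (is i j)) t)
                   (table (encodePoly ∘ p) nil) (table (encodeℤ ∘ a) nil)
               ≡ table (λ j → encodePoly (column a (λ i → is i j) (p j))) nil
rowsTree-table {zero}  is t a p = refl
rowsTree-table {suc k} {q} {n} is t a p = trans
  (cong (λ acc → second (fold rowsStep (encodeUnary q) acc (table (encodeℤ ∘ a ∘ suc) nil))) step)
  (rowsTree-table (is ∘ suc) t (a ∘ suc) p′)
  where
  p′ : Fin q → Poly n
  p′ j = (a zero , is zero j ∷ []) ∷ p j

  rest : Tree
  rest = tables (λ i j → encodeIndex (is (suc i) j)) t

  row : rowTree (encodeℤ (a zero)) (table (encodeIndex ∘ is zero) rest) (table (encodePoly ∘ p) nil) (encodeUnary q)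
      ≡ rest ∙ nil ∙ reversed (encodePoly ∘ p′) nil
  row = rowTree-table (encodeℤ (a zero)) (encodeIndex ∘ is zero) (encodePoly ∘ p) rest

  step : rowsStep (encodeUnary q)
           (table (encodeIndex ∘ is zero) rest ∙ table (encodePoly ∘ p) nil) (table (encodeℤ ∘ a) nil)
       ≡ rest ∙ table (encodePoly ∘ p′) nil
  step = trans (cong (λ r → rowRest r ∙ rowResult r) row)
    (cong (rest ∙_) (reverseOnto-reversed (encodePoly ∘ p′) nil nil))

module _ {k m : ℕ} where

  entries : Tree
  entries = tables (λ i j → encodeIndex (entry {k} {m} i j)) nil

  context : Tree
  context = encodeUnary k ∙ encodeUnary (suc m) ∙ entries

  atomTree-encode : ∀ α → atomTree context (encodeAtom encodeℤ α)
                        ≡ encodeQF encodePoly (atom (translateAtom {k} {m} α))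
  atomTree-encode α = by-cases α
    where
    prefix : Vec ℤ (k + m) → Fin k → Tree
    prefix a i = encodeℤ (lookup a (i ↑ˡ m))

    split : ∀ a → splitTree (encodeUnary k) (encodeList encodeℤ (toList a))
                ≡ reversed (prefix a) nil ∙ table (λ j → encodeℤ (lookup a (k ↑ʳ j))) nil
    split a = trans
      (cong (splitTree (encodeUnary k)) (trans (table-lookup encodeℤ a) (table-++ k (encodeℤ ∘ lookup a) nil)))
      (splitTree-table (prefix a) (table (λ j → encodeℤ (lookup a (k ↑ʳ j))) nil))

    polynomials : Vec ℤ (k + m) → ℤ → Tree
    polynomials a b = let s = splitTree (encodeUnary k) (encodeList encodeℤ (toList a)) in
      rowsTree (encodeUnary (suc m)) entries (scalarsTree (encodeℤ b ∙ second s)) (reverseOnto nil (first s))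

    polynomials-encode : ∀ a b → polynomials a b ≡ table (λ j → encodePoly (coefficient {k} {m} a b j)) nil
    polynomials-encode a b = begin
      polynomials a b
        ≡⟨ cong (λ s → rowsTree (encodeUnary (suc m)) entries (scalarsTree (encodeℤ b ∙ second s)) (reverseOnto nil (first s))) (split a) ⟩
      rowsTree (encodeUnary (suc m)) entries (scalarsTree (table (encodeℤ ∘ extended {k} {m} a b) nil)) (reverseOnto nil (reversed (prefix a) nil))
        ≡⟨ cong₂ (rowsTree (encodeUnary (suc m)) entries) (scalarsTree-table (encodeℤ ∘ extended {k} {m} a b))
             (reverseOnto-reversed (prefix a) nil nil) ⟩
      rowsTree (encodeUnary (suc m)) entries (table (λ j → encodePoly (scalar {k * suc m} (extended {k} {m} a b j))) nil) (table (prefix a) nil)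
        ≡⟨ rowsTree-table (entry {k} {m}) nil (λ i → lookup a (i ↑ˡ m)) (scalar ∘ extended {k} {m} a b) ⟩
      table (λ j → encodePoly (coefficient {k} {m} a b j)) nil ∎
      where open ≡-Reasoning

    coefficients : ∀ a b → second (polynomials a b)
                 ≡ encodeList encodePoly (toList (Vec.tabulate (λ j → coefficient {k} {m} a b (suc j))))
    coefficients a b = trans (cong second (polynomials-encode a b))
      (sym (table-tabulate encodePoly (λ j → coefficient {k} {m} a b (suc j))))

    constant : ∀ a b → first (polynomials a b) ≡ encodePoly (coefficient {k} {m} a b zero)
    constant a b = cong first (polynomials-encode a b)

    by-cases : ∀ α → atomTree context (encodeAtom encodeℤ α)
                   ≡ encodeQF encodePoly (atom (translateAtom {k} {m} α))
    by-cases (a ⊴ b) = cong₂ (λ s t → nil ∙ nil ∙ s ∙ t) (coefficients a b) (constant a b)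
    by-cases (a ≋ b mod q) = cong₂ (λ s t → nil ∙ encodeUnary 1 ∙ s ∙ t ∙ encodePoly (scalar {k * suc m} q))
      (coefficients a b) (constant a b)

  -- Processing the tokens of a formula amounts to pushing its translation, whatever the stack and
  -- the later tokens are. Reversed prefix order puts the right operand on the stack first, so the
  -- left operand is on top when the connective arrives.
  fold-tokens : ∀ φ a out → fold buildStep context a (tokens (encodeQF encodeℤ φ) out)
                          ≡ fold buildStep context (encodeQF encodePoly (translateQF {k} {m} φ) ∙ a) out
  fold-tokens (atom α) a out = cong (λ s → fold buildStep context (s ∙ a) out) (atomTree-encode α)
  fold-tokens (φ ∧ ψ)  a out = trans (fold-tokens ψ a (tokens (encodeQF encodeℤ φ) ((encodeUnary 1 ∙ nil) ∙ out)))
    (fold-tokens φ (encodeQF encodePoly (translateQF {k} {m} ψ) ∙ a) ((encodeUnary 1 ∙ nil) ∙ out))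
  fold-tokens (φ ∨ ψ)  a out = trans (fold-tokens ψ a (tokens (encodeQF encodeℤ φ) ((encodeUnary 2 ∙ nil) ∙ out)))
    (fold-tokens φ (encodeQF encodePoly (translateQF {k} {m} ψ) ∙ a) ((encodeUnary 2 ∙ nil) ∙ out))
  fold-tokens (~ φ)    a out = fold-tokens φ a ((encodeUnary 3 ∙ nil) ∙ out)

-- Prefix notation ends in a leaf, so its reversal starts with an atom. This supplies the
-- coefficient list from which `m` is recovered.
first-token : ∀ {n} (φ : QF ℤ n) out →
              Σ[ α ∈ Atom ℤ n ] first (tokens (encodeQF encodeℤ φ) out) ≡ encodeQF encodeℤ (atom α)
first-token (atom α) out = α , refl
first-token (φ ∧ ψ)  out = first-token ψ _
first-token (φ ∨ ψ)  out = first-token ψ _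
first-token (~ φ)    out = first-token φ _

integralTree-encode : ∀ {k m n} (is : Fin k → Fin (suc m) → Fin (suc n)) φ →
  integralTree (encodeUnary (suc m)) (tables (λ i j → encodeIndex (is i j)) nil) (encodeQF encodePoly φ) (encodeUnary k)
  ≡ encodeQF encodePoly (integral is φ)
integralTree-encode {zero}  is φ = refl
integralTree-encode {suc k} {m} {n} is φ = trans
  (cong (λ acc → second (fold integralStep (encodeUnary (suc m)) acc (encodeUnary k))) step)
  (integralTree-encode (is ∘ suc) _)
  where
  rest : Tree
  rest = tables (λ i j → encodeIndex (is (suc i) j)) nil

  monomials : Fin (suc m) → Tree
  monomials j = encodePoly (monomial (is zero j))

  r : Tree
  r = rowTree (encodeℤ (+ 1)) (table (encodeIndex ∘ is zero) rest) nil (encodeUnary (suc m))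

  row : r ≡ rest ∙ nil ∙ reversed monomials nil
  row = rowTree-nil (encodeℤ (+ 1)) (encodeIndex ∘ is zero) rest

  result : rowResult r ≡ table monomials nil
  result = trans (cong rowResult row) (reverseOnto-reversed monomials nil nil)

  step : integralStep (encodeUnary (suc m)) (table (encodeIndex ∘ is zero) rest ∙ encodeQF encodePoly φ) (encodeUnary (suc k))
       ≡ rest ∙ encodeQF encodePoly
           (atom (Vec.tabulate (λ j → monomial (is zero (suc j))) ≋ monomial (is zero zero) mod scalar (+ 1)) ∧ φ)
  step = cong₂ (λ x y → x ∙ conjoinTree y (encodeQF encodePoly φ)) (cong rowRest row)
    (cong₂ (λ s t → nil ∙ encodeUnary 1 ∙ s ∙ t ∙ scalarTree (encodeℤ (+ 1)))
      (trans (cong second result) (sym (table-tabulate encodePoly (λ j → monomial (is zero (suc j))))))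
      (cong first result))

encode-bigBinary : ∀ n → encodeℕ (ℕᵇ.toℕ (bigBinary n)) ≡ encodeUnary n
encode-bigBinary n = trans (cong encodeℕᵇ (ℕᵇ.fromℕ-toℕ (bigBinary n))) (digits n)
  where
  digits : ∀ n → encodeℕᵇ (bigBinary n) ≡ encodeUnary n
  digits zero    = refl
  digits (suc n) = cong (nil ∙_) (digits n)

translateTree-encode : ∀ {m} (ψ : ∃PA m) → translateTree (encode∃PA ψ) ≡ encode∃≤PA (translate ψ)
translateTree-encode {m} ψ@(∃^ k ∶ φ) = cong₂ _∙_ bounds matrix
  where
  open ≡-Reasoning
  s ts row : Tree
  s   = encode∃PA ψ
  ts  = tokens (encodeQF encodeℤ φ) nil
  row = replicateTree nil (nil ∙ second (splitTree (encodeUnary k) (first (second (second (first ts))))))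

  n : ℕ
  n = size s

  row-length : row ≡ encodeUnary (suc m)
  row-length with first-token φ nil
  ... | α , eq = begin
    row
      ≡⟨ cong (λ x → replicateTree nil (nil ∙ second (splitTree (encodeUnary k) (first (second (second x)))))) eq ⟩
    replicateTree nil (nil ∙ second (splitTree (encodeUnary k) (first (second (encodeAtom encodeℤ α)))))
      ≡⟨ cong (λ x → replicateTree nil (nil ∙ second (splitTree (encodeUnary k) x))) (proj₂ (coefficients α)) ⟩
    replicateTree nil (nil ∙ second (splitTree (encodeUnary k) (table (proj₁ (coefficients α)) nil)))
      ≡⟨ cong (λ x → replicateTree nil (nil ∙ second (splitTree (encodeUnary k) x))) (table-++ k (proj₁ (coefficients α)) nil) ⟩
    replicateTree nil (nil ∙ second (splitTree (encodeUnary k) (table prefix (table suffix nil))))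
      ≡⟨ cong (λ x → replicateTree nil (nil ∙ second x)) (splitTree-table prefix (table suffix nil)) ⟩
    replicateTree nil (nil ∙ table suffix nil)
      ≡⟨ replicateTree-table nil (λ { zero → nil ; (suc j) → suffix j }) ⟩
    table {suc m} (const nil) nil
      ≡⟨ encodeUnary-table (suc m) ⟨
    encodeUnary (suc m) ∎
    where
    coefficients : (α : Atom ℤ (k + m)) → ∃[ f ] first (second (encodeAtom encodeℤ α)) ≡ table {k + m} f nil
    coefficients (a ⊴ b)       = _ , table-lookup encodeℤ a
    coefficients (a ≋ b mod q) = _ , table-lookup encodeℤ a

    prefix : Fin k → Tree
    prefix i = proj₁ (coefficients α) (i ↑ˡ m)

    suffix : Fin m → Tree
    suffix j = proj₁ (coefficients α) (k ↑ʳ j)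

  entries-length : timesTree row (encodeUnary k) ≡ encodeUnary (k * suc m)
  entries-length = trans (cong (λ r → timesTree r (encodeUnary k)) row-length) (timesTree-unary (suc m) k)

  entries-encode : indices (timesTree row (encodeUnary k)) ≡ entries {k} {m}
  entries-encode = begin
    indices (timesTree row (encodeUnary k))          ≡⟨ cong indices entries-length ⟩
    indices (encodeUnary (k * suc m))                ≡⟨ indices-unary (k * suc m) nil ⟩
    table {k * suc m} (encodeUnary ∘ suc ∘ toℕ) nil  ≡⟨ tables-combine k {suc m} (encodeUnary ∘ suc ∘ toℕ) nil ⟨
    entries {k} {m}                                  ∎

  digits : Tree
  digits = let x = countNodes s nil; y = timesTree x x in timesTree y y

  digits-encode : digits ≡ encodeUnary ((n * n) * (n * n))
  digits-encode = begin
    digits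
      ≡⟨ cong (λ x → let y = timesTree x x in timesTree y y)
           (trans (countNodes-size s 0) (cong encodeUnary (ℕ.+-identityʳ n))) ⟩
    (let y = timesTree (encodeUnary n) (encodeUnary n) in timesTree y y)
      ≡⟨ cong (λ y → timesTree y y) (timesTree-unary n n) ⟩
    timesTree (encodeUnary (n * n)) (encodeUnary (n * n))
      ≡⟨ timesTree-unary (n * n) (n * n) ⟩
    encodeUnary ((n * n) * (n * n)) ∎

  B : ℕ
  B = ℕᵇ.toℕ (bigBinary ((n * n) * (n * n)))

  bounds : replicateTree digits (nil ∙ timesTree row (encodeUnary k))
         ≡ encodeList encodeℕ (toList (Vec.replicate (suc (k * suc m)) B))
  bounds = begin
    replicateTree digits (nil ∙ timesTree row (encodeUnary k))
      ≡⟨ cong₂ (λ x y → replicateTree x (nil ∙ y))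
           (trans digits-encode (sym (encode-bigBinary ((n * n) * (n * n)))))
           (trans entries-length (encodeUnary-table (k * suc m))) ⟩
    replicateTree (encodeℕ B) (table {suc (k * suc m)} (const nil) nil)
      ≡⟨ replicateTree-table (encodeℕ B) (const nil) ⟩
    table {suc (k * suc m)} (const (encodeℕ B)) nil
      ≡⟨ table-replicate (suc (k * suc m)) encodeℕ B ⟨
    encodeList encodeℕ (toList (Vec.replicate (suc (k * suc m)) B)) ∎

  build : buildTree (context {k} {m}) ts ≡ encodeQF encodePoly (translateQF {k} {m} φ)
  build = cong first (fold-tokens {k} {m} φ nil nil)

  positive-encode : positiveTree (encodeUnary (suc m)) ≡ encodeQF encodePoly (positive {m} {k * suc m})
  -- The zero polynomial has code `nil`, so the unary number `m` doubles as a list of `m` zero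
  -- polynomials.
  positive-encode = cong (λ x → encodeUnary 3 ∙ nil ∙ nil ∙ x ∙ encodePoly (scalar {k * suc m} -[1+ 0 ]))
    (trans (encodeUnary-table m) (sym (table-replicate m encodePoly [])))

  matrix : integralTree row (indices (timesTree row (encodeUnary k)))
             (conjoinTree (positiveTree row) (buildTree (encodeUnary k ∙ row ∙ indices (timesTree row (encodeUnary k))) ts))
             (encodeUnary k)
         ≡ encodeQF encodePoly (integral {k} {m} entry (positive ∧ translateQF φ))
  matrix = begin
    _ ≡⟨ cong₂ (λ r is → integralTree r is (conjoinTree (positiveTree r) (buildTree (encodeUnary k ∙ r ∙ is) ts)) (encodeUnary k))
           row-length entries-encode ⟩
    integralTree (encodeUnary (suc m)) (entries {k} {m})
      (conjoinTree (positiveTree (encodeUnary (suc m))) (buildTree (context {k} {m}) ts)) (encodeUnary k)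
      ≡⟨ cong₂ (λ x y → integralTree (encodeUnary (suc m)) (entries {k} {m}) (conjoinTree x y) (encodeUnary k))
           positive-encode build ⟩
    integralTree (encodeUnary (suc m)) (entries {k} {m}) (encodeQF encodePoly (positive ∧ translateQF {k} {m} φ)) (encodeUnary k)
      ≡⟨ integralTree-encode (entry {k} {m}) (positive ∧ translateQF φ) ⟩
    encodeQF encodePoly (integral {k} {m} entry (positive ∧ translateQF φ)) ∎

-- Correctness of the substitution

infix 7 _·_

_·_ : ∀ {n} → Vector ℤ n → Vector ℤ n → ℤ
a · x = sum (λ i → a i ℤ.* x i)

sum-++ : ∀ k {m} (f : Vector ℤ (k + m)) → sum f ≡ sum (f ∘ (_↑ˡ m)) ℤ.+ sum (f ∘ (k ↑ʳ_))
sum-++ zero    f = sym (ℤ.+-identityˡ _)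
sum-++ (suc k) f = trans (cong (λ s → f zero ℤ.+ s) (sum-++ k (f ∘ suc))) (sym (ℤ.+-assoc (f zero) _ _))

·-++ : ∀ {k m} (a : Vector ℤ (k + m)) (x : Vector ℤ k) (y : Vector ℤ m) →
       a · (x ++ y) ≡ (a ∘ (_↑ˡ m)) · x ℤ.+ (a ∘ (k ↑ʳ_)) · y
·-++ {k} {m} a x y = trans (sum-++ k _) (cong₂ ℤ._+_
  (sum-cong-≗ (λ i → cong (a (i ↑ˡ m) ℤ.*_) (lookup-++ˡ x y i)))
  (sum-cong-≗ (λ j → cong (a (k ↑ʳ j) ℤ.*_) (lookup-++ʳ x y j))))

·-congˡ : ∀ {n} {a b : Vector ℤ n} (x : Vector ℤ n) → a ≗ b → a · x ≡ b · x
·-congˡ x eq = sum-cong-≗ (λ i → cong (ℤ._* x i) (eq i))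

·-congʳ : ∀ {n} (a : Vector ℤ n) {x y : Vector ℤ n} → x ≗ y → a · x ≡ a · y
·-congʳ a eq = sum-cong-≗ (λ i → cong (a i ℤ.*_) (eq i))

·-distribˡ : ∀ {n} (a x y : Vector ℤ n) → a · (λ i → x i ℤ.+ y i) ≡ a · x ℤ.+ a · y
·-distribˡ a x y = trans (sum-cong-≗ (λ i → ℤ.*-distribˡ-+ (a i) (x i) (y i)))
  (∑-distrib-+ (λ i → a i ℤ.* x i) (λ i → a i ℤ.* y i))

·-distribʳ : ∀ {n} (a b x : Vector ℤ n) → (λ i → a i ℤ.+ b i) · x ≡ a · x ℤ.+ b · x
·-distribʳ a b x = trans (sum-cong-≗ (λ i → ℤ.*-distribʳ-+ (x i) (a i) (b i)))
  (∑-distrib-+ (λ i → a i ℤ.* x i) (λ i → b i ℤ.* x i))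

·-scaleˡ : ∀ {n} c (a x : Vector ℤ n) → (λ i → c ℤ.* a i) · x ≡ c ℤ.* (a · x)
·-scaleˡ c a x = trans (sum-cong-≗ (λ i → ℤ.*-assoc c (a i) (x i))) (sym (*-distribˡ-sum c (λ i → a i ℤ.* x i)))

·-scaleʳ : ∀ {n} c (a x : Vector ℤ n) → a · (λ i → c ℤ.* x i) ≡ c ℤ.* (a · x)
·-scaleʳ c a x = trans (sum-cong-≗ (λ i → swap (a i) c (x i))) (sym (*-distribˡ-sum c (λ i → a i ℤ.* x i)))
  where
  swap : ∀ a c x → a ℤ.* (c ℤ.* x) ≡ c ℤ.* (a ℤ.* x)
  swap = ℤ.solve-∀

·-combination : ∀ {r n} (c : Vector ℤ r) (A : Fin r → Vector ℤ n) (x : Vector ℤ n) →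
                (λ i → c · (λ l → A l i)) · x ≡ c · (λ l → A l · x)
·-combination c A x = begin
  sum (λ i → sum (λ l → c l ℤ.* A l i) ℤ.* x i)    ≡⟨ sum-cong-≗ (λ i → *-distribʳ-sum (x i) (λ l → c l ℤ.* A l i)) ⟩
  sum (λ i → sum (λ l → c l ℤ.* A l i ℤ.* x i))    ≡⟨ ∑-comm (λ i l → c l ℤ.* A l i ℤ.* x i) ⟩
  sum (λ l → sum (λ i → c l ℤ.* A l i ℤ.* x i))    ≡⟨ sum-cong-≗ (λ l → sum-cong-≗ (λ i → ℤ.*-assoc (c l) (A l i) (x i))) ⟩
  sum (λ l → sum (λ i → c l ℤ.* (A l i ℤ.* x i)))  ≡⟨ sum-cong-≗ (λ l → *-distribˡ-sum (c l) (λ i → A l i ℤ.* x i)) ⟨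
  sum (λ l → c l ℤ.* (A l · x))                    ∎
  where open ≡-Reasoning

evalPoly-column : ∀ {k n} x (a : Fin k → ℤ) (is : Fin k → Fin n) p →
                  evalPoly x (column a is p) ≡ a · (x ∘ is) ℤ.+ evalPoly x p
evalPoly-column {zero}  x a is p = sym (ℤ.+-identityˡ _)
evalPoly-column {suc k} x a is p = trans (evalPoly-column x (a ∘ suc) (is ∘ suc) _)
  (regroup ((a ∘ suc) · (x ∘ is ∘ suc)) (x (is zero)) (a zero) (evalPoly x p))
  where
  regroup : ∀ s x a p → s ℤ.+ (x ℤ.* a ℤ.+ p) ≡ a ℤ.* x ℤ.+ s ℤ.+ p
  regroup = ℤ.solve-∀

evalPoly-scalar : ∀ {n} (x : Vector ℤ (suc n)) c → evalPoly x (scalar c) ≡ c ℤ.* x zero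
evalPoly-scalar x c = trans (ℤ.+-identityʳ _) (ℤ.*-comm (x zero) c)

evalPoly-monomial : ∀ {n} (x : Vector ℤ n) i → evalPoly x (monomial i) ≡ x i
evalPoly-monomial x i = trans (ℤ.+-identityʳ _) (ℤ.*-identityʳ (x i))

i+k-k≡i : ∀ i k → i ℤ.+ k ℤ.- k ≡ i
i+k-k≡i = ℤ.solve-∀

i-k+k≡i : ∀ i k → i ℤ.- k ℤ.+ k ≡ i
i-k+k≡i = ℤ.solve-∀

+-cancelʳ-≤ : ∀ k {i j} → i ℤ.+ k ℤ.≤ j ℤ.+ k → i ℤ.≤ j
+-cancelʳ-≤ k {i} {j} le = subst₂ ℤ._≤_ (i+k-k≡i i k) (i+k-k≡i j k) (ℤ.+-monoˡ-≤ (ℤ.- k) le)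

+-cancelʳ-≡ : ∀ k {i j} → i ℤ.+ k ≡ j ℤ.+ k → i ≡ j
+-cancelʳ-≡ k {i} {j} eq = trans (sym (i+k-k≡i i k)) (trans (cong (ℤ._- k) eq) (i+k-k≡i j k))

positive⇒nonNegative : ∀ i → ℤ.Positive i → ℤ.NonNegative i
positive⇒nonNegative (+ suc n) _ = _

positive⇒nonZero : ∀ i → ℤ.Positive i → NonZero ∣ i ∣
positive⇒nonZero (+ suc n) _ = _

-- The substitution x = (X y - X₀)/Q.
module _ {k m} (v : Vector ℤ (suc (k * suc m))) (y : Vector ℤ m) (x : Vector ℤ k)
         (Q>0 : ℤ.Positive (v zero))
         (solves : ∀ i → v zero ℤ.* x i ℤ.+ v (entry {k} {m} i zero) ≡ (λ j → v (entry i (suc j))) · y) where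

  private
    Q : ℤ
    Q = v zero

    X : Fin k → Fin (suc m) → ℤ
    X i j = v (entry i j)

    -- The contribution of `X₀`. It occurs on both sides of the translated atom and cancels, leaving
    -- `Q` times the original atom.
    offset : Vec ℤ (k + m) → ℤ
    offset a = (λ i → lookup a (i ↑ˡ m)) · (λ i → X i zero)

    constant : ∀ a b → evalPoly v (coefficient {k} {m} a b zero) ≡ Q ℤ.* b ℤ.+ offset a
    constant a b = trans (evalPoly-column v (λ i → lookup a (i ↑ˡ m)) (λ i → entry {k} {m} i zero) (scalar b))
      (trans (cong (λ s → offset a ℤ.+ s) (evalPoly-scalar v b)) (regroup (offset a) b Q))
      where
      regroup : ∀ s b Q → s ℤ.+ b ℤ.* Q ≡ Q ℤ.* b ℤ.+ s
      regroup = ℤ.solve-∀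

    value : ∀ a b → linear (Vec.tabulate (λ j → coefficient {k} {m} a b (suc j))) (evalPoly v) y
                  ≡ Q ℤ.* linear a id (x ++ y) ℤ.+ offset a
    value a b = begin
      linear (Vec.tabulate (λ j → coefficient {k} {m} a b (suc j))) (evalPoly v) y
        ≡⟨ ·-congˡ y (λ j → trans (cong (evalPoly v) (lookup∘tabulate _ j)) (trans
             (evalPoly-column v α (λ i → entry i (suc j)) (scalar (β j)))
             (cong (λ s → α · (λ i → X i (suc j)) ℤ.+ s) (trans (evalPoly-scalar v (β j)) (ℤ.*-comm (β j) Q))))) ⟩
      (λ j → α · (λ i → X i (suc j)) ℤ.+ Q ℤ.* β j) · y
        ≡⟨ ·-distribʳ (λ j → α · (λ i → X i (suc j))) (λ j → Q ℤ.* β j) y ⟩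
      (λ j → α · (λ i → X i (suc j))) · y ℤ.+ (λ j → Q ℤ.* β j) · y
        ≡⟨ cong₂ ℤ._+_ (·-combination α (λ i j → X i (suc j)) y) (·-scaleˡ Q β y) ⟩
      α · (λ i → (λ j → X i (suc j)) · y) ℤ.+ Q ℤ.* (β · y)
        ≡⟨ cong (ℤ._+ Q ℤ.* (β · y)) (·-congʳ α (λ i → sym (solves i))) ⟩
      α · (λ i → Q ℤ.* x i ℤ.+ X i zero) ℤ.+ Q ℤ.* (β · y)
        ≡⟨ cong (ℤ._+ Q ℤ.* (β · y)) (trans (·-distribˡ α (λ i → Q ℤ.* x i) (λ i → X i zero))
             (cong (ℤ._+ offset a) (·-scaleʳ Q α x))) ⟩
      Q ℤ.* (α · x) ℤ.+ offset a ℤ.+ Q ℤ.* (β · y)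
        ≡⟨ regroup Q (α · x) (β · y) (offset a) ⟩
      Q ℤ.* (α · x ℤ.+ β · y) ℤ.+ offset a
        ≡⟨ cong (λ s → Q ℤ.* s ℤ.+ offset a) (·-++ (lookup a) x y) ⟨
      Q ℤ.* linear a id (x ++ y) ℤ.+ offset a ∎
      where
      open ≡-Reasoning
      α : Vector ℤ k
      α i = lookup a (i ↑ˡ m)
      β : Vector ℤ m
      β j = lookup a (k ↑ʳ j)
      regroup : ∀ Q a b s → Q ℤ.* a ℤ.+ s ℤ.+ Q ℤ.* b ≡ Q ℤ.* (a ℤ.+ b) ℤ.+ s
      regroup = ℤ.solve-∀

    instance
      Q-positive : ℤ.Positive Q
      Q-positive = Q>0

    Q-nonZero : NonZero ∣ Q ∣
    Q-nonZero = positive⇒nonZero Q Q>0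

    difference : ∀ a b → linear (Vec.tabulate (λ j → coefficient {k} {m} a b (suc j))) (evalPoly v) y
                           ℤ.- evalPoly v (coefficient {k} {m} a b zero)
                       ≡ Q ℤ.* (linear a id (x ++ y) ℤ.- b)
    difference a b = trans (cong₂ ℤ._-_ (value a b) (constant a b)) (regroup Q (linear a id (x ++ y)) b (offset a))
      where
      regroup : ∀ Q l b s → Q ℤ.* l ℤ.+ s ℤ.- (Q ℤ.* b ℤ.+ s) ≡ Q ℤ.* (l ℤ.- b)
      regroup = ℤ.solve-∀

    modulus : ∀ q → evalPoly v (scalar q) ≡ Q ℤ.* q
    modulus q = trans (evalPoly-scalar v q) (ℤ.*-comm q Q)

  translateAtom-sound : ∀ α → ⟦ translateAtom {k} {m} α ⟧ᵃ (evalPoly v) y → ⟦ α ⟧ᵃ id (x ++ y)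
  translateAtom-sound (a ⊴ b) h = ℤ.*-cancelˡ-≤-pos _ _ Q (+-cancelʳ-≤ (offset a)
    (subst₂ ℤ._≤_ (value a b) (constant a b) h))
  translateAtom-sound (a ≋ b mod q) h = ℤ.*-cancelˡ-∣ Q {q} {linear a id (x ++ y) ℤ.- b} {{Q-nonZero}}
    (subst₂ ℤ._∣_ (modulus q) (difference a b) h)

  translateAtom-complete : ∀ α → ⟦ α ⟧ᵃ id (x ++ y) → ⟦ translateAtom {k} {m} α ⟧ᵃ (evalPoly v) y
  translateAtom-complete (a ⊴ b) h = subst₂ ℤ._≤_ (sym (value a b)) (sym (constant a b))
    (ℤ.+-monoˡ-≤ (offset a) (ℤ.*-monoˡ-≤-nonNeg Q {{positive⇒nonNegative Q Q>0}} h))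
  translateAtom-complete (a ≋ b mod q) h = subst₂ ℤ._∣_ (sym (modulus q)) (sym (difference a b))
    (ℤ.*-monoʳ-∣ Q {q} {linear a id (x ++ y) ℤ.- b} h)

  -- Both directions are proved together because negation exchanges them.
  translateQF-sound : ∀ φ → ⟦ translateQF {k} {m} φ ⟧ (evalPoly v) y → ⟦ φ ⟧ id (x ++ y)
  translateQF-complete : ∀ φ → ⟦ φ ⟧ id (x ++ y) → ⟦ translateQF {k} {m} φ ⟧ (evalPoly v) y

  translateQF-sound (atom α) h       = translateAtom-sound α h
  translateQF-sound (φ ∧ ψ)  (h , i) = translateQF-sound φ h , translateQF-sound ψ i
  translateQF-sound (φ ∨ ψ)  h       = Sum.map (translateQF-sound φ) (translateQF-sound ψ) h
  translateQF-sound (~ φ)    h       = h ∘ translateQF-complete φ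

  translateQF-complete (atom α) h       = translateAtom-complete α h
  translateQF-complete (φ ∧ ψ)  (h , i) = translateQF-complete φ h , translateQF-complete ψ i
  translateQF-complete (φ ∨ ψ)  h       = Sum.map (translateQF-complete φ) (translateQF-complete ψ) h
  translateQF-complete (~ φ)    h       = h ∘ translateQF-sound φ

Integral : ∀ {k m n} → Vector ℤ (suc n) → Vector ℤ m → (Fin k → Fin (suc m) → Fin (suc n)) → Set
Integral v y is = ∀ i → v zero ℤ.∣ (λ j → v (is i (suc j))) · y ℤ.- v (is i zero)

module _ {m n} (v : Vector ℤ (suc n)) (y : Vector ℤ m) where

  private
    atom-≡ : ∀ (is : Fin (suc m) → Fin (suc n)) →
             ⟦ Vec.tabulate (λ j → monomial (is (suc j))) ≋ monomial (is zero) mod scalar (+ 1) ⟧ᵃ (evalPoly v) y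
             ≡ (v zero ℤ.∣ (λ j → v (is (suc j))) · y ℤ.- v (is zero))
    atom-≡ is = cong₂ ℤ._∣_ (trans (evalPoly-scalar v (+ 1)) (ℤ.*-identityˡ (v zero)))
      (cong₂ ℤ._-_
        (·-congˡ y (λ j → trans (cong (evalPoly v) (lookup∘tabulate _ j)) (evalPoly-monomial v (is (suc j)))))
        (evalPoly-monomial v (is zero)))

  integral-sound : ∀ {k} (is : Fin k → Fin (suc m) → Fin (suc n)) φ →
                   ⟦ integral is φ ⟧ (evalPoly v) y → Integral v y is × ⟦ φ ⟧ (evalPoly v) y
  integral-sound {zero}  is φ h = (λ ()) , h
  integral-sound {suc k} is φ h =
    let all , here , h′ = integral-sound (is ∘ suc) _ h
    in (λ { zero → subst id (atom-≡ (is zero)) here ; (suc i) → all i }) , h′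

  integral-complete : ∀ {k} (is : Fin k → Fin (suc m) → Fin (suc n)) φ →
                      Integral v y is → ⟦ φ ⟧ (evalPoly v) y → ⟦ integral is φ ⟧ (evalPoly v) y
  integral-complete {zero}  is φ all h = h
  integral-complete {suc k} is φ all h = integral-complete (is ∘ suc) _ (all ∘ suc)
    (subst id (sym (atom-≡ (is zero))) (all zero) , h)

  private
    zero-linear : linear (Vec.replicate m []) (evalPoly v) y ≡ + 0
    zero-linear = trans
      (sum-cong-≗ (λ j → cong (λ p → evalPoly v p ℤ.* y j) (lookup-replicate j [])))
      (sum-replicate-zero m)

  positive-sound : ⟦ positive {m} ⟧ (evalPoly v) y → ℤ.Positive (v zero)
  positive-sound h = by-sign (v zero) λ le →
    h (subst₂ ℤ._≤_ (sym zero-linear) (sym (trans (evalPoly-scalar v -[1+ 0 ]) (ℤ.-1*i≡-i (v zero)))) le)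
    where
    by-sign : ∀ i → ¬ (+ 0 ℤ.≤ ℤ.- i) → ℤ.Positive i
    by-sign (+ zero)   ¬le = contradiction (ℤ.+≤+ z≤n) ¬le
    by-sign (+ suc n)  ¬le = _
    by-sign -[1+ n ]   ¬le = contradiction (ℤ.+≤+ z≤n) ¬le

  positive-complete : ℤ.Positive (v zero) → ⟦ positive {m} ⟧ (evalPoly v) y
  positive-complete Q>0 h = by-sign (v zero) Q>0
    (subst₂ ℤ._≤_ zero-linear (trans (evalPoly-scalar v -[1+ 0 ]) (ℤ.-1*i≡-i (v zero))) h)
    where
    by-sign : ∀ i → ℤ.Positive i → ¬ (+ 0 ℤ.≤ ℤ.- i)
    by-sign (+ suc n) _ ()

translate-sound : ∀ {m} (ψ : ∃PA m) y → y ⊨∃≤ translate ψ → y ⊨∃ ψ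
translate-sound {m} (∃^ k ∶ φ) y (v , _ , h) =
  let ints , pos , h′ = integral-sound v y (entry {k} {m}) _ h
  in (λ i → Signed.quotient (divides i (ints i))) ,
     translateQF-sound v y _ (positive-sound v y pos) (λ i → solves i (ints i)) φ h′
  where
  value : Fin k → ℤ
  value i = (λ j → v (entry i (suc j))) · y

  divides : ∀ i → v zero ℤ.∣ value i ℤ.- v (entry i zero) → v zero Signed.∣ value i ℤ.- v (entry i zero)
  divides i = Signed.∣ᵤ⇒∣

  solves : ∀ i d → v zero ℤ.* Signed.quotient (divides i d) ℤ.+ v (entry i zero) ≡ value i
  solves i d = trans
    (cong (ℤ._+ v (entry i zero))
      (trans (ℤ.*-comm (v zero) _) (sym (Signed._∣_.equality (divides i d)))))
    (i-k+k≡i (value i) (v (entry i zero)))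

-- Siegel's lemma

sum-bound : ∀ {n} (f : Vector ℤ n) {B} → (∀ i → ∣ f i ∣ ≤ B) → ∣ sum f ∣ ≤ n * B
sum-bound {zero}  f b = z≤n
sum-bound {suc n} f b = ℕ.≤-trans (ℤ.∣i+j∣≤∣i∣+∣j∣ (f zero) _) (ℕ.+-mono-≤ (b zero) (sum-bound (f ∘ suc) (b ∘ suc)))

·-bound : ∀ {n} (a x : Vector ℤ n) {A X} → (∀ i → ∣ a i ∣ ≤ A) → (∀ i → ∣ x i ∣ ≤ X) → ∣ a · x ∣ ≤ n * (A * X)
·-bound a x bₐ bₓ = sum-bound (λ i → a i ℤ.* x i)
  (λ i → ℕ.≤-trans (ℕ.≤-reflexive (ℤ.abs-* (a i) (x i))) (ℕ.*-mono-≤ (bₐ i) (bₓ i)))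

^-distribʳ-* : ∀ r a b → (a * b) ^ r ≡ a ^ r * b ^ r
^-distribʳ-* zero    a b = refl
^-distribʳ-* (suc r) a b = trans (cong (a * b *_) (^-distribʳ-* r a b)) (interchange a b (a ^ r) (b ^ r))
  where
  interchange : ∀ a b c d → (a * b) * (c * d) ≡ (a * c) * (b * d)
  interchange = solve-∀

-- With `K = 2nH + 1` and `N = Kⁿ`, a row takes at most `2nHN + 1 ≤ KN` values on the box `[0, N)ⁿ`.
-- For `r < n` rows this gives at most `(KN)ʳ < Kⁿ Nʳ = Nʳ⁺¹ ≤ Nⁿ` images, fewer than there are
-- vectors.
siegelBase siegelBound : ℕ → ℕ → ℕ
siegelBase n H  = suc (2 * (n * H))
siegelBound n H = siegelBase n H ^ n

-- The integer vectors with entries in [0, N) outnumber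
-- their images under A, so two of them have the same image.
abstract
  siegel : ∀ {r n} H (A : Fin r → Vector ℤ n) → 1 ≤ H → r < n → (∀ i j → ∣ A i j ∣ ≤ H) →
           Σ[ v ∈ Vector ℤ n ] (∃[ j ] v j ≢ + 0) × (∀ i → A i · v ≡ + 0) × (∀ j → ∣ v j ∣ ≤ siegelBound n H)
  siegel {r} {n} H A 1≤H r<n A≤H = conclude (Fin.pigeonhole enough image)
    where
    K N S W : ℕ
    K = siegelBase n H
    N = siegelBound n H
    S = n * (H * N)
    W = suc (2 * S)

    2≤K : 2 ≤ K
    2≤K = s≤s (ℕ.≤-trans (ℕ.*-mono-≤ (ℕ.≤-trans (s≤s z≤n) r<n) 1≤H) (ℕ.m≤m+n (n * H) _))

    instance
      N≢0 : NonZero N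
      N≢0 = ℕ.m^n≢0 K n

    W≤KN : W ≤ K * N
    W≤KN = begin
      suc (2 * (n * (H * N)))     ≤⟨ ℕ.+-monoˡ-≤ (2 * S) (ℕ.m^n>0 K n) ⟩
      N + 2 * (n * (H * N))       ≡⟨ regroup n H N ⟩
      K * N                       ∎
      where
      open ℕ.≤-Reasoning
      regroup : ∀ n H N → N + 2 * (n * (H * N)) ≡ suc (2 * (n * H)) * N
      regroup = solve-∀

    enough : W ^ r < N ^ n
    enough = begin-strict
      W ^ r              ≤⟨ ℕ.^-monoˡ-≤ r W≤KN ⟩
      (K * N) ^ r        ≡⟨ ^-distribʳ-* r K N ⟩
      K ^ r * N ^ r      <⟨ ℕ.*-monoˡ-< (N ^ r) {{ℕ.m^n≢0 N r}} (ℕ.^-monoʳ-< K 2≤K r<n) ⟩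
      N * N ^ r          ≤⟨ ℕ.^-monoʳ-≤ N r<n ⟩
      N ^ n              ∎
      where open ℕ.≤-Reasoning

    vector : Fin (N ^ n) → Vector ℤ n
    vector p j = + toℕ (finToFun p j)

    vector≤N : ∀ p j → ∣ vector p j ∣ ≤ N
    vector≤N p j = ℕ.<⇒≤ (Fin.toℕ<n (finToFun p j))

    value≤S : ∀ p i → ∣ A i · vector p ∣ ≤ S
    value≤S p i = ·-bound (A i) (vector p) (A≤H i) (vector≤N p)

    -- Adding `S` moves the values from `[-S, S]` to `[0, 2S]`, so that they index `Fin W`.
    shifted : Fin (N ^ n) → Fin r → ℕ
    shifted p i = ∣ A i · vector p ℤ.+ + S ∣

    shifted<W : ∀ p i → shifted p i < W
    shifted<W p i = s≤s (begin
      ∣ A i · vector p ℤ.+ + S ∣     ≤⟨ ℤ.∣i+j∣≤∣i∣+∣j∣ (A i · vector p) (+ S) ⟩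
      ∣ A i · vector p ∣ + S         ≤⟨ ℕ.+-monoˡ-≤ S (value≤S p i) ⟩
      S + S                          ≤⟨ ℕ.+-monoʳ-≤ S (ℕ.m≤m+n S 0) ⟩
      2 * S                          ∎)
      where open ℕ.≤-Reasoning

    image : Fin (N ^ n) → Fin (W ^ r)
    image p = funToFin (λ i → fromℕ< (shifted<W p i))

    shifted-value : ∀ p i → + shifted p i ≡ A i · vector p ℤ.+ + S
    shifted-value p i = ℤ.0≤i⇒+∣i∣≡i (nonneg (A i · vector p) (value≤S p i))
      where
      nonneg : ∀ z → ∣ z ∣ ≤ S → + 0 ℤ.≤ z ℤ.+ + S
      nonneg (+ z)    b = ℤ.+≤+ z≤n
      nonneg -[1+ z ] b = subst (+ 0 ℤ.≤_) (sym (ℤ.⊖-≥ b)) (ℤ.+≤+ z≤n)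

    image-injective : ∀ {p q} → image p ≡ image q → ∀ i → A i · vector p ≡ A i · vector q
    image-injective {p} {q} eq i = +-cancelʳ-≡ (+ S)
      (trans (sym (shifted-value p i)) (trans (cong +_ same) (shifted-value q i)))
      where
      same : shifted p i ≡ shifted q i
      same = begin
        shifted p i                                   ≡⟨ Fin.toℕ-fromℕ< (shifted<W p i) ⟨
        toℕ (fromℕ< (shifted<W p i))                  ≡⟨ cong toℕ (Fin.finToFun-funToFin _ i) ⟨
        toℕ (finToFun (image p) i)                    ≡⟨ cong (λ f → toℕ (finToFun f i)) eq ⟩
        toℕ (finToFun (image q) i)                    ≡⟨ cong toℕ (Fin.finToFun-funToFin _ i) ⟩
        toℕ (fromℕ< (shifted<W q i))                  ≡⟨ Fin.toℕ-fromℕ< (shifted<W q i) ⟩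
        shifted q i                                   ∎
        where open ≡-Reasoning

    vector-injective : ∀ {p q} → (∀ j → vector p j ≡ vector q j) → p ≡ q
    vector-injective {p} {q} eq = begin
      p                        ≡⟨ Fin.funToFin-finToFin {n} {N} p ⟨
      funToFin {n} {N} (finToFun p)    ≡⟨ funToFin-cong (λ j → Fin.toℕ-injective (ℤ.+-injective (eq j))) ⟩
      funToFin {n} {N} (finToFun q)    ≡⟨ Fin.funToFin-finToFin {n} {N} q ⟩
      q                        ∎
      where
      open ≡-Reasoning
      funToFin-cong : ∀ {m n} {f g : Fin m → Fin n} → f ≗ g → funToFin f ≡ funToFin g
      funToFin-cong {zero}  eq = refl
      funToFin-cong {suc m} eq = cong₂ combine (eq zero) (funToFin-cong (eq ∘ suc))

    conclude : ∃₂ (λ p q → p Fin.< q × image p ≡ image q) →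
               Σ[ v ∈ Vector ℤ n ] (∃[ j ] v j ≢ + 0) × (∀ i → A i · v ≡ + 0) × (∀ j → ∣ v j ∣ ≤ N)
    conclude (p , q , p<q , eq) = v , nonzero , kernel , bounded
      where
      v : Vector ℤ n
      v j = vector p j ℤ.- vector q j

      nonzero : ∃[ j ] v j ≢ + 0
      nonzero = Fin.¬∀⟶∃¬ n _ (λ j → v j ℤ.≟ + 0)
        (λ all → Fin.<⇒≢ p<q (vector-injective (λ j → ℤ.i-j≡0⇒i≡j _ _ (all j))))

      kernel : ∀ i → A i · v ≡ + 0
      kernel i = begin
        A i · v                                                    ≡⟨ ·-congʳ (A i) (λ j → cong (λ s → vector p j ℤ.+ s) (ℤ.-1*i≡-i (vector q j))) ⟨
        A i · (λ j → vector p j ℤ.+ -[1+ 0 ] ℤ.* vector q j)       ≡⟨ ·-distribˡ (A i) (vector p) (λ j → -[1+ 0 ] ℤ.* vector q j) ⟩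
        A i · vector p ℤ.+ A i · (λ j → -[1+ 0 ] ℤ.* vector q j)   ≡⟨ cong₂ ℤ._+_ (image-injective eq i) (·-scaleʳ -[1+ 0 ] (A i) (vector q)) ⟩
        A i · vector q ℤ.+ -[1+ 0 ] ℤ.* (A i · vector q)           ≡⟨ cancel (A i · vector q) ⟩
        + 0                                                        ∎
        where
        open ≡-Reasoning
        cancel : ∀ a → a ℤ.+ -[1+ 0 ] ℤ.* a ≡ + 0
        cancel a = trans (cong (λ s → a ℤ.+ s) (ℤ.-1*i≡-i a)) (ℤ.+-inverseʳ a)

      bounded : ∀ j → ∣ v j ∣ ≤ N
      bounded j = begin
        ∣ + toℕ (finToFun p j) ℤ.- + toℕ (finToFun q j) ∣   ≡⟨ cong ∣_∣ (ℤ.m-n≡m⊖n (toℕ (finToFun p j)) (toℕ (finToFun q j))) ⟩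
        ∣ toℕ (finToFun p j) ℤ.⊖ toℕ (finToFun q j) ∣       ≤⟨ ℤ.∣m⊝n∣≤m⊔n (toℕ (finToFun p j)) (toℕ (finToFun q j)) ⟩
        toℕ (finToFun p j) ⊔ toℕ (finToFun q j)   ≤⟨ ℕ.⊔-lub (vector≤N p j) (vector≤N q j) ⟩
        N ∎
        where open ℕ.≤-Reasoning

-- Vertices near a solution

signum : ℤ → ℤ
signum (+ zero)  = + 0
signum (+ suc _) = + 1
signum -[1+ _ ]  = -[1+ 0 ]

signum-⊖ : ∀ m n → (m < n × signum (m ℤ.⊖ n) ≡ -[1+ 0 ]) ⊎
           (m ≡ n × signum (m ℤ.⊖ n) ≡ + 0) ⊎ (n < m × signum (m ℤ.⊖ n) ≡ + 1)
signum-⊖ zero    zero    = inj₂ (inj₁ (refl , refl))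
signum-⊖ zero    (suc n) = inj₁ (s≤s z≤n , refl)
signum-⊖ (suc m) zero    = inj₂ (inj₂ (s≤s z≤n , refl))
signum-⊖ (suc m) (suc n) = Sum.map (λ (a , b) → s≤s a , trans e b)
  (Sum.map (λ (a , b) → cong suc a , trans e b) (λ (a , b) → s≤s a , trans e b)) (signum-⊖ m n)
  where e = cong signum (ℤ.[1+m]⊖[1+n]≡m⊖n m n)

-- Used in contrapositive form: where a step changes the sign of the height, the height is at most
-- the length of the step.
signum-stable : ∀ u w → ∣ w ∣ < ∣ u ∣ → signum (u ℤ.+ w) ≡ signum u
signum-stable (+ suc a)  (+ n)     lt = refl
signum-stable (+ suc a)  -[1+ n ]  lt with signum-⊖ (suc a) (suc n)
... | inj₁ (gt , _)            = contradiction gt (ℕ.<-asym lt)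
... | inj₂ (inj₁ (eq , _))     = contradiction (sym eq) (ℕ.<⇒≢ lt)
... | inj₂ (inj₂ (_ , eq))     = eq
signum-stable -[1+ a ] (+ n)     lt with signum-⊖ n (suc a)
... | inj₁ (_ , eq)            = eq
... | inj₂ (inj₁ (eq , _))     = contradiction eq (ℕ.<⇒≢ lt)
... | inj₂ (inj₂ (gt , _))     = contradiction gt (ℕ.<-asym lt)
signum-stable -[1+ a ] -[1+ n ]  lt = refl

-- A step not directed along the sign of `u` goes towards zero, and keeping the sign it cannot
-- overshoot. At `u` equal to zero the hypotheses conflict, as any nonzero step leaves zero.
signum-descent : ∀ u w → w ≢ + 0 → signum u ≢ signum w → signum (u ℤ.+ w) ≡ signum u → ∣ u ℤ.+ w ∣ < ∣ u ∣
signum-descent (+ zero) w w≢0 opp same = contradiction (sym (trans (cong signum (sym (ℤ.+-identityˡ w))) same)) opp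
signum-descent (+ suc a) (+ zero)  w≢0 opp same = contradiction refl w≢0
signum-descent (+ suc a) (+ suc n) w≢0 opp same = contradiction refl opp
signum-descent (+ suc a) -[1+ n ]  w≢0 opp same with signum-⊖ (suc a) (suc n)
... | inj₁ (_ , eq)        with () ← trans (sym same) eq
... | inj₂ (inj₁ (_ , eq)) with () ← trans (sym same) eq
... | inj₂ (inj₂ (gt , _)) = subst (_< suc a) (sym (cong ∣_∣ (ℤ.⊖-≥ (ℕ.<⇒≤ gt)))) (s≤s (ℕ.m∸n≤m a n))
signum-descent -[1+ a ] (+ zero)  w≢0 opp same = contradiction refl w≢0
signum-descent -[1+ a ] -[1+ n ]  w≢0 opp same = contradiction refl opp
signum-descent -[1+ a ] (+ suc n) w≢0 opp same with signum-⊖ (suc n) (suc a)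
... | inj₂ (inj₁ (_ , eq)) with () ← trans (sym same) eq
... | inj₂ (inj₂ (_ , eq)) with () ← trans (sym same) eq
... | inj₁ (lt , _) = subst (_< suc a) (sym (trans (cong ∣_∣ (ℤ.⊖-< lt)) (ℤ.∣-i∣≡∣i∣ (+ (suc a ∸ suc n))))) (s≤s (ℕ.m∸n≤m a n))

signum-neg : ∀ w → w ≢ + 0 → signum w ≢ signum (ℤ.- w)
signum-neg (+ zero)  w≢0 _ = w≢0 refl
signum-neg (+ suc _) w≢0 ()
signum-neg -[1+ _ ]  w≢0 ()

·-zeroʳ : ∀ {n} (a : Vector ℤ n) → a · (const (+ 0)) ≡ + 0
·-zeroʳ {n} a = trans (sum-cong-≗ (λ i → ℤ.*-zeroʳ (a i))) (sum-replicate-zero n)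

·-zeroˡ : ∀ {n} (x : Vector ℤ n) → const (+ 0) · x ≡ + 0
·-zeroˡ {n} x = sum-replicate-zero n

-- Only the normals are bounded, not the offsets `γ`, which will contain `y`. The hypothesis
-- `spanning` guarantees that every nonzero direction meets some hyperplane transversally.
module Arrangement {p k : ℕ} (A : Fin p → Vector ℤ k) (γ : Fin p → ℤ)
                   (spanning : ∀ v → (∃[ i ] v i ≢ + 0) → ∃[ j ] A j · v ≢ + 0)
                   (H : ℕ) (1≤H : 1 ≤ H) (A≤H : ∀ j i → ∣ A j i ∣ ≤ H)
                   (M : ℕ) (M≢0 : NonZero M) where

  height : Fin p → Vector ℤ k → ℤ
  height j x = A j · x ℤ.- γ j

  height-+ : ∀ j {x x′} t w → (∀ i → x′ i ≡ x i ℤ.+ t ℤ.* w i) → height j x′ ≡ height j x ℤ.+ t ℤ.* (A j · w)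
  height-+ j {x} {x′} t w eq = begin
    A j · x′ ℤ.- γ j                                        ≡⟨ cong (ℤ._- γ j) (·-congʳ (A j) eq) ⟩
    A j · (λ i → x i ℤ.+ t ℤ.* w i) ℤ.- γ j                 ≡⟨ cong (ℤ._- γ j) (trans (·-distribˡ (A j) x (λ i → t ℤ.* w i))
                                                                 (cong (λ s → A j · x ℤ.+ s) (·-scaleʳ t (A j) w))) ⟩
    A j · x ℤ.+ t ℤ.* (A j · w) ℤ.- γ j                     ≡⟨ regroup (A j · x) (t ℤ.* (A j · w)) (γ j) ⟩
    height j x ℤ.+ t ℤ.* (A j · w)                          ∎
    where
    open ≡-Reasoning
    regroup : ∀ a b c → a ℤ.+ b ℤ.- c ≡ a ℤ.- c ℤ.+ b
    regroup = ℤ.solve-∀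

  SameSide : Vector ℤ k → Vector ℤ k → Set
  SameSide x x′ = ∀ j → signum (height j x′) ≡ signum (height j x)

  -- Walk from x along w as long as no hyperplane is touched, left or crossed.
  descend : ∀ n x w j → ∣ height j x ∣ ≤ n → A j · w ≢ + 0 → signum (height j x) ≢ signum (A j · w) →
            Σ[ t ∈ ℤ ] Σ[ x′ ∈ Vector ℤ k ] (∀ i → x′ i ≡ x i ℤ.+ t ℤ.* w i) × SameSide x x′ ×
            (∃[ j′ ] signum (height j′ x′ ℤ.+ A j′ · w) ≢ signum (height j′ x′))
  descend n x w j h≤n Aw≢0 opposite
    with Fin.all? (λ j′ → signum (height j′ x ℤ.+ A j′ · w) ℤ.≟ signum (height j′ x))
  ... | no ¬all = + 0 , x , (λ i → sym (ℤ.+-identityʳ (x i))) , (λ _ → refl) ,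
    Fin.¬∀⟶∃¬ p _ (λ j′ → signum (height j′ x ℤ.+ A j′ · w) ℤ.≟ signum (height j′ x)) ¬all
  ... | yes all = continue n h≤n
    where
    x₁ : Vector ℤ k
    x₁ i = x i ℤ.+ w i

    height₁ : ∀ j′ → height j′ x₁ ≡ height j′ x ℤ.+ A j′ · w
    height₁ j′ = trans (height-+ j′ {x} (+ 1) w (λ i → cong (λ s → x i ℤ.+ s) (sym (ℤ.*-identityˡ (w i)))))
      (cong (λ s → height j′ x ℤ.+ s) (ℤ.*-identityˡ (A j′ · w)))

    side₁ : SameSide x x₁
    side₁ j′ = trans (cong signum (height₁ j′)) (all j′)

    -- This bounds the length of the walk: `w` does not point away from hyperplane `j`, so every
    -- step that keeps all signs brings the point strictly nearer to it.
    closer : ∣ height j x₁ ∣ < ∣ height j x ∣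
    closer = subst (λ h → ∣ h ∣ < ∣ height j x ∣) (sym (height₁ j))
      (signum-descent (height j x) (A j · w) Aw≢0 opposite (all j))

    continue : ∀ n → ∣ height j x ∣ ≤ n → _
    continue zero    h≤n with () ← ℕ.<-≤-trans closer h≤n
    continue (suc n) h≤n with descend n x₁ w j (ℕ.≤-pred (ℕ.<-≤-trans closer h≤n)) Aw≢0
                                (λ eq → opposite (trans (sym (side₁ j)) eq))
    ... | t , x′ , eq , side , crossed = + 1 ℤ.+ t , x′ , (λ i → trans (eq i) (regroup (x i) (w i) t)) ,
      (λ j′ → trans (side j′) (side₁ j′)) , crossed
      where
      regroup : ∀ x w t → x ℤ.+ w ℤ.+ t ℤ.* w ≡ x ℤ.+ (+ 1 ℤ.+ t) ℤ.* w
      regroup = ℤ.solve-∀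

  Independent : ∀ {r} → (Fin r → Fin p) → Set
  Independent {r} I = ∀ (c : Vector ℤ r) → (∀ i → c · (λ l → A (I l) i) ≡ + 0) → ∀ l → c l ≡ + 0

  -- The largest change of height caused by one step `±M v`, where `v` comes from Siegel's lemma.
  nearBound : ℕ
  nearBound = k * (H * (M * siegelBound k H))

  record Near (x₀ : Vector ℤ k) (r : ℕ) : Set where
    constructor near
    field
      point       : Vector ℤ k
      steps       : Vector ℤ k
      congruent   : ∀ i → point i ≡ x₀ i ℤ.+ + M ℤ.* steps i
      sameSide    : SameSide x₀ point
      chosen      : Fin r → Fin p
      close       : ∀ l → ∣ height (chosen l) point ∣ ≤ nearBound
      independent : Independent chosen

  -- Heights over the chosen hyperplanes do not change, since `v` is parallel to them. The
  -- hyperplane that stops the walk need not be `j`; but a step along `v` changes its sign, so `v`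
  -- is not parallel to it, and this alone makes it independent of the chosen ones.
  extendAlong : ∀ {x₀ r} (s : Near x₀ r) v → (∀ l → A (Near.chosen s l) · v ≡ + 0) →
                (∀ i → ∣ v i ∣ ≤ siegelBound k H) → ∀ j → A j · v ≢ + 0 → Near x₀ (suc r)
  extendAlong {x₀} {r} (near x z cong-x side I close indep) v kernel v≤N j Av≢0 = conclude direction
    where
    nonzero-product : ∀ {a b} → a ≢ + 0 → b ≢ + 0 → a ℤ.* b ≢ + 0
    nonzero-product {a} a≢0 b≢0 eq = [ a≢0 , b≢0 ]′ (ℤ.i*j≡0⇒i≡0∨j≡0 a eq)

    scaled : ℤ → Vector ℤ k
    scaled μ i = μ ℤ.* v i

    M≢0ℤ : + M ≢ + 0
    M≢0ℤ eq = ℕ.≢-nonZero⁻¹ M {{M≢0}} (ℤ.+-injective eq)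

    Direction : Set
    Direction = Σ[ μ ∈ ℤ ] ∣ μ ∣ ≡ M × (∃[ s ] μ ≡ + M ℤ.* s) × A j · scaled μ ≢ + 0
                  × signum (height j x) ≢ signum (A j · scaled μ)

    direction : Direction
    direction with signum (height j x) ℤ.≟ signum (A j · scaled (+ M))
    ... | no  opp  = + M , refl , (+ 1 , sym (ℤ.*-identityʳ (+ M))) , nz , opp
      where
      nz : A j · scaled (+ M) ≢ + 0
      nz = subst (_≢ + 0) (sym (·-scaleʳ (+ M) (A j) v)) (nonzero-product M≢0ℤ Av≢0)
    -- Here `+M` leads away from hyperplane `j`, so the opposite direction leads towards it.
    ... | yes same = ℤ.- (+ M) , ℤ.∣-i∣≡∣i∣ (+ M) ,
      (-[1+ 0 ] , trans (sym (ℤ.-1*i≡-i (+ M))) (ℤ.*-comm -[1+ 0 ] (+ M))) ,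
      subst (_≢ + 0) (sym negated) (λ eq → nz (ℤ.neg-injective eq)) ,
      λ eq → signum-neg (A j · scaled (+ M)) nz (trans (sym same) (trans eq (cong signum negated)))
      where
      nz : A j · scaled (+ M) ≢ + 0
      nz = subst (_≢ + 0) (sym (·-scaleʳ (+ M) (A j) v)) (nonzero-product M≢0ℤ Av≢0)
      negated : A j · scaled (ℤ.- (+ M)) ≡ ℤ.- (A j · scaled (+ M))
      negated = trans (·-scaleʳ (ℤ.- (+ M)) (A j) v)
        (trans (sym (ℤ.neg-distribˡ-* (+ M) (A j · v))) (cong ℤ.-_ (sym (·-scaleʳ (+ M) (A j) v))))

    conclude : Direction → Near x₀ (suc r)
    conclude (μ , ∣μ∣≡M , (s , μ≡Ms) , Aw≢0 , opp)
      with descend ∣ height j x ∣ x (scaled μ) j ℕ.≤-refl Aw≢0 opp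
    ... | t , x′ , x′≡ , side′ , j′ , crossed = near x′ z′ congruent′ (λ i → trans (side′ i) (side i))
      (j′ Vector.∷ I) close′ independent′
      where
      w : Vector ℤ k
      w = scaled μ

      z′ : Vector ℤ k
      z′ i = z i ℤ.+ t ℤ.* s ℤ.* v i

      congruent′ : ∀ i → x′ i ≡ x₀ i ℤ.+ + M ℤ.* z′ i
      congruent′ i = begin
        x′ i                                                        ≡⟨ x′≡ i ⟩
        x i ℤ.+ t ℤ.* (μ ℤ.* v i)                                   ≡⟨ cong₂ (λ a b → a ℤ.+ t ℤ.* (b ℤ.* v i)) (cong-x i) μ≡Ms ⟩
        x₀ i ℤ.+ + M ℤ.* z i ℤ.+ t ℤ.* (+ M ℤ.* s ℤ.* v i)          ≡⟨ regroup (x₀ i) (+ M) (z i) t s (v i) ⟩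
        x₀ i ℤ.+ + M ℤ.* (z i ℤ.+ t ℤ.* s ℤ.* v i)                  ∎
        where
        open ≡-Reasoning
        regroup : ∀ x m z t s v → x ℤ.+ m ℤ.* z ℤ.+ t ℤ.* (m ℤ.* s ℤ.* v) ≡ x ℤ.+ m ℤ.* (z ℤ.+ t ℤ.* s ℤ.* v)
        regroup = ℤ.solve-∀

      Aw≢0′ : A j′ · w ≢ + 0
      Aw≢0′ eq = crossed (cong signum (trans (cong (λ s → height j′ x′ ℤ.+ s) eq) (ℤ.+-identityʳ _)))

      Av≢0′ : A j′ · v ≢ + 0
      Av≢0′ eq = Aw≢0′ (trans (·-scaleʳ μ (A j′) v) (trans (cong (λ s → μ ℤ.* s) eq) (ℤ.*-zeroʳ μ)))

      close′ : ∀ l → ∣ height ((j′ Vector.∷ I) l) x′ ∣ ≤ nearBound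
      -- The next step would change this sign, so the height is at most `∣ A j′ · w ∣`.
      close′ zero = ℕ.≤-trans (ℕ.≮⇒≥ (λ lt → crossed (signum-stable (height j′ x′) (A j′ · w) lt)))
        (·-bound (A j′) w (A≤H j′) (λ i → ℕ.≤-trans (ℕ.≤-reflexive (ℤ.abs-* μ (v i)))
          (ℕ.*-mono-≤ (ℕ.≤-reflexive ∣μ∣≡M) (v≤N i))))
      close′ (suc l) = subst (λ h → ∣ h ∣ ≤ nearBound) (sym unchanged) (close l)
        where
        unchanged : height (I l) x′ ≡ height (I l) x
        unchanged = begin
          height (I l) x′                                     ≡⟨ height-+ (I l) {x} t w x′≡ ⟩
          height (I l) x ℤ.+ t ℤ.* (A (I l) · w)              ≡⟨ cong (λ s → height (I l) x ℤ.+ t ℤ.* s)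
                                                                   (trans (·-scaleʳ μ (A (I l)) v) (cong (λ s → μ ℤ.* s) (kernel l))) ⟩
          height (I l) x ℤ.+ t ℤ.* (μ ℤ.* + 0)                ≡⟨ vanish (height (I l) x) t μ ⟩
          height (I l) x                                      ∎
          where
          open ≡-Reasoning
          vanish : ∀ h t μ → h ℤ.+ t ℤ.* (μ ℤ.* + 0) ≡ h
          vanish = ℤ.solve-∀

      independent′ : Independent (j′ Vector.∷ I)
      independent′ c c≡0 = λ { zero → c₀≡0 ; (suc l) → indep (c ∘ suc) tail≡0 l }
        where
        open ≡-Reasoning
        -- Pairing the linear relation with `v` kills every term except that of the new hyperplane.
        product≡0 : c zero ℤ.* (A j′ · v) ≡ + 0
        product≡0 = begin
          c zero ℤ.* (A j′ · v)
            ≡⟨ ℤ.+-identityʳ _ ⟨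
          c zero ℤ.* (A j′ · v) ℤ.+ + 0
            ≡⟨ cong (λ s → c zero ℤ.* (A j′ · v) ℤ.+ s) (trans (·-congʳ (c ∘ suc) kernel) (·-zeroʳ (c ∘ suc))) ⟨
          c · (λ l → A ((j′ Vector.∷ I) l) · v)
            ≡⟨ ·-combination c (A ∘ (j′ Vector.∷ I)) v ⟨
          (λ i → c · (λ l → A ((j′ Vector.∷ I) l) i)) · v
            ≡⟨ trans (·-congˡ v c≡0) (·-zeroˡ v) ⟩
          + 0 ∎

        c₀≡0 : c zero ≡ + 0
        c₀≡0 = [ id , (λ eq → contradiction eq Av≢0′) ]′ (ℤ.i*j≡0⇒i≡0∨j≡0 (c zero) product≡0)

        tail≡0 : ∀ i → (c ∘ suc) · (λ l → A (I l) i) ≡ + 0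
        tail≡0 i = begin
          (c ∘ suc) · (λ l → A (I l) i)                              ≡⟨ ℤ.+-identityˡ _ ⟨
          + 0 ℤ.* A j′ i ℤ.+ (c ∘ suc) · (λ l → A (I l) i)           ≡⟨ cong (λ s → s ℤ.* A j′ i ℤ.+ (c ∘ suc) · (λ l → A (I l) i)) c₀≡0 ⟨
          c · (λ l → A ((j′ Vector.∷ I) l) i)                               ≡⟨ c≡0 i ⟩
          + 0                                                        ∎

  extend : ∀ {x₀ r} → r < k → Near x₀ r → Near x₀ (suc r)
  extend r<k s =
    let v , v≢0 , kernel , v≤N = siegel H (A ∘ Near.chosen s) 1≤H r<k (λ l → A≤H (Near.chosen s l))
        j , Av≢0 = spanning v v≢0
    in extendAlong s v kernel v≤N j Av≢0

  nearVertex : ∀ x₀ r → r ≤ k → Near x₀ r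
  nearVertex x₀ zero    _   = near x₀ (const (+ 0))
    (λ i → sym (trans (cong (λ s → x₀ i ℤ.+ s) (ℤ.*-zeroʳ (+ M))) (ℤ.+-identityʳ (x₀ i))))
    (λ _ → refl) (λ ()) (λ ()) (λ _ _ ())
  nearVertex x₀ (suc r) r<k = extend r<k (nearVertex x₀ r (ℕ.<⇒≤ r<k))

-- Small parametrisations of solutions

unit : ∀ {n} → Fin n → Vector ℤ n
unit zero    zero    = + 1
unit zero    (suc j) = + 0
unit (suc i) zero    = + 0
unit (suc i) (suc j) = unit i j

unit-· : ∀ {n} (i : Fin n) x → unit i · x ≡ x i
unit-· {suc n} zero x = begin
  + 1 ℤ.* x zero ℤ.+ const (+ 0) · (x ∘ suc)    ≡⟨ cong₂ ℤ._+_ (ℤ.*-identityˡ (x zero)) (·-zeroˡ (x ∘ suc)) ⟩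
  x zero ℤ.+ + 0                                ≡⟨ ℤ.+-identityʳ (x zero) ⟩
  x zero                                        ∎
  where open ≡-Reasoning
unit-· (suc i) x = trans (ℤ.+-identityˡ _) (unit-· i (x ∘ suc))

∣unit∣≤1 : ∀ {n} (i j : Fin n) → ∣ unit i j ∣ ≤ 1
∣unit∣≤1 zero    zero    = ℕ.≤-refl
∣unit∣≤1 zero    (suc j) = z≤n
∣unit∣≤1 (suc i) zero    = z≤n
∣unit∣≤1 (suc i) (suc j) = ∣unit∣≤1 i j

·-comm : ∀ {n} (a b : Vector ℤ n) → a · b ≡ b · a
·-comm a b = sum-cong-≗ (λ i → ℤ.*-comm (a i) (b i))

-- A vector is determined over ℚ by its products with a basis; the
-- coefficients come from Siegel's lemma applied to the basis and a unit vector.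
record SmallCoordinate {k} (B : ℕ) (A : Fin k → Vector ℤ k) (i : Fin k) : Set where
  field
    denominator         : ℕ
    denominator≢0       : NonZero denominator
    denominator≤        : denominator ≤ B
    coefficients        : Vector ℤ k
    coefficients≤       : ∀ l → ∣ coefficients l ∣ ≤ B
    solves              : ∀ x → + denominator ℤ.* x i ℤ.+ coefficients · (λ l → A l · x) ≡ + 0

-- The `k + 1` vectors `unit i` and `A l` in dimension `k` satisfy a small integer relation, which
-- takes the place of Cramer's rule. The coefficient of `unit i` cannot vanish, since the rest would
-- be a nontrivial relation between the independent `A l`. Pairing with `x` solves for `x i`.
smallCoordinate : ∀ {k} H → 1 ≤ H → (A : Fin k → Vector ℤ k) → (∀ l i → ∣ A l i ∣ ≤ H) →
                  (∀ c → (∀ i → c · (λ l → A l i) ≡ + 0) → ∀ l → c l ≡ + 0) →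
                  ∀ i → SmallCoordinate (siegelBound (suc k) H) A i
smallCoordinate {k} H 1≤H A A≤H indep i =
  let v , v≢0 , kernel , v≤ = siegel H (λ i′ l → basis l i′) 1≤H (ℕ.n<1+n k) (λ i′ l → basis≤H l i′)
  in fromRelation v v≢0 (λ i′ → trans (·-comm v (λ l → basis l i′)) (kernel i′)) v≤
  where
  basis : Fin (suc k) → Vector ℤ k
  basis = unit i Vector.∷ A

  basis≤H : ∀ l i′ → ∣ basis l i′ ∣ ≤ H
  basis≤H zero    i′ = ℕ.≤-trans (∣unit∣≤1 i i′) 1≤H
  basis≤H (suc l) i′ = A≤H l i′

  fromRelation : ∀ v → (∃[ l ] v l ≢ + 0) → (∀ i′ → v · (λ l → basis l i′) ≡ + 0) →
                 (∀ l → ∣ v l ∣ ≤ siegelBound (suc k) H) → SmallCoordinate (siegelBound (suc k) H) A i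
  fromRelation v (l , vₗ≢0) relation v≤ = by-sign (v zero) refl
    where
    open ≡-Reasoning

    leading≢0 : v zero ≢ + 0
    leading≢0 v₀≡0 = vₗ≢0 (all≡0 l)
      where
      tail≡0 : ∀ i′ → (v ∘ suc) · (λ l → A l i′) ≡ + 0
      tail≡0 i′ = begin
        (v ∘ suc) · (λ l → A l i′)                             ≡⟨ ℤ.+-identityˡ _ ⟨
        + 0 ℤ.* unit i i′ ℤ.+ (v ∘ suc) · (λ l → A l i′)       ≡⟨ cong (λ s → s ℤ.* unit i i′ ℤ.+ (v ∘ suc) · (λ l → A l i′)) v₀≡0 ⟨
        v · (λ l → basis l i′)                                 ≡⟨ relation i′ ⟩
        + 0                                                    ∎
      all≡0 : ∀ l → v l ≡ + 0
      all≡0 zero    = v₀≡0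
      all≡0 (suc l) = indep (v ∘ suc) tail≡0 l

    solved : ∀ x → v zero ℤ.* x i ℤ.+ (v ∘ suc) · (λ l → A l · x) ≡ + 0
    solved x = begin
      v zero ℤ.* x i ℤ.+ (v ∘ suc) · (λ l → A l · x)       ≡⟨ cong (λ s → v zero ℤ.* s ℤ.+ (v ∘ suc) · (λ l → A l · x)) (unit-· i x) ⟨
      v · (λ l → basis l · x)                              ≡⟨ ·-combination v basis x ⟨
      (λ i′ → v · (λ l → basis l i′)) · x                  ≡⟨ trans (·-congˡ x relation) (·-zeroˡ x) ⟩
      + 0                                                  ∎

    by-sign : ∀ q → v zero ≡ q → SmallCoordinate (siegelBound (suc k) H) A i
    by-sign (+ zero)  eq = contradiction eq leading≢0
    by-sign (+ suc n) eq = record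
      { denominator   = suc n
      ; denominator≢0 = _
      ; denominator≤  = subst (λ q → ∣ q ∣ ≤ siegelBound (suc k) H) eq (v≤ zero)
      ; coefficients  = v ∘ suc
      ; coefficients≤ = v≤ ∘ suc
      ; solves        = λ x → trans (cong (λ q → q ℤ.* x i ℤ.+ (v ∘ suc) · (λ l → A l · x)) (sym eq)) (solved x)
      }
    -- The denominator has to be positive, so the whole relation is negated.
    by-sign -[1+ n ]  eq = record
      { denominator   = suc n
      ; denominator≢0 = _
      ; denominator≤  = subst (λ q → ∣ q ∣ ≤ siegelBound (suc k) H) eq (v≤ zero)
      ; coefficients  = λ l → -[1+ 0 ] ℤ.* v (suc l)
      ; coefficients≤ = λ l → subst (_≤ siegelBound (suc k) H)
          (sym (trans (cong ∣_∣ (ℤ.-1*i≡-i (v (suc l)))) (ℤ.∣-i∣≡∣i∣ (v (suc l))))) (v≤ (suc l))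
      ; solves        = λ x → begin
          + suc n ℤ.* x i ℤ.+ (λ l → -[1+ 0 ] ℤ.* v (suc l)) · (λ l → A l · x)
            ≡⟨ cong₂ (λ q s → q ℤ.* x i ℤ.+ s) (trans (cong ℤ.-_ (sym eq)) (sym (ℤ.-1*i≡-i (v zero))))
                 (·-scaleˡ -[1+ 0 ] (v ∘ suc) (λ l → A l · x)) ⟩
          -[1+ 0 ] ℤ.* v zero ℤ.* x i ℤ.+ -[1+ 0 ] ℤ.* ((v ∘ suc) · (λ l → A l · x))
            ≡⟨ factor -[1+ 0 ] (v zero) (x i) ((v ∘ suc) · (λ l → A l · x)) ⟩
          -[1+ 0 ] ℤ.* (v zero ℤ.* x i ℤ.+ (v ∘ suc) · (λ l → A l · x))
            ≡⟨ cong (λ s → -[1+ 0 ] ℤ.* s) (solved x) ⟩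
          + 0 ∎
      }
      where
      factor : ∀ e q x s → e ℤ.* q ℤ.* x ℤ.+ e ℤ.* s ≡ e ℤ.* (q ℤ.* x ℤ.+ s)
      factor = ℤ.solve-∀

-- The product of all denominators is taken, and `μ i` is the product of the others.
commonMultiple : ∀ {k} (q : Fin k → ℕ) B → (∀ i → NonZero (q i)) → (∀ i → q i ≤ B) →
                 Σ[ Q ∈ ℕ ] NonZero Q × Q ≤ B ^ k × (Σ[ μ ∈ (Fin k → ℕ) ] (∀ i → μ i ≤ B ^ k) × (∀ i → μ i * q i ≡ Q))
commonMultiple {zero}  q B q≢0 q≤B = 1 , _ , s≤s z≤n , (λ ()) , (λ ()) , (λ ())
commonMultiple {suc k} q B q≢0 q≤B with commonMultiple (q ∘ suc) B (q≢0 ∘ suc) (q≤B ∘ suc)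
... | Q , Q≢0 , Q≤ , μ , μ≤ , μq≡Q =
  q zero * Q , ℕ.m*n≢0 (q zero) Q {{q≢0 zero}} {{Q≢0}} , ℕ.*-mono-≤ (q≤B zero) Q≤ ,
  (Q Vector.∷ (λ i → q zero * μ i)) ,
  (λ { zero    → ℕ.≤-trans Q≤ (ℕ.m≤n*m (B ^ k) B {{B≢0}})
     ; (suc i) → ℕ.*-mono-≤ (q≤B zero) (μ≤ i) }) ,
  (λ { zero    → ℕ.*-comm Q (q zero)
     ; (suc i) → trans (ℕ.*-assoc (q zero) (μ i) (q (suc i))) (cong (q zero *_) (μq≡Q i)) })
  where
  B≢0 : NonZero B
  B≢0 = ℕ.>-nonZero (ℕ.≤-trans (ℕ.>-nonZero⁻¹ (q zero) {{q≢0 zero}}) (q≤B zero))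

-- A cofactor of at most `B ^ k` times a combination of `k` numbers, each at most `nearBound + H`,
-- with coefficients at most `B`. The `suc` lets the same bound cover the common denominator, which
-- is at most `B ^ k`.
parameterBound : ℕ → ℕ → ℕ → ℕ
parameterBound k H M = B ^ k * suc (k * (B * (k * (H * (M * siegelBound k H)) + H)))
  where
  B : ℕ
  B = siegelBound (suc k) H

record Parametrised {k m} (y : Vector ℤ m) (x : Vector ℤ k) (T : ℕ) : Set where
  field
    denominator   : ℕ
    denominator≢0 : NonZero denominator
    denominator≤  : denominator ≤ T
    numerator     : Fin k → Fin (suc m) → ℤ
    numerator≤    : ∀ i j → ∣ numerator i j ∣ ≤ T
    solves        : ∀ i → + denominator ℤ.* x i ℤ.+ numerator i zero ≡ (numerator i ∘ suc) · y

module Parametrise {p k m : ℕ} (L : Fin p → Vector ℤ (k + m)) (g : Fin p → ℤ) (y : Vector ℤ m)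
                   (coordinates : ∀ i → ∃[ j ] ∀ (x : Vector ℤ k) → L j · (_++_ {n = m} x (const (+ 0))) ≡ x i)
                   (H : ℕ) (1≤H : 1 ≤ H) (L≤H : ∀ j i → ∣ L j i ∣ ≤ H) (g≤H : ∀ j → ∣ g j ∣ ≤ H)
                   (M : ℕ) (M≢0 : NonZero M) (x₀ : Vector ℤ k) where

  A : Fin p → Vector ℤ k
  A j i = L j (i ↑ˡ m)

  C : Fin p → Vector ℤ m
  C j i = L j (k ↑ʳ i)

  γ : Fin p → ℤ
  γ j = g j ℤ.- C j · y

  A≤H : ∀ j i → ∣ A j i ∣ ≤ H
  A≤H j i = L≤H j (i ↑ˡ m)

  spanning : ∀ v → (∃[ i ] v i ≢ + 0) → ∃[ j ] A j · v ≢ + 0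
  spanning v (i , vᵢ≢0) = let j , eq = coordinates i in
    j , λ Av≡0 → vᵢ≢0 (begin
      v i                                        ≡⟨ eq v ⟨
      L j · (v ++ const (+ 0))                   ≡⟨ ·-++ (L j) v (const (+ 0)) ⟩
      A j · v ℤ.+ C j · const (+ 0)              ≡⟨ cong₂ ℤ._+_ Av≡0 (·-zeroʳ (C j)) ⟩
      + 0                                        ∎)
    where open ≡-Reasoning

  open Arrangement A γ spanning H 1≤H A≤H M M≢0 public

  height-++ : ∀ j x → height j x ≡ L j · (x ++ y) ℤ.- g j
  height-++ j x = trans (regroup (A j · x) (g j) (C j · y)) (cong (ℤ._- g j) (sym (·-++ (L j) x y)))
    where
    regroup : ∀ a g c → a ℤ.- (g ℤ.- c) ≡ a ℤ.+ c ℤ.- g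
    regroup = ℤ.solve-∀

  vertex : Near x₀ k
  vertex = nearVertex x₀ k ℕ.≤-refl

  open Near vertex public using (point; steps; congruent; sameSide)
  open Near vertex using (chosen; close; independent)

  private
    B : ℕ
    B = siegelBound (suc k) H

  parametrised : Parametrised y point (parameterBound k H M)
  parametrised = fromCoordinates
    (λ i → smallCoordinate H 1≤H (A ∘ chosen) (λ l → A≤H (chosen l)) independent i)
    where
    fromCoordinates : (∀ i → SmallCoordinate B (A ∘ chosen) i) → Parametrised y point (parameterBound k H M)
    fromCoordinates small with commonMultiple (SmallCoordinate.denominator ∘ small) B
                         (SmallCoordinate.denominator≢0 ∘ small) (SmallCoordinate.denominator≤ ∘ small)
    ... | Q , Q≢0 , Q≤ , μ , μ≤ , μq≡Q = record
      { denominator   = Q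
      ; denominator≢0 = Q≢0
      ; denominator≤  = ℕ.≤-trans Q≤ (ℕ.m≤m*n (B ^ k) _)
      ; numerator     = X
      ; numerator≤    = X≤
      ; solves        = solves
      }
      where
      c : Fin k → Vector ℤ k
      c i = SmallCoordinate.coefficients (small i)

      q : Fin k → ℕ
      q i = SmallCoordinate.denominator (small i)

      -- As `level l` equals `A · point + C · y` for the `l`-th chosen hyperplane, `A · point` is a
      -- bounded number minus `C · y`. The bounded part goes into column 0 of `X`, while the small
      -- entries of `C` give the coefficients of `y`.
      level : Vector ℤ k
      level l = height (chosen l) point ℤ.+ g (chosen l)

      X : Fin k → Fin (suc m) → ℤ
      X i zero    = + μ i ℤ.* (c i · level)
      X i (suc j) = + μ i ℤ.* (c i · (λ l → C (chosen l) j))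

      product≤ : ∀ i (z : Vector ℤ k) → (∀ l → ∣ z l ∣ ≤ nearBound + H) →
              ∣ + μ i ℤ.* (c i · z) ∣ ≤ parameterBound k H M
      product≤ i z z≤ = ℕ.≤-trans (ℕ.≤-reflexive (ℤ.abs-* (+ μ i) (c i · z)))
        (ℕ.*-mono-≤ (μ≤ i) (ℕ.m≤n⇒m≤1+n (·-bound (c i) z (SmallCoordinate.coefficients≤ (small i)) z≤)))

      X≤ : ∀ i j → ∣ X i j ∣ ≤ parameterBound k H M
      X≤ i zero    = product≤ i level (λ l → ℕ.≤-trans (ℤ.∣i+j∣≤∣i∣+∣j∣ (height (chosen l) point) (g (chosen l)))
        (ℕ.+-mono-≤ (close l) (g≤H (chosen l))))
      X≤ i (suc j) = product≤ i (λ l → C (chosen l) j) (λ l → ℕ.≤-trans (L≤H (chosen l) (k ↑ʳ j)) (ℕ.m≤n+m H nearBound))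

      level-split : ∀ l → level l ≡ A (chosen l) · point ℤ.+ C (chosen l) · y
      level-split l = regroup (A (chosen l) · point) (g (chosen l)) (C (chosen l) · y)
        where
        regroup : ∀ a g c → a ℤ.- (g ℤ.- c) ℤ.+ g ≡ a ℤ.+ c
        regroup = ℤ.solve-∀

      coordinate : ∀ i → + q i ℤ.* point i ℤ.+ c i · level ≡ c i · (λ l → C (chosen l) · y)
      coordinate i = begin
        + q i ℤ.* point i ℤ.+ c i · level
          ≡⟨ cong (λ s → + q i ℤ.* point i ℤ.+ s) (trans (·-congʳ (c i) level-split)
               (·-distribˡ (c i) (λ l → A (chosen l) · point) (λ l → C (chosen l) · y))) ⟩
        + q i ℤ.* point i ℤ.+ (c i · (λ l → A (chosen l) · point) ℤ.+ c i · (λ l → C (chosen l) · y))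
          ≡⟨ ℤ.+-assoc (+ q i ℤ.* point i) _ _ ⟨
        + q i ℤ.* point i ℤ.+ c i · (λ l → A (chosen l) · point) ℤ.+ c i · (λ l → C (chosen l) · y)
          ≡⟨ cong (ℤ._+ c i · (λ l → C (chosen l) · y)) (SmallCoordinate.solves (small i) point) ⟩
        + 0 ℤ.+ c i · (λ l → C (chosen l) · y)
          ≡⟨ ℤ.+-identityˡ _ ⟩
        c i · (λ l → C (chosen l) · y) ∎
        where open ≡-Reasoning

      solves : ∀ i → + Q ℤ.* point i ℤ.+ X i zero ≡ (X i ∘ suc) · y
      solves i = begin
        + Q ℤ.* point i ℤ.+ + μ i ℤ.* (c i · level)
          ≡⟨ cong (λ s → s ℤ.* point i ℤ.+ + μ i ℤ.* (c i · level)) (trans (cong +_ (sym (μq≡Q i))) (ℤ.pos-* (μ i) (q i))) ⟩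
        + μ i ℤ.* + q i ℤ.* point i ℤ.+ + μ i ℤ.* (c i · level)
          ≡⟨ factor (+ μ i) (+ q i) (point i) (c i · level) ⟩
        + μ i ℤ.* (+ q i ℤ.* point i ℤ.+ c i · level)
          ≡⟨ cong (λ s → + μ i ℤ.* s) (trans (coordinate i) (sym (·-combination (c i) (C ∘ chosen) y))) ⟩
        + μ i ℤ.* ((λ j → c i · (λ l → C (chosen l) j)) · y)
          ≡⟨ ·-scaleˡ (+ μ i) (λ j → c i · (λ l → C (chosen l) j)) y ⟨
        (X i ∘ suc) · y ∎
        where
        open ≡-Reasoning
        factor : ∀ e q x s → e ℤ.* q ℤ.* x ℤ.+ e ℤ.* s ≡ e ℤ.* (q ℤ.* x ℤ.+ s)
        factor = ℤ.solve-∀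

-- Truth depends only on sides of hyperplanes and residues

hyperplanes : ∀ {n} → QF ℤ n → List (Vec ℤ n × ℤ)
hyperplanes (atom (a ⊴ b))       = (a , b) ∷ []
-- A modulus 0 makes the congruence an equation, which is decided by the sign of the height.
hyperplanes (atom (a ≋ b mod q)) = (a , b) ∷ []
hyperplanes (φ ∧ ψ)              = hyperplanes φ List.++ hyperplanes ψ
hyperplanes (φ ∨ ψ)              = hyperplanes φ List.++ hyperplanes ψ
hyperplanes (~ φ)                = hyperplanes φ

-- A modulus 0 must not annihilate the product of the moduli, by which the walk steps.
1⊔_ : ℕ → ℕ
1⊔ zero  = 1
1⊔ suc n = suc n

1⊔-nonZero : ∀ n → NonZero (1⊔ n)
1⊔-nonZero zero    = _
1⊔-nonZero (suc n) = _

period : ∀ {n} → QF ℤ n → ℕ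
period (atom (a ⊴ b))       = 1
period (atom (a ≋ b mod q)) = 1⊔ ∣ q ∣
period (φ ∧ ψ)              = period φ * period ψ
period (φ ∨ ψ)              = period φ * period ψ
period (~ φ)                = period φ

period-nonZero : ∀ {n} (φ : QF ℤ n) → NonZero (period φ)
period-nonZero (atom (a ⊴ b))       = _
period-nonZero (atom (a ≋ b mod q)) = 1⊔-nonZero ∣ q ∣
period-nonZero (φ ∧ ψ)              = ℕ.m*n≢0 (period φ) (period ψ) {{period-nonZero φ}} {{period-nonZero ψ}}
period-nonZero (φ ∨ ψ)              = ℕ.m*n≢0 (period φ) (period ψ) {{period-nonZero φ}} {{period-nonZero ψ}}
period-nonZero (~ φ)                = period-nonZero φ

Alike : ℕ → ℤ → ℤ → Set
Alike M u v = signum v ≡ signum u × ∃[ d ] v ≡ u ℤ.+ + M ℤ.* d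

alike-sym : ∀ {M u v} → Alike M u v → Alike M v u
alike-sym {M} {u} (same , d , refl) = sym same , ℤ.- d , sym (cancel u (+ M) d)
  where
  cancel : ∀ u m d → u ℤ.+ m ℤ.* d ℤ.+ m ℤ.* ℤ.- d ≡ u
  cancel = ℤ.solve-∀

alike-≤0 : ∀ {M} u v → Alike M u v → u ℤ.≤ + 0 → v ℤ.≤ + 0
alike-≤0 (+ zero)  (+ zero)  (same , _) u≤0 = ℤ.+≤+ z≤n
alike-≤0 (+ zero)  (+ suc v) (() , _)
alike-≤0 (+ suc u) v         (same , _) (ℤ.+≤+ ())
alike-≤0 -[1+ u ]  (+ zero)  (() , _)
alike-≤0 -[1+ u ]  (+ suc v) (() , _)
alike-≤0 u         -[1+ v ]  (same , _) u≤0 = ℤ.-≤+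

-- For `q` equal to zero, divisibility says that the number is zero, which its sign determines.
-- Otherwise `q` divides `M`, and adding a multiple of `M` does no harm.
alike-∣ : ∀ {M} q u v → 1⊔ ∣ q ∣ ℕ.∣ M → Alike M u v → q ℤ.∣ u → q ℤ.∣ v
alike-∣ {M} q u v M∣ (same , d , v≡) q∣u = by-modulus ∣ q ∣ refl
  where
  signum≡0 : ∀ v → signum v ≡ + 0 → v ≡ + 0
  signum≡0 (+ zero) eq = refl

  by-modulus : ∀ n → ∣ q ∣ ≡ n → ∣ q ∣ ℕ.∣ ∣ v ∣
  by-modulus zero eq = subst (λ v → ∣ q ∣ ℕ.∣ ∣ v ∣) (sym (signum≡0 v (trans same (cong signum u≡0)))) (∣ q ∣ ℕ.∣0)
    where
    u≡0 : u ≡ + 0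
    u≡0 = ℤ.∣i∣≡0⇒i≡0 (ℕ.0∣⇒≡0 (subst (ℕ._∣ ∣ u ∣) eq q∣u))
  by-modulus (suc n) eq = subst (q ℤ.∣_) (sym v≡) (Signed.∣⇒∣ᵤ (Signed.∣m∣n⇒∣m+n (Signed.∣ᵤ⇒∣ {q} {u} q∣u)
    (Signed.∣m⇒∣m*n d (Signed.∣ᵤ⇒∣ {q} {+ M} (subst (ℕ._∣ M) (trans (cong 1⊔_ eq) (sym eq)) M∣)))))

module _ {n} (x x′ : Vector ℤ n) (M : ℕ) where

  AlikeAt : Vec ℤ n × ℤ → Set
  AlikeAt (a , b) = Alike M (lookup a · x ℤ.- b) (lookup a · x′ ℤ.- b)

  alike-⟦⟧ : ∀ φ → period φ ℕ.∣ M → All AlikeAt (hyperplanes φ) →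
             (⟦ φ ⟧ id x → ⟦ φ ⟧ id x′) × (⟦ φ ⟧ id x′ → ⟦ φ ⟧ id x)
  alike-⟦⟧ (atom (a ⊴ b)) _ (al ∷ []) =
    (λ le → ℤ.i-j≤0⇒i≤j (alike-≤0 {M} _ _ al (ℤ.i≤j⇒i-j≤0 le))) ,
    (λ le → ℤ.i-j≤0⇒i≤j (alike-≤0 {M} _ _ (alike-sym {M} al) (ℤ.i≤j⇒i-j≤0 le)))
  alike-⟦⟧ (atom (a ≋ b mod q)) M∣ (al ∷ []) = alike-∣ {M} q _ _ M∣ al , alike-∣ {M} q _ _ M∣ (alike-sym {M} al)
  alike-⟦⟧ (φ ∧ ψ) M∣ als =
    let alsφ , alsψ = All.++⁻ (hyperplanes φ) als
        f , f′ = alike-⟦⟧ φ (ℕ.m*n∣⇒m∣ (period φ) (period ψ) M∣) alsφ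
        g , g′ = alike-⟦⟧ ψ (ℕ.m*n∣⇒n∣ (period φ) (period ψ) M∣) alsψ
    in (λ (h , i) → f h , g i) , (λ (h , i) → f′ h , g′ i)
  alike-⟦⟧ (φ ∨ ψ) M∣ als =
    let alsφ , alsψ = All.++⁻ (hyperplanes φ) als
        f , f′ = alike-⟦⟧ φ (ℕ.m*n∣⇒m∣ (period φ) (period ψ) M∣) alsφ
        g , g′ = alike-⟦⟧ ψ (ℕ.m*n∣⇒n∣ (period φ) (period ψ) M∣) alsψ
    in Sum.map f g , Sum.map f′ g′
  alike-⟦⟧ (~ φ) M∣ als = let f , f′ = alike-⟦⟧ φ M∣ als in (λ h → h ∘ f′) , (λ h → h ∘ f)

++-all : ∀ {A : Set} {P : A → Set} {p q} (f : Vector A p) (g : Vector A q) →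
         (∀ i → P (f i)) → (∀ j → P (g j)) → ∀ i → P ((f ++ g) i)
++-all {p = p} f g all-f all-g i with splitAt p i
... | inj₁ i′ = all-f i′
... | inj₂ j  = all-g j

smallSolution : ∀ {k m} (φ : QF ℤ (k + m)) H → 1 ≤ H →
                All (λ (a , b) → (∀ i → ∣ lookup a i ∣ ≤ H) × ∣ b ∣ ≤ H) (hyperplanes φ) →
                ∀ (x : Vector ℤ k) (y : Vector ℤ m) → ⟦ φ ⟧ id (x ++ y) →
                ∃[ x′ ] ⟦ φ ⟧ id (x′ ++ y) × Parametrised y x′ (parameterBound k H (period φ))
smallSolution {k} {m} φ H 1≤H small x y holds =
  point , proj₁ (alike-⟦⟧ (x ++ y) (point ++ y) (period φ) φ ℕ.∣-refl 
    (All.tabulate (λ h∈hs → subst (AlikeAt (x ++ y) (point ++ y) (period φ))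
      (sym (lookup-index h∈hs)) (alikes (index h∈hs))))) holds ,
  parametrised
  where
  Hyperplane : Set
  Hyperplane = Vector ℤ (k + m) × ℤ

  axes : Vector Hyperplane k
  axes i = unit (i ↑ˡ m) , + 0

  hs : List (Vec ℤ (k + m) × ℤ)
  hs = hyperplanes φ

  faces : Vector Hyperplane (List.length hs)
  faces j = lookup (proj₁ (List.lookup hs j)) , proj₂ (List.lookup hs j)

  family : Vector Hyperplane (k + List.length hs)
  family = axes ++ faces

  bounded : ∀ j → (∀ i → ∣ proj₁ (family j) i ∣ ≤ H) × ∣ proj₂ (family j) ∣ ≤ H
  bounded = ++-all {P = λ (a , b) → (∀ i → ∣ a i ∣ ≤ H) × ∣ b ∣ ≤ H} axes faces
    (λ i → (λ j → ℕ.≤-trans (∣unit∣≤1 (i ↑ˡ m) j) 1≤H) , z≤n)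
    (λ j → All.lookup small (∈-lookup j))

  coordinates : ∀ i → ∃[ j ] ∀ x → proj₁ (family j) · (x ++ const (+ 0)) ≡ x i
  coordinates i = i ↑ˡ List.length hs , λ x → begin
    proj₁ (family (i ↑ˡ List.length hs)) · (x ++ const (+ 0))
      ≡⟨ ·-congˡ (x ++ const (+ 0)) (λ l → cong (λ h → proj₁ h l) (lookup-++ˡ axes faces i)) ⟩
    unit (i ↑ˡ m) · (x ++ const (+ 0))
      ≡⟨ unit-· (i ↑ˡ m) (x ++ const (+ 0)) ⟩
    (x ++ const (+ 0)) (i ↑ˡ m)
      ≡⟨ lookup-++ˡ x (const (+ 0)) i ⟩
    x i ∎
    where open ≡-Reasoning

  open Parametrise (proj₁ ∘ family) (proj₂ ∘ family) y coordinates H 1≤H (proj₁ ∘ bounded) (proj₂ ∘ bounded)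
    (period φ) (period-nonZero φ) x

  alikes : ∀ j → AlikeAt (x ++ y) (point ++ y) (period φ) (List.lookup hs j)
  alikes j = subst (λ (a , b) → Alike (period φ) (a · (x ++ y) ℤ.- b) (a · (point ++ y) ℤ.- b))
    (lookup-++ʳ axes faces j)
    (subst₂ (Alike (period φ)) (height-++ j′ x) (height-++ j′ point)
      (sameSide j′ , A j′ · steps , height-+ j′ (+ period φ) steps congruent))
    where
    j′ = k ↑ʳ j

-- Sizes of encodings

n≤2^n : ∀ n → n ≤ 2 ^ n
n≤2^n zero    = z≤n
n≤2^n (suc n) = begin
  suc n              ≤⟨ ℕ.+-mono-≤ (ℕ.m^n>0 2 n) (n≤2^n n) ⟩
  2 ^ n + 2 ^ n      ≤⟨ ℕ.+-monoʳ-≤ (2 ^ n) (ℕ.m≤m+n (2 ^ n) 0) ⟩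
  2 ^ suc n          ∎
  where open ℕ.≤-Reasoning

suc-2^ : ∀ {a} b → a ≤ 2 ^ b → suc a ≤ 2 ^ suc b
suc-2^ b a≤ = ℕ.+-mono-≤ (ℕ.m^n>0 2 b) (ℕ.≤-trans a≤ (ℕ.m≤m+n (2 ^ b) 0))

*-2^ : ∀ {a b} c d → a ≤ 2 ^ c → b ≤ 2 ^ d → a * b ≤ 2 ^ (c + d)
*-2^ c d a≤ b≤ = ℕ.≤-trans (ℕ.*-mono-≤ a≤ b≤) (ℕ.≤-reflexive (sym (ℕ.^-distribˡ-+-* 2 c d)))

^-2^ : ∀ {a n} c d → a ≤ 2 ^ c → n ≤ d → a ^ n ≤ 2 ^ (c * d)
^-2^ {a} {n} c d a≤ n≤d = begin
  a ^ n            ≤⟨ ℕ.^-monoˡ-≤ n a≤ ⟩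
  (2 ^ c) ^ n      ≤⟨ ℕ.^-monoʳ-≤ (2 ^ c) {{ℕ.m^n≢0 2 c}} n≤d ⟩
  (2 ^ c) ^ d      ≡⟨ ℕ.^-*-assoc 2 c d ⟩
  2 ^ (c * d)      ∎
  where open ℕ.≤-Reasoning

weaken-2^ : ∀ {a b c} → b ≤ c → a ≤ 2 ^ b → a ≤ 2 ^ c
weaken-2^ b≤c a≤ = ℕ.≤-trans a≤ (ℕ.^-monoʳ-≤ 2 b≤c)

-- The successor suits the induction: `2[1+ b ]` has twice the value of `suc (toℕ b)`.
toℕ<2^size : ∀ b → suc (ℕᵇ.toℕ b) ≤ 2 ^ size (encodeℕᵇ b)
toℕ<2^size ℕᵇ.zero  = s≤s z≤n
toℕ<2^size 2[1+ b ] = suc-2^ (1 + size (encodeℕᵇ b)) (ℕ.*-monoʳ-≤ 2 (toℕ<2^size b))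
toℕ<2^size 1+[2 b ] = ℕ.≤-trans
  (suc-2^ (1 + size (encodeℕᵇ b)) (ℕ.≤-trans (ℕ.≤-trans (ℕ.n≤1+n _) (ℕ.≤-reflexive (sym (ℕ.*-suc 2 (ℕᵇ.toℕ b)))))
    (ℕ.*-monoʳ-≤ 2 (toℕ<2^size b))))
  (ℕ.^-monoʳ-≤ 2 (ℕ.m≤n+m (2 + size (encodeℕᵇ b)) 2))

n≤2^size : ∀ n → n ≤ 2 ^ size (encodeℕ n)
n≤2^size n = subst (_≤ 2 ^ size (encodeℕ n)) (ℕᵇ.toℕ-fromℕ n) (ℕ.<⇒≤ (toℕ<2^size (ℕᵇ.fromℕ n)))

∣i∣≤2^size : ∀ i → ∣ i ∣ ≤ 2 ^ size (encodeℤ i)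
∣i∣≤2^size (+ n)    = weaken-2^ (ℕ.m≤n+m (size (encodeℕ n)) 2) (n≤2^size n)
∣i∣≤2^size -[1+ n ] = weaken-2^ (ℕ.m≤n+m (size (encodeℕ (suc n))) 4) (n≤2^size (suc n))

1⊔-2^size : ∀ q → 1⊔ ∣ q ∣ ≤ 2 ^ size (encodeℤ q)
1⊔-2^size q = by-cases ∣ q ∣ (∣i∣≤2^size q)
  where
  by-cases : ∀ n → n ≤ 2 ^ size (encodeℤ q) → 1⊔ n ≤ 2 ^ size (encodeℤ q)
  by-cases zero    _ = ℕ.m^n>0 2 (size (encodeℤ q))
  by-cases (suc n) b = b

lookup-size : ∀ {n} (a : Vec ℤ n) i → size (encodeℤ (lookup a i)) ≤ size (encodeList encodeℤ (toList a))
lookup-size (c ∷ a) zero    = ℕ.m≤n⇒m≤1+n (ℕ.m≤m+n _ _)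
lookup-size (c ∷ a) (suc i) = ℕ.m≤n⇒m≤1+n (ℕ.≤-trans (lookup-size a i) (ℕ.m≤n+m _ (size (encodeℤ c))))

length-size : ∀ {n} (a : Vec ℤ n) → n ≤ size (encodeList encodeℤ (toList a))
length-size []      = z≤n
length-size (c ∷ a) = s≤s (ℕ.≤-trans (length-size a) (ℕ.m≤n+m _ (size (encodeℤ c))))

module _ {n : ℕ} where

  private
    left : ∀ t x y → size x ≤ size (t ∙ x ∙ y)
    left t x y = ℕ.m≤n⇒m≤1+n (ℕ.≤-trans (ℕ.m≤n⇒m≤1+n (ℕ.m≤m+n (size x) (size y))) (ℕ.m≤n+m _ (size t)))

    right : ∀ t x y → size y ≤ size (t ∙ x ∙ y)
    right t x y = ℕ.m≤n⇒m≤1+n (ℕ.≤-trans (ℕ.m≤n⇒m≤1+n (ℕ.m≤n+m (size y) (size x))) (ℕ.m≤n+m _ (size t)))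

  -- Every atom spells out all `n` coefficients, including zeros, and every formula contains an
  -- atom.
  variables≤size : (φ : QF ℤ n) → n ≤ size (encodeQF encodeℤ φ)
  variables≤size (atom (a ⊴ b))       = ℕ.≤-trans (length-size a)
    (ℕ.≤-trans (left nil _ (encodeℤ b)) (ℕ.m≤n+m _ 2))
  variables≤size (atom (a ≋ b mod q)) = ℕ.≤-trans (length-size a)
    (ℕ.≤-trans (left (encodeUnary 1) _ (encodeℤ b ∙ encodeℤ q)) (ℕ.m≤n+m _ 2))
  variables≤size (φ ∧ ψ) = ℕ.≤-trans (variables≤size φ) (left (encodeUnary 1) _ (encodeQF encodeℤ ψ))
  variables≤size (φ ∨ ψ) = ℕ.≤-trans (variables≤size φ) (left (encodeUnary 2) _ (encodeQF encodeℤ ψ))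
  variables≤size (~ φ)   = ℕ.≤-trans (variables≤size φ) (ℕ.m≤n+m _ 8)

  -- Moduli multiply along connectives while code sizes add, so the product has polynomially many
  -- bits.
  period≤ : (φ : QF ℤ n) → period φ ≤ 2 ^ size (encodeQF encodeℤ φ)
  period≤ φ@(atom (a ⊴ b))       = ℕ.m^n>0 2 (size (encodeQF encodeℤ φ))
  period≤ φ@(atom (a ≋ b mod q)) = weaken-2^
    (ℕ.≤-trans (ℕ.m≤n⇒m≤1+n (ℕ.m≤n+m _ (size (encodeℤ b))))
      (ℕ.≤-trans (right (encodeUnary 1) (encodeList encodeℤ (toList a)) (encodeℤ b ∙ encodeℤ q)) (ℕ.m≤n+m _ 2)))
    (1⊔-2^size q)
  period≤ (φ ∧ ψ) = weaken-2^ (ℕ.m≤n+m (size (encodeQF encodeℤ φ) + size (encodeQF encodeℤ ψ)) 5)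
     (*-2^ (size (encodeQF encodeℤ φ)) (size (encodeQF encodeℤ ψ)) (period≤ φ) (period≤ ψ))
  period≤ (φ ∨ ψ) = weaken-2^ (ℕ.m≤n+m (size (encodeQF encodeℤ φ) + size (encodeQF encodeℤ ψ)) 7)
     (*-2^ (size (encodeQF encodeℤ φ)) (size (encodeQF encodeℤ ψ)) (period≤ φ) (period≤ ψ))
  period≤ (~ φ)   = weaken-2^ (ℕ.m≤n+m (size (encodeQF encodeℤ φ)) 8) (period≤ φ)

  hyperplanes≤ : ∀ S (φ : QF ℤ n) → size (encodeQF encodeℤ φ) ≤ S →
                 All (λ (a , b) → (∀ i → ∣ lookup a i ∣ ≤ 2 ^ S) × ∣ b ∣ ≤ 2 ^ S) (hyperplanes φ)
  hyperplanes≤ S (atom (a ⊴ b)) le =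
    ((λ i → weaken-2^ (ℕ.≤-trans (ℕ.≤-trans (lookup-size a i) (left nil (encodeList encodeℤ (toList a)) (encodeℤ b))) le′)
              (∣i∣≤2^size (lookup a i))) ,
     weaken-2^ (ℕ.≤-trans (right nil (encodeList encodeℤ (toList a)) (encodeℤ b)) le′) (∣i∣≤2^size b)) ∷ []
    where le′ = ℕ.≤-trans (ℕ.m≤n+m _ 2) le
  hyperplanes≤ S (atom (a ≋ b mod q)) le =
    ((λ i → weaken-2^ (ℕ.≤-trans (ℕ.≤-trans (lookup-size a i)
        (left (encodeUnary 1) (encodeList encodeℤ (toList a)) (encodeℤ b ∙ encodeℤ q))) le′)
              (∣i∣≤2^size (lookup a i))) ,
     weaken-2^ (ℕ.≤-trans (ℕ.≤-trans (ℕ.m≤n⇒m≤1+n (ℕ.m≤m+n _ (size (encodeℤ q))))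
         (right (encodeUnary 1) (encodeList encodeℤ (toList a)) (encodeℤ b ∙ encodeℤ q))) le′) (∣i∣≤2^size b)) ∷ []
    where le′ = ℕ.≤-trans (ℕ.m≤n+m _ 2) le
  hyperplanes≤ S (φ ∧ ψ) le = All.++⁺
    (hyperplanes≤ S φ (ℕ.≤-trans (left (encodeUnary 1) (encodeQF encodeℤ φ) (encodeQF encodeℤ ψ)) le))
    (hyperplanes≤ S ψ (ℕ.≤-trans (right (encodeUnary 1) (encodeQF encodeℤ φ) (encodeQF encodeℤ ψ)) le))
  hyperplanes≤ S (φ ∨ ψ) le = All.++⁺
    (hyperplanes≤ S φ (ℕ.≤-trans (left (encodeUnary 2) (encodeQF encodeℤ φ) (encodeQF encodeℤ ψ)) le))
    (hyperplanes≤ S ψ (ℕ.≤-trans (right (encodeUnary 2) (encodeQF encodeℤ φ) (encodeQF encodeℤ ψ)) le))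
  hyperplanes≤ S (~ φ) le = hyperplanes≤ S φ (ℕ.≤-trans (ℕ.m≤n+m _ 8) le)

  5≤size : (φ : QF ℤ n) → 5 ≤ size (encodeQF encodeℤ φ)
  5≤size (atom (a ⊴ b))       = s≤s (s≤s (s≤s (s≤s (1≤size (encodeList encodeℤ (toList a) ∙ encodeℤ b)))))
  5≤size (atom (a ≋ b mod q)) = ℕ.m≤m+n 5 _
  5≤size (φ ∧ ψ)              = s≤s (s≤s (s≤s (s≤s (1≤size (encodeQF encodeℤ φ ∙ encodeQF encodeℤ ψ)))))
  5≤size (φ ∨ ψ)              = ℕ.m≤m+n 5 _
  5≤size (~ φ)                = ℕ.m≤m+n 5 _

-- The uniform bound and completeness

2^n≤bigBinary : ∀ n → 2 ^ n ≤ suc (ℕᵇ.toℕ (bigBinary n))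
2^n≤bigBinary zero    = ℕ.≤-refl
2^n≤bigBinary (suc n) = ℕ.m≤n⇒m≤1+n (ℕ.*-monoʳ-≤ 2 (2^n≤bigBinary n))

siegelBound-2^ : ∀ {n H} s → n ≤ s → H ≤ 2 ^ s → siegelBound n H ≤ 2 ^ (suc (suc (s + s)) * s)
siegelBound-2^ {n} {H} s n≤s H≤ = ^-2^ {siegelBase n H} (suc (suc (s + s))) s
  (suc-2^ (suc (s + s)) (ℕ.*-monoʳ-≤ 2 (*-2^ s s (ℕ.≤-trans n≤s (n≤2^n s)) H≤))) n≤s

-- Counting bits through the definition gives the exponent `2s³ + 6s² + 8s + 2`. Its successor is at
-- most `s⁴` from `s = 5` on, but not yet at `s = 4`; this is where the lower bound on the size of a
-- code enters.
parameterBound-2^ : ∀ {k M} s → suc k ≤ s → 5 ≤ s → M ≤ 2 ^ s →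
                    parameterBound k (2 ^ s) M < 2 ^ ((s * s) * (s * s))
parameterBound-2^ {k} {M} s k<s 5≤s M≤ = weaken-2^ exponent≤ (suc-2^ exponent
  (*-2^ (e * s) (suc (s + (e + suc (s + (s + (s + e)))))) (^-2^ e s B≤ k≤s)
    (suc-2^ (s + (e + suc (s + (s + (s + e))))) (*-2^ s (e + suc (s + (s + (s + e)))) k≤2^s
      (*-2^ e (suc (s + (s + (s + e)))) B≤
        (double (s + (s + (s + e))) (*-2^ s (s + (s + e)) k≤2^s
                  (*-2^ s (s + e) ℕ.≤-refl (*-2^ s e M≤ (siegelBound-2^ s k≤s ℕ.≤-refl))))
                (ℕ.^-monoʳ-≤ 2 (ℕ.m≤m+n s (s + (s + e))))))))))
  where
  e exponent : ℕ
  e        = suc (suc (s + s)) * s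
  exponent = e * s + suc (s + (e + suc (s + (s + (s + e)))))

  k≤s : k ≤ s
  k≤s = ℕ.<⇒≤ k<s

  k≤2^s : k ≤ 2 ^ s
  k≤2^s = ℕ.≤-trans k≤s (n≤2^n s)

  B≤ : siegelBound (suc k) (2 ^ s) ≤ 2 ^ e
  B≤ = siegelBound-2^ s k<s ℕ.≤-refl

  double : ∀ {a b} c → a ≤ 2 ^ c → b ≤ 2 ^ c → a + b ≤ 2 ^ suc c
  double c a≤ b≤ = ℕ.+-mono-≤ a≤ (ℕ.≤-trans b≤ (ℕ.m≤m+n (2 ^ c) 0))

  exponent≤ : suc exponent ≤ (s * s) * (s * s)
  exponent≤ with ℕ.m≤n⇒∃[o]m+o≡n 5≤s
  -- With `s = 5 + t`, the difference of the two sides is a polynomial in `t` with nonnegative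
  -- coefficients, namely the one added here.
  ... | t , refl = ℕ.≤-trans (ℕ.m≤m+n _ (t * t * t * t + 18 * (t * t * t) + 114 * (t * t) + 282 * t + 182))
    (ℕ.≤-reflexive (expand t))
    where
    expand : ∀ t → (let s = 5 + t; e = suc (suc (s + s)) * s in
             suc (e * s + suc (s + (e + suc (s + (s + (s + e))))))
               + (t * t * t * t + 18 * (t * t * t) + 114 * (t * t) + 282 * t + 182))
           ≡ (let s = 5 + t in (s * s) * (s * s))
    expand = solve-∀

translate-complete : ∀ {m} (ψ : ∃PA m) y → y ⊨∃ ψ → y ⊨∃≤ translate ψ
translate-complete {m} ψ@(∃^ k ∶ φ) y (x , holds) =
  fromSmall (smallSolution φ (2 ^ s) (ℕ.m^n>0 2 s) (hyperplanes≤ s φ φ≤s) x y holds)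
  where
  s T B : ℕ
  s = size (encode∃PA ψ)
  T = parameterBound k (2 ^ s) (period φ)
  B = ℕᵇ.toℕ (bigBinary ((s * s) * (s * s)))

  φ≤s : size (encodeQF encodeℤ φ) ≤ s
  φ≤s = ℕ.m≤n⇒m≤1+n (ℕ.m≤n+m _ (size (encodeUnary k)))

  k<s : suc k ≤ s
  k<s = s≤s (ℕ.≤-trans (ℕ.m≤m+n k m) (ℕ.≤-trans (variables≤size φ) (ℕ.m≤n+m _ (size (encodeUnary k)))))

  T≤B : T ≤ B
  T≤B = ℕ.≤-pred (ℕ.≤-trans
    (parameterBound-2^ s k<s (ℕ.≤-trans (5≤size φ) φ≤s) (weaken-2^ φ≤s (period≤ φ)))
    (2^n≤bigBinary ((s * s) * (s * s))))

  fromSmall : (∃[ x′ ] ⟦ φ ⟧ id (x′ ++ y) × Parametrised y x′ T) → y ⊨∃≤ translate ψ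
  fromSmall (x′ , holds′ , small) = v ,
    (λ i → subst (∣ v i ∣ ≤_) (sym (lookup-replicate i B)) (ℕ.≤-trans (v≤T i) T≤B)) ,
    integral-complete v y (entry {k} {m}) _ integrality
      (positive-complete v y Q>0 , translateQF-complete v y x′ Q>0 solves′ φ holds′)
    where
    open Parametrised small

    v : Vector ℤ (suc (k * suc m))
    v zero    = + denominator
    v (suc i) = uncurry numerator (remQuot {k} (suc m) i)

    v-entry : ∀ i j → v (entry i j) ≡ numerator i j
    v-entry i j = cong (uncurry numerator) (Fin.remQuot-combine i j)

    v≤T : ∀ i → ∣ v i ∣ ≤ T
    v≤T zero    = denominator≤
    v≤T (suc i) = numerator≤ _ _

    Q>0 : ℤ.Positive (v zero)
    Q>0 = nonZero⇒positive denominator denominator≢0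
      where
      nonZero⇒positive : ∀ n → NonZero n → ℤ.Positive (+ n)
      nonZero⇒positive (suc n) _ = _

    solves′ : ∀ i → v zero ℤ.* x′ i ℤ.+ v (entry i zero) ≡ (λ j → v (entry i (suc j))) · y
    solves′ i = trans (cong (λ z → + denominator ℤ.* x′ i ℤ.+ z) (v-entry i zero))
      (trans (solves i) (·-congˡ y (λ j → sym (v-entry i (suc j)))))

    integrality : Integral v y (entry {k} {m})
    integrality i = subst (v zero ℤ.∣_)
      (trans (sym (i+k-k≡i (v zero ℤ.* x′ i) (v (entry i zero)))) (cong (ℤ._- v (entry i zero)) (solves′ i)))
      (Signed.∣⇒∣ᵤ {v zero} {v zero ℤ.* x′ i} (Signed.∣m⇒∣m*n (x′ i) Signed.∣-refl))

theorem3p1 : Σ[ P ∈ Program ] Σ[ c ∈ ℕ ] Σ[ d ∈ ℕ ]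
    (∀ (m : ℕ) (φ : ∃PA m) →
    Σ[ ψ ∈ ∃≤PA m ] Σ[ t ∈ ℕ ]
    (P ⊢ encode∃PA φ ⇓ encode∃≤PA ψ ⟨ t ⟩)
    × t ≤ c * size (encode∃PA φ) ^ d
    × ((y : Vector ℤ m) → (y ⊨∃ φ) ⇔ (y ⊨∃≤ ψ)))
theorem3p1 =
  let c , d , bound≤ = monomial-bound (PolyTime.bound translateTreeᵖ) in
  PolyTime.program translateTreeᵖ , c , d , λ m φ →
    let t , runs , t≤ = PolyTime.run translateTreeᵖ (encode∃PA φ) in
    translate φ , t ,
    subst (λ u → PolyTime.program translateTreeᵖ ⊢ encode∃PA φ ⇓ u ⟨ t ⟩) (translateTree-encode φ) runs ,
    ℕ.≤-trans t≤ (bound≤ (size (encode∃PA φ)) (1≤size (encode∃PA φ))) ,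
    λ y → mk⇔ (translate-complete φ y) (translate-sound φ y)
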